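{- Let $\mathsf{M}$ be a nonempty loopless matroid. Then \[\underline{\mathrm{H}}_{\mathsf{M}}(x)=\sum_{\substack{F\in\mathcal{L}(\mathsf{M})\\ F\neq\varnothing}}\overline{\chi}_{\mathsf{M}|_F}(x)\,\underline{\mathrm{H}}_{\mathsf{M}/F}(x).\] In particular, this recursion (for nonempty loopless matroids) together with the initial condition $\underline{\mathrm{H}}_{\mathsf{U}_{0,0}}(x)=1$ uniquely determines the map assigning to each loopless matroid $\mathsf{M}$ the Hilbert series $\underline{\mathrm{H}}_{\mathsf{M}}(x)$ of its Chow ring.
   Context: For a loopless matroid $\mathsf{M}$ on a finite set $E$: $\mathcal{L}(\mathsf{M})$ is the lattice of flats, $\mu$ its Möbius function, $\operatorname{rk}$ the rank; for a flat $F$, $\mathsf{M}|_F$ is the restriction to $F$ and $\mathsf{M}/F$ the contraction by $F$ (both loopless). $\mathsf{U}_{0,0}$ is the empty matroid. The characteristic polynomial is $\chi_{\mathsf{M}}(x)=\sum_{F\in\mathcal{L}(\mathsf{M})}\mu(\varnothing,F)x^{\operatorname{rk}(E)-\operatorname{rk}(F)}$; for nonempty loopless $\mathsf{M}$ it is divisible by $x-1$ and the reduced characteristic polynomial is $\overline{\chi}_{\mathsf{M}}(x)=\chi_{\mathsf{M}}(x)/(x-1)$ (with the convention $\overline{\chi}_{\mathsf{U}_{0,0}}(x)=-1$). The Chow ring $\underline{\mathrm{CH}}(\mathsf{M})=\mathbb{Q}[x_F:F\in\mathcal{L}(\mathsf{M})\smallsetminus\{\varnothing,E\}]/(I+J)$,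 with $I$ generated by $x_{F_1}x_{F_2}$ for incomparable $F_1,F_2$ and $J$ by $\sum_{F\ni i}x_F-\sum_{F\ni j}x_F$ ($i,j\in E$), graded with $\deg x_F=1$; $\underline{\mathrm{H}}_{\mathsf{M}}(x)$ is its Hilbert series. -}

module Defs where

open import Data.Bool using (Bool; true; false; _∧_; _∨_; not; if_then_else_)
open import Data.Nat as ℕ using (ℕ; zero; suc; _∸_; _≤_; _≡ᵇ_; _<ᵇ_; _≤ᵇ_)
open import Data.Integer as ℤ using (ℤ; +_)
open import Data.Rational as ℚ using (ℚ; 0ℚ; 1ℚ)
open import Data.Fin as Fin using (Fin)
open import Data.Fin.Subset
  using (Subset; _∪_; _∩_; _─_; ∁; ⁅_⁆; ∣_∣; _⊆_; _∈_; ⊥; ⊤; Nonempty)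
open import Data.Fin.Subset.Properties using (_⊆?_; _∈?_)
open import Data.Vec using (Vec; []; _∷_)
open import Data.List as List using (List; []; _∷_; filter; length; map; concatMap; upTo; allFin; foldr)
open import Data.Product using (Σ; ∃; _×_; _,_)
open import Relation.Nullary using (does; ¬_)
open import Relation.Binary.PropositionalEquality using (_≡_)

sumℤ : List ℤ → ℤ
sumℤ = foldr ℤ._+_ (+ 0)

sumℚ : List ℚ → ℚ
sumℚ = foldr ℚ._+_ 0ℚ

ΣFinℚ : (d : ℕ) → (Fin d → ℚ) → ℚ
ΣFinℚ d f = sumℚ (map f (allFin d))

allᶠ : (n : ℕ) → (Fin n → Bool) → Bool
allᶠ n p = foldr (λ i b → p i ∧ b) true (allFin n)

anyᶠ : (n : ℕ) → (Fin n → Bool) → Bool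
anyᶠ n p = foldr (λ i b → p i ∨ b) false (allFin n)

_⊆ᵇ_ : {n : ℕ} → Subset n → Subset n → Bool
X ⊆ᵇ Y = does (X ⊆? Y)

_∈ᵇ_ : {n : ℕ} → Fin n → Subset n → Bool
i ∈ᵇ X = does (i ∈? X)

_≡ˢ_ : {n : ℕ} → Subset n → Subset n → Bool
X ≡ˢ Y = (X ⊆ᵇ Y) ∧ (Y ⊆ᵇ X)

isEmptyᵇ : {n : ℕ} → Subset n → Bool
isEmptyᵇ X = X ⊆ᵇ ⊥

allSubsets : (n : ℕ) → List (Subset n)
allSubsets zero = [] ∷ []
allSubsets (suc n) =
  map (true ∷_) (allSubsets n) List.++ map (false ∷_) (allSubsets n)

record MatroidData (n : ℕ) : Set where
  constructor matroid
  field
    ground : Subset n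
    rk     : Subset n → ℕ
open MatroidData public

record IsMatroid {n : ℕ} (M : MatroidData n) : Set where
  field
    R1 : ∀ X → X ⊆ ground M → rk M X ≤ ∣ X ∣
    R2 : ∀ X Y → X ⊆ Y → Y ⊆ ground M → rk M X ≤ rk M Y
    R3 : ∀ X Y → X ⊆ ground M → Y ⊆ ground M →
         rk M (X ∪ Y) ℕ.+ rk M (X ∩ Y) ≤ rk M X ℕ.+ rk M Y

Loopless : {n : ℕ} → MatroidData n → Set
Loopless M = ∀ e → e ∈ ground M → rk M ⁅ e ⁆ ≡ 1

NonemptyMatroid : {n : ℕ} → MatroidData n → Set
NonemptyMatroid M = Nonempty (ground M)

EmptyMatroid : {n : ℕ} → MatroidData n → Set
EmptyMatroid M = ¬ Nonempty (ground M)

isFlatᵇ : {n : ℕ} → MatroidData n → Subset n → Bool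
isFlatᵇ {n} M F =
  (F ⊆ᵇ ground M) ∧
  allᶠ n (λ e → if (e ∈ᵇ ground M) ∧ not (e ∈ᵇ F)
                then rk M F <ᵇ rk M (F ∪ ⁅ e ⁆) else true)

flats : {n : ℕ} → MatroidData n → List (Subset n)
flats {n} M = filter (λ F → isFlatᵇ M F Data.Bool.≟ true) (allSubsets n)
  where import Data.Bool

_∣ᴹ_ : {n : ℕ} → MatroidData n → Subset n → MatroidData n
M ∣ᴹ F = matroid F (rk M)

_/ᴹ_ : {n : ℕ} → MatroidData n → Subset n → MatroidData n
M /ᴹ F = matroid (ground M ─ F) (λ X → rk M (X ∪ F) ∸ rk M F)

-- Möbius function μ(∅,F) on the lattice of flats, by the recursion
-- μ(∅,∅) = 1,  μ(∅,F) = - Σ_{G flat, G ⊊ F} μ(∅,G).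
-- (fuel argument; fuel suc n suffices since chains of flats have length ≤ n)

μ-fuel : {n : ℕ} → ℕ → MatroidData n → Subset n → ℤ
μ-fuel zero M F = + 0
μ-fuel (suc k) M F =
  if isEmptyᵇ F then + 1
  else ℤ.- sumℤ (map (μ-fuel k M)
                  (List.filter (λ G → ((G ⊆ᵇ F) ∧ not (F ⊆ᵇ G)) Data.Bool.≟ true)
                               (flats M)))
  where import Data.Bool

μ∅ : {n : ℕ} → MatroidData n → Subset n → ℤ
μ∅ {n} M F = μ-fuel (suc n) M F

Series : Set
Series = ℕ → ℤ

_*ˢ_ : Series → Series → Series
(p *ˢ q) k = sumℤ (map (λ i → p i ℤ.* q (k ∸ i)) (upTo (suc k)))

sumSeries : {A : Set} → List A → (A → Series) → Series
sumSeries xs f k = sumℤ (map (λ a → f a k) xs)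

_≈ˢ_ : Series → Series → Set
p ≈ˢ q = ∀ k → p k ≡ q k

χ : {n : ℕ} → MatroidData n → Series
χ M k = sumℤ (map (λ F → if (rk M (ground M) ∸ rk M F) ≡ᵇ k then μ∅ M F else + 0)
                  (flats M))

-- reduced characteristic polynomial χ_M(x)/(x-1) (quotient by synthetic
-- division: the coefficient of x^k is the sum of the coefficients of χ_M
-- in degrees > k; deg χ_M = rk E), with χ̄_{U_{0,0}} = -1.
χ̄ : {n : ℕ} → MatroidData n → Series
χ̄ M k =
  if isEmptyᵇ (ground M) then (if k ≡ᵇ 0 then ℤ.- (+ 1) else + 0)
  else sumℤ (map (λ i → if k <ᵇ i then χ M i else + 0)
                 (upTo (suc (rk M (ground M)))))

-- The Chow ring  CH(M) = ℚ[x_F : F ∈ L(M) ∖ {∅,E}] / (I + J)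

chowVars : {n : ℕ} → MatroidData n → List (Subset n)
chowVars M = List.filter
  (λ F → (not (isEmptyᵇ F) ∧ not (F ≡ˢ ground M)) Data.Bool.≟ true) (flats M)
  where import Data.Bool

nVars : {n : ℕ} → MatroidData n → ℕ
nVars M = length (chowVars M)

var : {n : ℕ} (M : MatroidData n) → Fin (nVars M) → Subset n
var M i = List.lookup (chowVars M) i

Monomial : ℕ → Set
Monomial m = Fin m → ℕ

consMon : {m : ℕ} → ℕ → Monomial m → Monomial (suc m)
consMon a u Fin.zero = a
consMon a u (Fin.suc i) = u i

monomials : (m k : ℕ) → List (Monomial m)
monomials zero zero = (λ ()) ∷ []
monomials zero (suc k) = []
monomials (suc m) k =
  concatMap (λ a → map (consMon a) (monomials m (k ∸ a))) (upTo (suc k))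

_≡ᵐ_ : {m : ℕ} → Monomial m → Monomial m → Bool
_≡ᵐ_ {m} u v = allᶠ m (λ i → u i ≡ᵇ v i)

_≤ᵐ_ : {m : ℕ} → Monomial m → Monomial m → Bool
_≤ᵐ_ {m} u v = allᶠ m (λ i → u i ≤ᵇ v i)

_∸ᵐ_ : {m : ℕ} → Monomial m → Monomial m → Monomial m
(u ∸ᵐ v) i = u i ∸ v i

unitMon : {m : ℕ} → Fin m → Monomial m
unitMon i j = if does (i Fin.≟ j) then 1 else 0

_+ᵐ_ : {m : ℕ} → Monomial m → Monomial m → Monomial m
(u +ᵐ v) i = u i ℕ.+ v i

Poly : ℕ → Set
Poly m = Monomial m → ℚ

record Generator (m : ℕ) : Set where
  constructor gen
  field
    degree : ℕ
    poly   : Poly m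

incomparableᵇ : {n : ℕ} → Subset n → Subset n → Bool
incomparableᵇ F G = not (F ⊆ᵇ G) ∧ not (G ⊆ᵇ F)

genI : {n : ℕ} (M : MatroidData n) → List (Generator (nVars M))
genI M = concatMap (λ i → concatMap (λ j →
           if incomparableᵇ (var M i) (var M j)
           then gen 2 (λ e → if e ≡ᵐ (unitMon i +ᵐ unitMon j) then 1ℚ else 0ℚ) ∷ []
           else []) (allFin (nVars M))) (allFin (nVars M))

linJ : {n : ℕ} (M : MatroidData n) → Fin n → Fin n → Poly (nVars M)
linJ M a b e = sumℚ (map (λ i →
    if e ≡ᵐ unitMon i
    then ((if a ∈ᵇ var M i then 1ℚ else 0ℚ) ℚ.- (if b ∈ᵇ var M i then 1ℚ else 0ℚ))
    else 0ℚ) (allFin (nVars M)))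

genJ : {n : ℕ} (M : MatroidData n) → List (Generator (nVars M))
genJ {n} M = concatMap (λ a → concatMap (λ b →
    if (a ∈ᵇ ground M) ∧ (b ∈ᵇ ground M) then gen 1 (linJ M a b) ∷ [] else [])
    (allFin n)) (allFin n)

generators : {n : ℕ} (M : MatroidData n) → List (Generator (nVars M))
generators M = genI M List.++ genJ M

-- the degree-k part of the polynomial ring: coordinates w.r.t. the
-- monomial basis of degree k
basisMon : {n : ℕ} (M : MatroidData n) → ℕ → List (Monomial (nVars M))
basisMon M k = monomials (nVars M) k

dimPoly : {n : ℕ} → MatroidData n → ℕ → ℕ
dimPoly M k = length (basisMon M k)

Deg : {n : ℕ} → MatroidData n → ℕ → Set
Deg M k = Fin (dimPoly M k) → ℚ

-- u · g, for u a monomial of degree k - deg g, as an element of degree k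
mulMon : {n : ℕ} (M : MatroidData n) (k : ℕ) →
         Monomial (nVars M) → Poly (nVars M) → Deg M k
mulMon M k u g j =
  let e = List.lookup (basisMon M k) j in
  if u ≤ᵐ e then g (e ∸ᵐ u) else 0ℚ

idealSpan : {n : ℕ} (M : MatroidData n) (k : ℕ) → List (Deg M k)
idealSpan M k = concatMap (λ g →
    if Generator.degree g ≤ᵇ k
    then map (λ u → mulMon M k u (Generator.poly g))
             (monomials (nVars M) (k ∸ Generator.degree g))
    else []) (generators M)

lincomb : {n : ℕ} (M : MatroidData n) (k d : ℕ) →
          (Fin d → ℚ) → (Fin d → Deg M k) → Deg M k
lincomb M k d c b j = ΣFinℚ d (λ i → c i ℚ.* b i j)

InIdeal : {n : ℕ} (M : MatroidData n) (k : ℕ) → Deg M k → Set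
InIdeal M k v =
  let L = idealSpan M k in
  ∃ λ (c : Fin (length L) → ℚ) →
    ∀ j → v j ≡ ΣFinℚ (length L) (λ i → c i ℚ.* List.lookup L i j)

-- dim_ℚ CH^k(M) = d : there are d elements of degree k whose classes form
-- a basis of the quotient space (ℚ[x])_k / (I+J)_k
ChowDim : {n : ℕ} (M : MatroidData n) (k d : ℕ) → Set
ChowDim M k d =
  Σ (Fin d → Deg M k) λ b →
    (∀ (c : Fin d → ℚ) → InIdeal M k (lincomb M k d c b) → ∀ i → c i ≡ 0ℚ)
    × (∀ (v : Deg M k) → ∃ λ (c : Fin d → ℚ) →
         InIdeal M k (λ j → v j ℚ.- lincomb M k d c b j))

IsChowHilbert : {n : ℕ} → MatroidData n → Series → Set
IsChowHilbert M h = ∀ k → ∃ λ d → (h k ≡ + d) × ChowDim M k d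

oneSeries : Series
oneSeries k = if k ≡ᵇ 0 then + 1 else + 0

nonemptyFlats : {n : ℕ} → MatroidData n → List (Subset n)
nonemptyFlats M = List.filter (λ F → not (isEmptyᵇ F) Data.Bool.≟ true) (flats M)
  where import Data.Bool

{-# OPTIONS --safe #-}
module Submission where

-- For a flat F let D(F) be the Chow ring of M / F in the presentation with variables x_G for all flats G ⊋ F
-- (so x_E is included) and relations x_G x_H = 0 for incomparable G, H and Σ_{G ∋ a} x_G = 0 for a ∉ F. We study
-- the dual space: functions on words in the flats which respect these relations. With σ_G = Σ_{H ⊇ G} x_H and
-- ρ = rk G - rk F, the relation σ_G^ρ = 0 holds in D(F). Since σ_G = x_G + s, where s is the sum of the larger
-- variables, it expresses the coefficients of x_G^e for e ≥ ρ through those for e < ρ. Hence a functional on D(F)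
-- is determined by its value at 1 and its coefficients of x_G^e, 1 ≤ e < ρ, which are functionals on D(G).
-- Conversely such data can be prescribed freely: the functional is built flat by flat, downwards, and the linear
-- relations are verified by descending induction on the smallest letter of a word. The Hilbert series H_F of D(F)
-- therefore satisfies H_F = 1 + Σ_{G ⊋ F} (x + … + x^(ρ-1)) H_G, that is, Σ_{G ⊇ F} (x^ρ - x) H_G = 1 - x.
-- Möbius inversion over the flats F turns this into Σ_F χ_{M|F} H_{M/F} = x H_M, and dividing by x - 1 gives the
-- recursion, which determines the Hilbert series by induction on the size of the ground set.

open import Defs
open import Data.Nat using (ℕ)
open import Data.Fin.Subset using (Subset)
open import Data.List.Membership.Propositional using (_∈_)
open import Data.Product using (_×_)

open import Algebra.Bundles using (CommutativeRing)
open import Level using (0ℓ)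
open import Data.Bool using (Bool; true; false; if_then_else_; _∧_; not; T)
import Data.Bool
open import Data.List using (List; []; _∷_; _++_; map; foldr; filter; concatMap)
open import Data.List.Relation.Unary.Any using (here; there; index; any?)
open import Data.List.Relation.Unary.All as All using (All; []; _∷_)
open import Data.List.Relation.Unary.AllPairs as AllPairs using (AllPairs; []; _∷_)
open import Data.List.Relation.Unary.Unique.Propositional using (Unique)
open import Relation.Nullary using (does; yes; no; Dec; ¬_; contradiction)
open import Relation.Unary using (Decidable)
open import Relation.Binary.PropositionalEquality as ≡ using (_≡_; _≢_; _≗_)
open import Function using (_∘_; id; _$_; case_of_)

-- Dualising turns relations into conditions on functions, so no normal form of ring elements has to
-- be computed: uniqueness of a functional with given coefficients bounds the dimension from above,
-- existence bounds it from below. Existence is the harder half. The construction enforces only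
-- σ_G^ρ = 0, and the relation at `a` has to be derived. For `a` outside G, apply that relation to
-- the coefficients of the powers of x_G. The resulting sequence is killed by σ_G^ρ, and its terms
-- of exponent 1 to ρ - 1 vanish by the choice of the data. Its term of exponent 0 is a multiple of
-- σ_B, where B is the flat covering G through `a`. Since B has rank ρ + 1 over F, the sum of the
-- larger variables to the power ρ kills this term as well, which leaves only the zero sequence from
-- exponent 1 on. The variable x_E is kept so that all D(F) have the same shape and G = E is no
-- exception; it is eliminated only in the comparison with the Chow ring as defined.

-- Finite sums over lists in a commutative ring.

module ListSum (R : CommutativeRing 0ℓ 0ℓ) where
  open CommutativeRing R
  open import Algebra.Properties.CommutativeSemigroup
    (CommutativeRing.+-commutativeSemigroup R) using (interchange)
  open import Algebra.Properties.Ring ring using (-0#≈0#; -‿+-comm)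

  private variable A B : Set

  ∑ : List A → (A → Carrier) → Carrier
  ∑ xs f = foldr _+_ 0# (map f xs)

  ∑-cong∈ : ∀ (xs : List A) {f g} → (∀ x → x ∈ xs → f x ≈ g x) → ∑ xs f ≈ ∑ xs g
  ∑-cong∈ []       h = refl
  ∑-cong∈ (x ∷ xs) h = +-cong (h x (here ≡.refl)) (∑-cong∈ xs (λ y → h y ∘ there))

  ∑-cong : ∀ (xs : List A) {f g} → (∀ x → f x ≈ g x) → ∑ xs f ≈ ∑ xs g
  ∑-cong xs h = ∑-cong∈ xs (λ x _ → h x)

  ∑-0 : ∀ (xs : List A) → ∑ xs (λ _ → 0#) ≈ 0#
  ∑-0 []       = refl
  ∑-0 (x ∷ xs) = trans (+-identityˡ _) (∑-0 xs)

  ∑-zero∈ : ∀ (xs : List A) {f} → (∀ x → x ∈ xs → f x ≈ 0#) → ∑ xs f ≈ 0#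
  ∑-zero∈ xs h = trans (∑-cong∈ xs h) (∑-0 xs)

  ∑-zero : ∀ (xs : List A) {f} → (∀ x → f x ≈ 0#) → ∑ xs f ≈ 0#
  ∑-zero xs h = ∑-zero∈ xs (λ x _ → h x)

  ∑-+ : ∀ (xs : List A) f g → ∑ xs (λ x → f x + g x) ≈ ∑ xs f + ∑ xs g
  ∑-+ []       f g = sym (+-identityˡ 0#)
  ∑-+ (x ∷ xs) f g = trans (+-congˡ (∑-+ xs f g)) (interchange _ _ _ _)

  ∑-*ˡ : ∀ (xs : List A) c f → ∑ xs (λ x → c * f x) ≈ c * ∑ xs f
  ∑-*ˡ []       c f = sym (zeroʳ c)
  ∑-*ˡ (x ∷ xs) c f = trans (+-congˡ (∑-*ˡ xs c f)) (sym (distribˡ c _ _))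

  ∑-*ʳ : ∀ (xs : List A) c f → ∑ xs (λ x → f x * c) ≈ ∑ xs f * c
  ∑-*ʳ []       c f = sym (zeroˡ c)
  ∑-*ʳ (x ∷ xs) c f = trans (+-congˡ (∑-*ʳ xs c f)) (sym (distribʳ c _ _))

  ∑-neg : ∀ (xs : List A) f → ∑ xs (λ x → - f x) ≈ - ∑ xs f
  ∑-neg []       f = sym -0#≈0#
  ∑-neg (x ∷ xs) f = trans (+-congˡ (∑-neg xs f)) (-‿+-comm _ _)

  ∑-sub : ∀ (xs : List A) f g → ∑ xs (λ x → f x - g x) ≈ ∑ xs f - ∑ xs g
  ∑-sub xs f g = trans (∑-+ xs f (λ x → - g x)) (+-congˡ (∑-neg xs g))

  ∑-++ : ∀ (xs ys : List A) f → ∑ (xs ++ ys) f ≈ ∑ xs f + ∑ ys f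
  ∑-++ []       ys f = sym (+-identityˡ _)
  ∑-++ (x ∷ xs) ys f = trans (+-congˡ (∑-++ xs ys f)) (sym (+-assoc _ _ _))

  ∑-map : ∀ (g : A → B) xs f → ∑ (map g xs) f ≈ ∑ xs (f ∘ g)
  ∑-map g []       f = refl
  ∑-map g (x ∷ xs) f = +-congˡ (∑-map g xs f)

  ∑-swap : ∀ (xs : List A) (ys : List B) (f : A → B → Carrier) →
           ∑ xs (λ x → ∑ ys (f x)) ≈ ∑ ys (λ y → ∑ xs (λ x → f x y))
  ∑-swap []       ys f = sym (∑-0 ys)
  ∑-swap (x ∷ xs) ys f = trans (+-congˡ (∑-swap xs ys f)) (sym (∑-+ ys (f x) _))

  ∑-concatMap : ∀ (g : A → List B) xs f → ∑ (concatMap g xs) f ≈ ∑ xs (λ x → ∑ (g x) f)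
  ∑-concatMap g []       f = refl
  ∑-concatMap g (x ∷ xs) f = trans (∑-++ (g x) (concatMap g xs) f) (+-congˡ (∑-concatMap g xs f))

  ∑-filter : ∀ {P : A → Set} (P? : Decidable P) xs f → ∑ (filter P? xs) f ≈ ∑ xs (λ x → if does (P? x) then f x else 0#)
  ∑-filter P? []       f = refl
  ∑-filter P? (x ∷ xs) f with does (P? x)
  ... | true  = +-congˡ (∑-filter P? xs f)
  ... | false = trans (∑-filter P? xs f) (sym (+-identityˡ _))

  ∑-filterᵇ : ∀ (b : A → Bool) xs f →
              ∑ (filter (λ x → b x Data.Bool.≟ true) xs) f ≈
              ∑ xs (λ x → if b x then f x else 0#)
  ∑-filterᵇ b []       f = refl
  ∑-filterᵇ b (x ∷ xs) f with b x
  ... | true  = +-congˡ (∑-filterᵇ b xs f)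
  ... | false = trans (∑-filterᵇ b xs f) (sym (+-identityˡ _))

  ∑-single : ∀ {xs : List A} → Unique xs → ∀ {x} → x ∈ xs → (b : A → Bool) (f : A → Carrier) → b x ≡ true →
             (∀ y → y ∈ xs → b y ≡ true → y ≡ x) → ∑ xs (λ y → if b y then f y else 0#) ≈ f x
  ∑-single {xs = z ∷ xs} (z∉ ∷ uniq) {x} (here ≡.refl) b f bx only rewrite bx =
    trans (+-congˡ (∑-zero∈ xs other)) (+-identityʳ (f x))
    where
    other : ∀ y → y ∈ xs → (if b y then f y else 0#) ≈ 0#
    other y y∈ with b y in by
    ... | false = refl
    ... | true  = contradiction (≡.sym (only y (there y∈) by)) (All.lookup z∉ y∈)
  ∑-single {xs = z ∷ xs} (z∉ ∷ uniq) {x} (there x∈) b f bx only with b z in bz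
  ... | true  = contradiction (only z (here ≡.refl) bz) (All.lookup z∉ x∈)
  ... | false = trans (+-identityˡ _) (∑-single uniq x∈ b f bx (λ y y∈ → only y (there y∈)))

open import Data.Nat using (zero; suc)
open import Data.Rational using (ℚ; 0ℚ; 1ℚ)
import Data.Rational as ℚ
import Data.Rational.Properties as ℚₚ
open import Data.Rational.Solver
open import Data.Product using (∃; _,_; proj₁; proj₂)
open import Data.List using (allFin; tabulate; replicate; length; lookup; upTo; downFrom)
import Data.List.Properties as Listₚ
open import Data.List.Membership.Propositional.Properties
  using (∈-allFin; ∈-++⁺ˡ; ∈-++⁺ʳ; ∈-++⁻; ∈-map⁺; ∈-map⁻; ∈-filter⁺; ∈-filter⁻; ∈-concatMap⁺; ∈-concatMap⁻;
         ∈-lookup; ∈-upTo⁺; ∈-upTo⁻; ∈-downFrom⁺; ∈-downFrom⁻; ∈-∃++)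
open import Data.Fin using (Fin; punchIn)
import Data.Fin as Fin
import Data.Fin.Properties as Finₚ
open import Relation.Nullary.Decidable using (¬?; _×-dec_; _⊎-dec_; map′; decidable-stable; dec-true; dec-false)
open import Relation.Binary.PropositionalEquality using (refl; sym; trans; cong; cong₂; subst; subst₂; module ≡-Reasoning)

-- Linear algebra over ℚ: quotients, annihilators and invariance of dimension.

module LinearAlgebra where
  open ≡-Reasoning
  open ListSum ℚₚ.+-*-commutativeRing
  open import Data.Rational using (_+_; _*_; _-_; 1/_; NonZero)
  open import Algebra.Properties.Group ℚₚ.+-0-group using (∙-cancelˡ)
  open +-*-Solver using (solve; _:=_; _:+_; _:*_; _:-_; :-_; con)

  V : ℕ → Set
  V N = Fin N → ℚ

  dot : ∀ {N} → V N → V N → ℚ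
  dot {N} φ v = ∑ (allFin N) (λ j → φ j * v j)

  comb : ∀ {N} d → (Fin d → ℚ) → (Fin d → V N) → V N
  comb d c b j = ∑ (allFin d) (λ i → c i * b i j)

  record InSpan {N} (L : List (V N)) (v : V N) : Set where
    constructor _,_
    field
      coeff : Fin (length L) → ℚ
      eq    : ∀ j → v j ≡ comb (length L) coeff (lookup L) j

  ∑-allFin-suc : ∀ d (f : Fin (suc d) → ℚ) →
    ∑ (allFin (suc d)) f ≡ f Fin.zero + ∑ (allFin d) (f ∘ Fin.suc)
  ∑-allFin-suc d f = cong (f Fin.zero +_) $ begin
    ∑ (tabulate Fin.suc) f           ≡⟨ cong (λ l → ∑ l f) (Listₚ.map-tabulate id Fin.suc) ⟨
    ∑ (map Fin.suc (allFin d)) f     ≡⟨ ∑-map Fin.suc (allFin d) f ⟩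
    ∑ (allFin d) (f ∘ Fin.suc)       ∎

  ∑-allFin-punchIn : ∀ d (p : Fin (suc d)) (f : Fin (suc d) → ℚ) →
    ∑ (allFin (suc d)) f ≡ f p + ∑ (allFin d) (f ∘ punchIn p)
  ∑-allFin-punchIn d Fin.zero f = ∑-allFin-suc d f
  ∑-allFin-punchIn (suc d) (Fin.suc p) f = begin
    ∑ (allFin (suc (suc d))) f
      ≡⟨ ∑-allFin-suc (suc d) f ⟩
    f Fin.zero + ∑ (allFin (suc d)) (f ∘ Fin.suc)
      ≡⟨ cong (f Fin.zero +_) (∑-allFin-punchIn d p (f ∘ Fin.suc)) ⟩
    f Fin.zero + (f (Fin.suc p) + ∑ (allFin d) (f ∘ Fin.suc ∘ punchIn p))
      ≡⟨ solve 3 (λ x y z → x :+ (y :+ z) := y :+ (x :+ z)) refl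
           (f Fin.zero) (f (Fin.suc p)) (∑ (allFin d) (f ∘ Fin.suc ∘ punchIn p)) ⟩
    f (Fin.suc p) + (f Fin.zero + ∑ (allFin d) (f ∘ Fin.suc ∘ punchIn p))
      ≡⟨ cong (f (Fin.suc p) +_) (∑-allFin-suc d (f ∘ punchIn (Fin.suc p))) ⟨
    f (Fin.suc p) + ∑ (allFin (suc d)) (f ∘ punchIn (Fin.suc p)) ∎

  δ : ∀ {d} → Fin d → Fin d → ℚ
  δ i j = if does (i Fin.≟ j) then 1ℚ else 0ℚ

  ∑-δˡ : ∀ d (i : Fin d) (f : Fin d → ℚ) → ∑ (allFin d) (λ j → δ i j * f j) ≡ f i
  ∑-δˡ (suc d) Fin.zero f = begin
    ∑ (allFin (suc d)) (λ j → δ Fin.zero j * f j)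
      ≡⟨ ∑-allFin-suc d (λ j → δ Fin.zero j * f j) ⟩
    1ℚ * f Fin.zero + ∑ (allFin d) (λ j → 0ℚ * f (Fin.suc j))
      ≡⟨ cong₂ _+_ (ℚₚ.*-identityˡ (f Fin.zero)) (∑-zero (allFin d) (λ j → ℚₚ.*-zeroˡ (f (Fin.suc j)))) ⟩
    f Fin.zero + 0ℚ
      ≡⟨ ℚₚ.+-identityʳ _ ⟩
    f Fin.zero ∎
  ∑-δˡ (suc d) (Fin.suc i) f = begin
    ∑ (allFin (suc d)) (λ j → δ (Fin.suc i) j * f j)
      ≡⟨ ∑-allFin-suc d (λ j → δ (Fin.suc i) j * f j) ⟩
    0ℚ * f Fin.zero + ∑ (allFin d) (λ j → δ i j * f (Fin.suc j))
      ≡⟨ cong₂ _+_ (ℚₚ.*-zeroˡ (f Fin.zero)) (∑-δˡ d i (f ∘ Fin.suc)) ⟩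
    0ℚ + f (Fin.suc i)
      ≡⟨ ℚₚ.+-identityˡ _ ⟩
    f (Fin.suc i) ∎

  δ-refl : ∀ {d} (i : Fin d) → δ i i ≡ 1ℚ
  δ-refl i rewrite dec-true (i Fin.≟ i) refl = refl

  δ-≢ : ∀ {d} {i j : Fin d} → i ≢ j → δ i j ≡ 0ℚ
  δ-≢ {i = i} {j} ne rewrite dec-false (i Fin.≟ j) ne = refl

  δ-sym : ∀ {d} (i j : Fin d) → δ i j ≡ δ j i
  δ-sym i j with i Fin.≟ j
  ... | yes refl = sym (δ-refl i)
  ... | no ne    = sym (δ-≢ (ne ∘ sym))

  δ-punchIn : ∀ {d} (p : Fin (suc d)) (i j : Fin d) → δ (punchIn p i) (punchIn p j) ≡ δ i j
  δ-punchIn p i j with i Fin.≟ j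
  ... | yes refl = δ-refl (punchIn p i)
  ... | no ne    = δ-≢ (ne ∘ Finₚ.punchIn-injective p i j)

  dot-congʳ : ∀ {N} (φ : V N) {v w : V N} → (∀ j → v j ≡ w j) → dot φ v ≡ dot φ w
  dot-congʳ {N} φ h = ∑-cong (allFin N) (λ j → cong (φ j *_) (h j))

  dot-sub-scaleʳ : ∀ {N} (φ v w : V N) t → dot φ (λ j → v j - t * w j) ≡ dot φ v - t * dot φ w
  dot-sub-scaleʳ {N} φ v w t = begin
    ∑ (allFin N) (λ j → φ j * (v j - t * w j))
      ≡⟨ ∑-cong (allFin N) (λ j → solve 4 (λ a b c d → a :* (b :- c :* d) := a :* b :- c :* (a :* d))
                                   refl (φ j) (v j) t (w j)) ⟩
    ∑ (allFin N) (λ j → φ j * v j - t * (φ j * w j))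
      ≡⟨ ∑-sub (allFin N) _ _ ⟩
    dot φ v - ∑ (allFin N) (λ j → t * (φ j * w j))
      ≡⟨ cong (dot φ v -_) (∑-*ˡ (allFin N) t _) ⟩
    dot φ v - t * dot φ w ∎

  dot-comm : ∀ {N} (φ v : V N) → dot φ v ≡ dot v φ
  dot-comm {N} φ v = ∑-cong (allFin N) (λ j → ℚₚ.*-comm (φ j) (v j))

  dot-sub-scaleˡ : ∀ {N} (v w φ : V N) t → dot (λ j → v j - t * w j) φ ≡ dot v φ - t * dot w φ
  dot-sub-scaleˡ v w φ t = trans (dot-comm _ φ)
    (trans (dot-sub-scaleʳ φ v w t) (cong₂ (λ x y → x - t * y) (dot-comm φ v) (dot-comm φ w)))

  dot-combʳ : ∀ {N} d (φ : V N) c (b : Fin d → V N) →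
              dot φ (comb d c b) ≡ ∑ (allFin d) (λ i → c i * dot φ (b i))
  dot-combʳ {N} d φ c b = begin
    ∑ (allFin N) (λ j → φ j * comb d c b j)
      ≡⟨ ∑-cong (allFin N) (λ j → sym (∑-*ˡ (allFin d) (φ j) _)) ⟩
    ∑ (allFin N) (λ j → ∑ (allFin d) (λ i → φ j * (c i * b i j)))
      ≡⟨ ∑-swap (allFin N) (allFin d) _ ⟩
    ∑ (allFin d) (λ i → ∑ (allFin N) (λ j → φ j * (c i * b i j)))
      ≡⟨ ∑-cong (allFin d) (λ i → trans
           (∑-cong (allFin N) (λ j → solve 3 (λ x y z → x :* (y :* z) := y :* (x :* z)) refl (φ j) (c i) (b i j)))
           (∑-*ˡ (allFin N) (c i) _)) ⟩
    ∑ (allFin d) (λ i → c i * dot φ (b i)) ∎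

  comb-sub : ∀ {N} d c c′ (b : Fin d → V N) j →
             comb d (λ i → c i - c′ i) b j ≡ comb d c b j - comb d c′ b j
  comb-sub d c c′ b j = trans
    (∑-cong (allFin d) (λ i → solve 3 (λ x y z → (x :- y) :* z := x :* z :- y :* z) refl (c i) (c′ i) (b i j)))
    (∑-sub (allFin d) _ _)

  comb-comb : ∀ {N} d d′ (c : Fin d′ → ℚ) (e : Fin d′ → Fin d → ℚ) (b : Fin d → V N) j →
    comb d (λ i → ∑ (allFin d′) (λ k → c k * e k i)) b j ≡ comb d′ c (λ k → comb d (e k) b) j
  comb-comb d d′ c e b j = begin
    ∑ (allFin d) (λ i → ∑ (allFin d′) (λ k → c k * e k i) * b i j)
      ≡⟨ ∑-cong (allFin d) (λ i → sym (∑-*ʳ (allFin d′) (b i j) _)) ⟩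
    ∑ (allFin d) (λ i → ∑ (allFin d′) (λ k → c k * e k i * b i j))
      ≡⟨ ∑-swap (allFin d) (allFin d′) _ ⟩
    ∑ (allFin d′) (λ k → ∑ (allFin d) (λ i → c k * e k i * b i j))
      ≡⟨ ∑-cong (allFin d′) (λ k → trans
           (∑-cong (allFin d) (λ i → ℚₚ.*-assoc (c k) (e k i) (b i j)))
           (∑-*ˡ (allFin d) (c k) _)) ⟩
    comb d′ c (λ k → comb d (e k) b) j ∎

  module _ {N : ℕ} where

    InSpan-cong : ∀ {L : List (V N)} {v w} → (∀ j → w j ≡ v j) → InSpan L v → InSpan L w
    InSpan-cong h (c , p) = c , λ j → trans (h j) (p j)

    InSpan-0 : ∀ {L : List (V N)} → InSpan L (λ _ → 0ℚ)
    InSpan-0 {L} = (λ _ → 0ℚ) , λ j → sym (∑-zero (allFin (length L)) (λ i → ℚₚ.*-zeroˡ (lookup L i j)))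

    InSpan-+ : ∀ {L : List (V N)} {v w} → InSpan L v → InSpan L w → InSpan L (λ j → v j + w j)
    InSpan-+ {L} (c , p) (c′ , q) = (λ i → c i + c′ i) , λ j → begin
      _ ≡⟨ cong₂ _+_ (p j) (q j) ⟩
      comb _ c (lookup L) j + comb _ c′ (lookup L) j
        ≡⟨ ∑-+ (allFin (length L)) _ _ ⟨
      ∑ (allFin (length L)) (λ i → c i * lookup L i j + c′ i * lookup L i j)
        ≡⟨ ∑-cong (allFin (length L)) (λ i → sym (ℚₚ.*-distribʳ-+ (lookup L i j) (c i) (c′ i))) ⟩
      comb _ (λ i → c i + c′ i) (lookup L) j ∎

    InSpan-* : ∀ {L : List (V N)} t {v} → InSpan L v → InSpan L (λ j → t * v j)
    InSpan-* {L} t (c , p) = (λ i → t * c i) , λ j → begin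
      _ ≡⟨ cong (t *_) (p j) ⟩
      t * comb _ c (lookup L) j
        ≡⟨ ∑-*ˡ (allFin (length L)) t _ ⟨
      ∑ (allFin (length L)) (λ i → t * (c i * lookup L i j))
        ≡⟨ ∑-cong (allFin (length L)) (λ i → sym (ℚₚ.*-assoc t (c i) _)) ⟩
      comb _ (λ i → t * c i) (lookup L) j ∎

    InSpan-∑ : ∀ {L : List (V N)} {A : Set} (xs : List A) (c : A → ℚ) {v : A → V N} →
               (∀ x → InSpan L (v x)) → InSpan L (λ j → ∑ xs (λ x → c x * v x j))
    InSpan-∑ []       c h = InSpan-0
    InSpan-∑ (x ∷ xs) c h = InSpan-+ (InSpan-* (c x) (h x)) (InSpan-∑ xs c h)

    InSpan-∷ : ∀ {l} {L : List (V N)} {v} t → InSpan L v → InSpan (l ∷ L) (λ j → t * l j + v j)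
    InSpan-∷ {l} {L} t (c , p) = c′ , λ j →
      trans (cong (t * l j +_) (p j)) (sym (∑-allFin-suc (length L) (λ i → c′ i * lookup (l ∷ L) i j)))
      where
      c′ : Fin (suc (length L)) → ℚ
      c′ Fin.zero    = t
      c′ (Fin.suc i) = c i

    InSpan-⊥ : ∀ {L : List (V N)} {φ v} → (∀ l → l ∈ L → dot φ l ≡ 0ℚ) → InSpan L v → dot φ v ≡ 0ℚ
    InSpan-⊥ {L} {φ} {v} h (c , p) = begin
      dot φ v ≡⟨ dot-congʳ φ p ⟩
      dot φ (comb (length L) c (lookup L)) ≡⟨ dot-combʳ (length L) φ c (lookup L) ⟩
      ∑ (allFin (length L)) (λ i → c i * dot φ (lookup L i))
        ≡⟨ ∑-zero (allFin (length L)) (λ i → trans (cong (c i *_) (h _ (∈-lookup i))) (ℚₚ.*-zeroʳ (c i))) ⟩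
      0ℚ ∎

  -- A basis `b` of the quotient by the span of `L` and the dual basis `φ` of the annihilator of
  -- `L`; pairing with `φ` gives the coordinates modulo the span.
  record DualBasis {N} (L : List (V N)) : Set where
    field
      dim     : ℕ
      b φ     : Fin dim → V N
      dual    : ∀ i j → dot (φ i) (b j) ≡ δ i j
      φ⊥      : ∀ i l → l ∈ L → dot (φ i) l ≡ 0ℚ
      spans   : ∀ v → InSpan L (λ j → v j - comb dim (λ i → dot (φ i) v) b j)

  dualBasis-[] : ∀ {N} → DualBasis {N} []
  dualBasis-[] {N} = record
    { dim = N ; b = δ ; φ = δ
    ; dual = λ i j → trans (∑-δˡ N i (δ j)) (δ-sym j i)
    ; φ⊥ = λ _ _ ()
    ; spans = λ v → InSpan-cong (λ j → begin
        v j - comb N (λ i → dot (δ i) v) δ j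
          ≡⟨ cong (v j -_) (∑-cong (allFin N) (λ i → trans (cong₂ _*_ (∑-δˡ N i v) (δ-sym i j)) (ℚₚ.*-comm (v i) _))) ⟩
        v j - ∑ (allFin N) (λ i → δ j i * v i)
          ≡⟨ cong (v j -_) (∑-δˡ N j v) ⟩
        v j - v j
          ≡⟨ ℚₚ.+-inverseʳ (v j) ⟩
        0ℚ ∎) InSpan-0
    }

  -- One elimination step. As `φ p` does not kill the new relation `l`, the relation expresses `b p`
  -- through the other basis vectors, so the index `p` is dropped. The factor `t` corrects each
  -- remaining functional by a multiple of `φ p` so that it kills `l`.
  module Eliminate {N} {L : List (V N)} (l : V N) {d} (b φ : Fin (suc d) → V N)
    (dual : ∀ i j → dot (φ i) (b j) ≡ δ i j)
    (φ⊥ : ∀ i x → x ∈ L → dot (φ i) x ≡ 0ℚ)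
    (spans : ∀ v → InSpan L (λ j → v j - comb (suc d) (λ i → dot (φ i) v) b j))
    (p : Fin (suc d)) (φₚl≢0 : dot (φ p) l ≢ 0ℚ) where

    instance
      nz : NonZero (dot (φ p) l)
      nz = ℚ.≢-nonZero φₚl≢0

    c⁻¹ : ℚ
    c⁻¹ = 1/ dot (φ p) l

    t : Fin d → ℚ
    t i = dot (φ (punchIn p i)) l * c⁻¹

    φ′ : Fin d → V N
    φ′ i j = φ (punchIn p i) j - t i * φ p j

    dot-φ′ : ∀ i v → dot (φ′ i) v ≡ dot (φ (punchIn p i)) v - t i * dot (φ p) v
    dot-φ′ i v = dot-sub-scaleˡ (φ (punchIn p i)) (φ p) v (t i)

    dual′ : ∀ i j → dot (φ′ i) (b (punchIn p j)) ≡ δ i j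
    dual′ i j = begin
      _ ≡⟨ dot-φ′ i _ ⟩
      dot (φ (punchIn p i)) (b (punchIn p j)) - t i * dot (φ p) (b (punchIn p j))
        ≡⟨ cong₂ (λ x y → x - t i * y) (trans (dual _ _) (δ-punchIn p i j))
             (trans (dual _ _) (δ-≢ (Finₚ.punchInᵢ≢i p j ∘ sym))) ⟩
      δ i j - t i * 0ℚ
        ≡⟨ cong (δ i j -_) (ℚₚ.*-zeroʳ (t i)) ⟩
      δ i j - 0ℚ ≡⟨ ℚₚ.+-identityʳ _ ⟩
      δ i j ∎

    φ′⊥l : ∀ i → dot (φ′ i) l ≡ 0ℚ
    φ′⊥l i = begin
      _ ≡⟨ dot-φ′ i l ⟩
      x - x * c⁻¹ * dot (φ p) l
        ≡⟨ cong (x -_) (trans (ℚₚ.*-assoc x c⁻¹ _) (trans (cong (x *_) (ℚₚ.*-inverseˡ (dot (φ p) l))) (ℚₚ.*-identityʳ x))) ⟩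
      x - x ≡⟨ ℚₚ.+-inverseʳ x ⟩
      0ℚ ∎
      where x = dot (φ (punchIn p i)) l

    φ′⊥ : ∀ i x → x ∈ l ∷ L → dot (φ′ i) x ≡ 0ℚ
    φ′⊥ i x (here refl) = φ′⊥l i
    φ′⊥ i x (there x∈L) = begin
      _ ≡⟨ dot-φ′ i x ⟩
      dot (φ (punchIn p i)) x - t i * dot (φ p) x
        ≡⟨ cong₂ (λ y z → y - t i * z) (φ⊥ _ x x∈L) (φ⊥ p x x∈L) ⟩
      0ℚ - t i * 0ℚ ≡⟨ solve 1 (λ t → con 0ℚ :- t :* con 0ℚ := con 0ℚ) refl (t i) ⟩
      0ℚ ∎

    spans′ : ∀ v → InSpan (l ∷ L) (λ j → v j - comb d (λ i → dot (φ′ i) v) (b ∘ punchIn p) j)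
    spans′ v = InSpan-cong eq (InSpan-∷ κ (spans v′))
      where
      -- Subtracting this multiple of `l` makes the pairing with `φ p` zero, so `b p` disappears
      -- from the old expansion.
      κ : ℚ
      κ = dot (φ p) v * c⁻¹

      v′ : V N
      v′ j = v j - κ * l j

      φₚv′ : dot (φ p) v′ ≡ 0ℚ
      φₚv′ = begin
        _ ≡⟨ dot-sub-scaleʳ (φ p) v l κ ⟩
        x - x * c⁻¹ * dot (φ p) l
          ≡⟨ cong (x -_) (trans (ℚₚ.*-assoc x c⁻¹ _) (trans (cong (x *_) (ℚₚ.*-inverseˡ (dot (φ p) l))) (ℚₚ.*-identityʳ x))) ⟩
        x - x ≡⟨ ℚₚ.+-inverseʳ x ⟩
        0ℚ ∎
        where x = dot (φ p) v

      φ′v : ∀ i → dot (φ (punchIn p i)) v′ ≡ dot (φ′ i) v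
      φ′v i = begin
        _ ≡⟨ dot-sub-scaleʳ (φ (punchIn p i)) v l κ ⟩
        dot (φ (punchIn p i)) v - dot (φ p) v * c⁻¹ * dot (φ (punchIn p i)) l
          ≡⟨ solve 4 (λ a b c d → a :- b :* c :* d := a :- d :* c :* b) refl
               (dot (φ (punchIn p i)) v) (dot (φ p) v) c⁻¹ (dot (φ (punchIn p i)) l) ⟩
        dot (φ (punchIn p i)) v - t i * dot (φ p) v
          ≡⟨ dot-φ′ i v ⟨
        dot (φ′ i) v ∎

      comb-eq : ∀ j → comb (suc d) (λ i → dot (φ i) v′) b j ≡ comb d (λ i → dot (φ′ i) v) (b ∘ punchIn p) j
      comb-eq j = begin
        _ ≡⟨ ∑-allFin-punchIn d p (λ i → dot (φ i) v′ * b i j) ⟩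
        dot (φ p) v′ * b p j + ∑ (allFin d) (λ i → dot (φ (punchIn p i)) v′ * b (punchIn p i) j)
          ≡⟨ cong₂ _+_ (trans (cong (_* b p j) φₚv′) (ℚₚ.*-zeroˡ (b p j)))
               (∑-cong (allFin d) (λ i → cong (_* b (punchIn p i) j) (φ′v i))) ⟩
        0ℚ + comb d (λ i → dot (φ′ i) v) (b ∘ punchIn p) j ≡⟨ ℚₚ.+-identityˡ _ ⟩
        _ ∎

      eq : ∀ j → v j - comb d (λ i → dot (φ′ i) v) (b ∘ punchIn p) j ≡
                 κ * l j + (v′ j - comb (suc d) (λ i → dot (φ i) v′) b j)
      eq j = begin
        v j - y ≡⟨ solve 3 (λ v y z → v :- y := z :+ (v :- z :- y)) refl (v j) y (κ * l j) ⟩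
        κ * l j + (v′ j - y) ≡⟨ cong (λ z → κ * l j + (v′ j - z)) (sym (comb-eq j)) ⟩
        _ ∎
        where y = comb d (λ i → dot (φ′ i) v) (b ∘ punchIn p) j

  dualBasis-∷ : ∀ {N} l {L : List (V N)} → DualBasis L → DualBasis (l ∷ L)
  dualBasis-∷ {N} l {L} record { dim = d ; b = b ; φ = φ ; dual = dual ; φ⊥ = φ⊥ ; spans = spans }
    with Finₚ.any? (λ i → ¬? (dot (φ i) l ℚₚ.≟ 0ℚ))
  dualBasis-∷ l record { dim = suc d ; b = b ; φ = φ ; dual = dual ; φ⊥ = φ⊥ ; spans = spans }
    | yes (p , φₚl≢0) = record
      { dim = d ; b = b ∘ punchIn p ; φ = E.φ′ ; dual = E.dual′ ; φ⊥ = E.φ′⊥ ; spans = E.spans′ }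
      where module E = Eliminate l b φ dual φ⊥ spans p φₚl≢0
  -- Every functional already kills `l`: the old bases remain valid, and `l` enters with coefficient
  -- 0.
  ... | no none = record
    { dim = d ; b = b ; φ = φ ; dual = dual
    ; φ⊥ = λ { i x (here refl) → decidable-stable (dot (φ i) l ℚₚ.≟ 0ℚ) (λ ne → none (i , ne))
             ; i x (there x∈) → φ⊥ i x x∈ }
    ; spans = λ v → InSpan-cong (λ j → solve 2 (λ x y → x := con 0ℚ :* y :+ x) refl
        (v j - comb d (λ i → dot (φ i) v) b j) (l j)) (InSpan-∷ 0ℚ (spans v)) }

  dualBasis : ∀ {N} (L : List (V N)) → DualBasis L
  dualBasis []      = dualBasis-[]
  dualBasis (l ∷ L) = dualBasis-∷ l (dualBasis L)

  Independent : ∀ {N} → List (V N) → ∀ d → (Fin d → V N) → Set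
  Independent L d b = ∀ (c : Fin d → ℚ) → InSpan L (comb d c b) → ∀ i → c i ≡ 0ℚ

  Spanned : ∀ {N} → List (V N) → ∀ d → (Fin d → V N) → V N → Set
  Spanned L d b v = ∃ λ (c : Fin d → ℚ) → InSpan L (λ j → v j - comb d c b j)

  sub≡0⇒≡ : ∀ {x y : ℚ} → x - y ≡ 0ℚ → x ≡ y
  sub≡0⇒≡ {x} {y} h = begin
    x           ≡⟨ solve 2 (λ x y → x := (x :- y) :+ y) refl x y ⟩
    (x - y) + y ≡⟨ cong (_+ y) h ⟩
    0ℚ + y      ≡⟨ ℚₚ.+-identityˡ y ⟩
    y           ∎

  -- Expanding `p i` in `q` and then each `q k` in `p` gives a second expansion of `p i` in `p`;
  -- independence compares it with the trivial one.
  change-inverse : ∀ {N} {L : List (V N)} d d′ (p : Fin d → V N) (q : Fin d′ → V N) →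
    Independent L d p → (sp : ∀ i → Spanned L d′ q (p i)) (sq : ∀ k → Spanned L d p (q k)) →
    ∀ i i′ → ∑ (allFin d′) (λ k → proj₁ (sp i) k * proj₁ (sq k) i′) ≡ δ i i′
  change-inverse d d′ p q ind sp sq i i′ = sym (sub≡0⇒≡ (ind x x∈ i′))
    where
    c : Fin d′ → ℚ
    c = proj₁ (sp i)
    e : Fin d′ → Fin d → ℚ
    e k = proj₁ (sq k)
    x : Fin d → ℚ
    x m = δ i m - ∑ (allFin d′) (λ k → c k * e k m)
    x∈ = InSpan-cong (λ j → begin
      comb d x p j
        ≡⟨ comb-sub d (δ i) _ p j ⟩
      comb d (δ i) p j - comb d (λ m → ∑ (allFin d′) (λ k → c k * e k m)) p j
        ≡⟨ cong₂ _-_ (∑-δˡ d i (λ m → p m j)) (comb-comb d d′ c e p j) ⟩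
      p i j - comb d′ c (λ k → comb d (e k) p) j
        ≡⟨ solve 3 (λ x y z → x :- z := (x :- y) :+ (y :- z)) refl (p i j) (comb d′ c q j) (comb d′ c (λ k → comb d (e k) p) j) ⟩
      (p i j - comb d′ c q j) + (comb d′ c q j - comb d′ c (λ k → comb d (e k) p) j)
        ≡⟨ cong (p i j - comb d′ c q j +_) (trans (sym (∑-sub (allFin d′) _ _))
             (∑-cong (allFin d′) (λ k → solve 3 (λ c x y → c :* x :- c :* y := c :* (x :- y)) refl (c k) (q k j) (comb d (e k) p j)))) ⟩
      (p i j - comb d′ c q j) + ∑ (allFin d′) (λ k → c k * (q k j - comb d (e k) p j)) ∎)
      (InSpan-+ (proj₂ (sp i)) (InSpan-∑ (allFin d′) c (λ k → proj₂ (sq k))))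

  ∑1≥0 : ∀ d → 0ℚ ℚ.≤ ∑ (allFin d) (λ _ → 1ℚ)
  ∑1≥0 zero = ℚₚ.≤-refl
  ∑1≥0 (suc d) rewrite ∑-allFin-suc d (λ _ → 1ℚ) =
    ℚₚ.≤-trans (∑1≥0 d) (ℚₚ.≤-trans (ℚₚ.≤-reflexive (sym (ℚₚ.+-identityˡ S)))
      (ℚₚ.+-monoˡ-≤ S (ℚₚ.nonNegative⁻¹ 1ℚ)))
    where S = ∑ (allFin d) (λ _ → 1ℚ)

  0≢1+∑1 : ∀ d → 0ℚ ≢ 1ℚ + ∑ (allFin d) (λ _ → 1ℚ)
  0≢1+∑1 d eq = ℚₚ.<-irrefl eq (ℚₚ.<-≤-trans (ℚₚ.positive⁻¹ 1ℚ)
    (ℚₚ.≤-trans (ℚₚ.≤-reflexive (sym (ℚₚ.+-identityʳ 1ℚ))) (ℚₚ.+-monoʳ-≤ 1ℚ (∑1≥0 d))))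

  -- Characteristic zero: a trace that is a sum of `d` ones determines `d`.
  ∑1-injective : ∀ d d′ → ∑ (allFin d) (λ _ → 1ℚ) ≡ ∑ (allFin d′) (λ _ → 1ℚ) → d ≡ d′
  ∑1-injective zero zero eq = refl
  ∑1-injective zero (suc d′) eq = contradiction (trans eq (∑-allFin-suc d′ (λ _ → 1ℚ))) (0≢1+∑1 d′)
  ∑1-injective (suc d) zero eq = contradiction (trans (sym eq) (∑-allFin-suc d (λ _ → 1ℚ))) (0≢1+∑1 d)
  ∑1-injective (suc d) (suc d′) eq = cong suc (∑1-injective d d′
    (∙-cancelˡ 1ℚ (∑ (allFin d) (λ _ → 1ℚ)) (∑ (allFin d′) (λ _ → 1ℚ))
      (trans (sym (∑-allFin-suc d (λ _ → 1ℚ))) (trans eq (∑-allFin-suc d′ (λ _ → 1ℚ))))))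

  -- The base change matrices C, E satisfy CE = I and EC = I, and tr(CE) = tr(EC).
  dimension-unique : ∀ {N} {L : List (V N)} d d′ (p : Fin d → V N) (q : Fin d′ → V N) →
    Independent L d p → Independent L d′ q →
    (∀ i → Spanned L d′ q (p i)) → (∀ k → Spanned L d p (q k)) → d ≡ d′
  dimension-unique d d′ p q indp indq sp sq = ∑1-injective d d′ (begin
    ∑ (allFin d) (λ _ → 1ℚ)
      ≡⟨ ∑-cong (allFin d) (λ i → sym (trans (change-inverse d d′ p q indp sp sq i i) (δ-refl i))) ⟩
    ∑ (allFin d) (λ i → ∑ (allFin d′) (λ k → c i k * e k i))
      ≡⟨ ∑-swap (allFin d) (allFin d′) _ ⟩
    ∑ (allFin d′) (λ k → ∑ (allFin d) (λ i → c i k * e k i))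
      ≡⟨ ∑-cong (allFin d′) (λ k → ∑-cong (allFin d) (λ i → ℚₚ.*-comm (c i k) (e k i))) ⟩
    ∑ (allFin d′) (λ k → ∑ (allFin d) (λ i → e k i * c i k))
      ≡⟨ ∑-cong (allFin d′) (λ k → trans (change-inverse d′ d q p indq sq sp k k) (δ-refl k)) ⟩
    ∑ (allFin d′) (λ _ → 1ℚ) ∎)
    where
    c : Fin d → Fin d′ → ℚ
    c i = proj₁ (sp i)
    e : Fin d′ → Fin d → ℚ
    e k = proj₁ (sq k)

  -- The bridge from functionals to `ChowDim`. Elimination supplies dual bases `b` and `φ`; both `φ`
  -- and `q` are bases of the annihilator of `L`, so they have the same size, and `b` is a basis of
  -- the quotient of that size.
  quotient-basis : ∀ {N} (L : List (V N)) d (q : Fin d → V N) →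
    (∀ k l → l ∈ L → dot (q k) l ≡ 0ℚ) → Independent [] d q →
    (∀ v → (∀ l → l ∈ L → dot v l ≡ 0ℚ) → Spanned [] d q v) →
    ∃ λ (b : Fin d → V N) → Independent L d b × (∀ v → Spanned L d b v)
  quotient-basis {N} L d q q⊥ ind-q span-q = subst
    (λ d → ∃ λ (b : Fin d → V N) → Independent L d b × (∀ v → Spanned L d b v)) dim≡d
    (b , ind-b , λ v → (λ i → dot (φ i) v) , spans v)
    where
    open DualBasis (dualBasis L)

    dot-φ-comb : ∀ i c → dot (φ i) (comb dim c b) ≡ c i
    dot-φ-comb i c = begin
      dot (φ i) (comb dim c b)                         ≡⟨ dot-combʳ dim (φ i) c b ⟩
      ∑ (allFin dim) (λ j → c j * dot (φ i) (b j))
        ≡⟨ ∑-cong (allFin dim) (λ j → trans (cong (c j *_) (dual i j)) (ℚₚ.*-comm (c j) (δ i j))) ⟩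
      ∑ (allFin dim) (λ j → δ i j * c j)               ≡⟨ ∑-δˡ dim i c ⟩
      c i ∎

    ind-b : Independent L dim b
    ind-b c c∈ i = trans (sym (dot-φ-comb i c)) (InSpan-⊥ {φ = φ i} (φ⊥ i) c∈)

    ind-φ : Independent [] dim φ
    ind-φ c (_ , comb≡0) i = begin
      c i                                              ≡⟨ ∑-δˡ dim i c ⟨
      ∑ (allFin dim) (λ j → δ i j * c j)
        ≡⟨ ∑-cong (allFin dim) (λ j → trans (ℚₚ.*-comm (δ i j) (c j))
             (cong (c j *_) (trans (δ-sym i j) (trans (sym (dual j i)) (dot-comm (φ j) (b i)))))) ⟩
      ∑ (allFin dim) (λ j → c j * dot (b i) (φ j))     ≡⟨ dot-combʳ dim (b i) c φ ⟨
      dot (b i) (comb dim c φ)                         ≡⟨ dot-congʳ (b i) comb≡0 ⟩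
      dot (b i) (λ _ → 0ℚ)                             ≡⟨ ∑-zero (allFin N) (λ j → ℚₚ.*-zeroʳ (b i j)) ⟩
      0ℚ ∎

    -- Pair `a` with the expansion of the unit vector `δ j` modulo the span of `L`; the error term
    -- lies in the span, which `a` kills.
    expand : ∀ a → (∀ l → l ∈ L → dot a l ≡ 0ℚ) → ∀ j → a j ≡ comb dim (λ i → dot a (b i)) φ j
    expand a a⊥ j = begin
      a j                                              ≡⟨ ∑-δˡ N j a ⟨
      dot (δ j) a                                      ≡⟨ dot-comm (δ j) a ⟩
      dot a (δ j)
        ≡⟨ sub≡0⇒≡ (trans (sym dot-sub) (InSpan-⊥ {φ = a} {v = λ i → δ j i - comb dim c b i} a⊥ (spans (δ j)))) ⟩
      dot a (comb dim c b)                             ≡⟨ dot-combʳ dim a c b ⟩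
      ∑ (allFin dim) (λ i → c i * dot a (b i))
        ≡⟨ ∑-cong (allFin dim) (λ i → trans (ℚₚ.*-comm (c i) (dot a (b i)))
             (cong (dot a (b i) *_) (trans (dot-comm (φ i) (δ j)) (∑-δˡ N j (φ i))))) ⟩
      comb dim (λ i → dot a (b i)) φ j ∎
      where
      c : Fin dim → ℚ
      c i = dot (φ i) (δ j)
      dot-sub : dot a (λ i → δ j i - comb dim c b i) ≡ dot a (δ j) - dot a (comb dim c b)
      dot-sub = trans (∑-cong (allFin N) (λ i → solve 3 (λ x y z → x :* (y :- z) := x :* y :- x :* z) refl (a i) (δ j i) (comb dim c b i)))
        (∑-sub (allFin N) (λ i → a i * δ j i) (λ i → a i * comb dim c b i))

    dim≡d : dim ≡ d
    dim≡d = dimension-unique dim d φ q ind-φ ind-q (λ i → span-q (φ i) (φ⊥ i))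
      (λ k → (λ i → dot (q k) (b i)) , InSpan-cong (λ j → begin
        q k j - comb dim (λ i → dot (q k) (b i)) φ j   ≡⟨ cong (_- comb dim (λ i → dot (q k) (b i)) φ j) (expand (q k) (q⊥ k) j) ⟩
        comb dim (λ i → dot (q k) (b i)) φ j - comb dim (λ i → dot (q k) (b i)) φ j ≡⟨ ℚₚ.+-inverseʳ (comb dim (λ i → dot (q k) (b i)) φ j) ⟩
        0ℚ ∎) InSpan-0)

import Algebra.Solver.CommutativeMonoid
open import Algebra.Structures using (IsCommutativeRing)
open import Data.Empty using (⊥-elim)
open import Data.Nat using (_+_; _∸_; _≤_; _<_; _<ᵇ_; _≡ᵇ_; _≤ᵇ_; z≤n; s≤s)
import Data.Nat.Properties as ℕₚ
open import Data.Sum using (_⊎_; inj₁; inj₂; [_,_]′)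
open import Data.List.Membership.Propositional using (_∉_; find; lose)
open import Data.List.Relation.Unary.Any.Properties using (lookup-index)
import Data.List.Relation.Unary.All.Properties as Allₚ
import Data.List.Relation.Unary.AllPairs.Properties as AllPairsₚ
import Data.List.Relation.Unary.Unique.Propositional.Properties as Uniqueₚ
open import Data.List.Relation.Binary.Permutation.Propositional using (_↭_; ↭-refl; ↭-sym; ↭-trans; prep; swap)
import Data.List.Relation.Binary.Permutation.Propositional.Properties as ↭ₚ
open import Data.Vec using ([]; _∷_)
import Data.Vec.Properties as Vecₚ
open import Data.Fin.Subset using (_∪_; _─_; ⁅_⁆; ∣_∣; _⊆_; _⊂_; Nonempty) renaming (_∈_ to _∈ˢ_; _∉_ to _∉ˢ_; ⊥ to ∅)
open import Data.Fin.Subset.Properties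

-- Booleans, decisions and inclusions of subsets.

does⁻ : ∀ {A : Set} (d : Dec A) → does d ≡ true → A
does⁻ (yes a) _ = a

∧-true⁻ : ∀ {a b} → a ∧ b ≡ true → a ≡ true × b ≡ true
∧-true⁻ {true} {true} _ = refl , refl

∧-true⁺ : ∀ {a b} → a ≡ true → b ≡ true → a ∧ b ≡ true
∧-true⁺ refl refl = refl

bool-ext : ∀ {a b} → (a ≡ true → b ≡ true) → (b ≡ true → a ≡ true) → a ≡ b
bool-ext {true}          f g = sym (f refl)
bool-ext {false} {true}  f g = g refl
bool-ext {false} {false} f g = refl

if-∧ : ∀ {A : Set} p q {x z : A} → (if p then (if q then x else z) else z) ≡ (if p ∧ q then x else z)
if-∧ true  q = refl
if-∧ false q = refl

if-swap : ∀ {A : Set} p q {x z : A} →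
  (if p then (if q then x else z) else z) ≡ (if q then (if p then x else z) else z)
if-swap true  q     = refl
if-swap false true  = refl
if-swap false false = refl

if-cong : ∀ {A : Set} b {x y z : A} → (b ≡ true → x ≡ y) → (if b then x else z) ≡ (if b then y else z)
if-cong true  h = h refl
if-cong false h = refl

allᶠ⁻ : ∀ {n} (p : Fin n → Bool) → allᶠ n p ≡ true → ∀ i → p i ≡ true
allᶠ⁻ {n} p h i = go (allFin n) h (∈-allFin i)
  where
  go : ∀ xs → foldr (λ i b → p i ∧ b) true xs ≡ true → ∀ {i} → i ∈ xs → p i ≡ true
  go (x ∷ xs) h (here refl) = proj₁ (∧-true⁻ h)
  go (x ∷ xs) h (there i∈)  = go xs (proj₂ (∧-true⁻ {p x} h)) i∈

allᶠ⁺ : ∀ {n} (p : Fin n → Bool) → (∀ i → p i ≡ true) → allᶠ n p ≡ true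
allᶠ⁺ {n} p h = go (allFin n)
  where
  go : ∀ xs → foldr (λ i b → p i ∧ b) true xs ≡ true
  go []       = refl
  go (x ∷ xs) = ∧-true⁺ (h x) (go xs)

∈-allSubsets : ∀ {n} (X : Subset n) → X ∈ allSubsets n
∈-allSubsets []          = here refl
∈-allSubsets (true ∷ X)  = ∈-++⁺ˡ (∈-map⁺ (true ∷_) (∈-allSubsets X))
∈-allSubsets {suc n} (false ∷ X) = ∈-++⁺ʳ (map (true ∷_) (allSubsets n)) (∈-map⁺ (false ∷_) (∈-allSubsets X))

⊈⇒∃∉ : ∀ {n} {X Y : Subset n} → ¬ X ⊆ Y → ∃ λ x → x ∈ˢ X × x ∉ˢ Y
⊈⇒∃∉ {n} {X} {Y} X⊈Y with Finₚ.any? (λ x → (x ∈? X) ×-dec ¬? (x ∈? Y))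
... | yes w = w
... | no none = contradiction (λ {x} x∈X → decidable-stable (x ∈? Y) (λ x∉Y → none (x , x∈X , x∉Y))) X⊈Y

⊆⇒≡⊎⊂ : ∀ {n} {X Y : Subset n} → X ⊆ Y → X ≡ Y ⊎ X ⊂ Y
⊆⇒≡⊎⊂ {X = X} {Y} X⊆Y with Y ⊆? X
... | yes Y⊆X = inj₁ (⊆-antisym X⊆Y Y⊆X)
... | no Y⊈X  = inj₂ (X⊆Y , ⊈⇒∃∉ Y⊈X)

⊂⇒⊉ : ∀ {n} {X Y : Subset n} → X ⊂ Y → ¬ Y ⊆ X
⊂⇒⊉ (_ , x , x∈Y , x∉X) Y⊆X = x∉X (Y⊆X x∈Y)

∪-lub : ∀ {n} {X Y Z : Subset n} → X ⊆ Z → Y ⊆ Z → X ∪ Y ⊆ Z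
∪-lub {X = X} {Y} X⊆Z Y⊆Z x∈ = [ X⊆Z , Y⊆Z ]′ (x∈p∪q⁻ X Y x∈)

⁅⁆⊆ : ∀ {n} {x : Fin n} {Y : Subset n} → x ∈ˢ Y → ⁅ x ⁆ ⊆ Y
⁅⁆⊆ {x = x} {Y} x∈Y y∈ = subst (_∈ˢ Y) (sym (x∈⁅y⁆⇒x≡y x y∈)) x∈Y

-- Flats, rank and closure.

module Flats {n : ℕ} (M : MatroidData n) where

  E : Subset n
  E = ground M

  r : Subset n → ℕ
  r = rk M

  IsFlat : Subset n → Set
  IsFlat F = F ⊆ E × (∀ e → e ∈ˢ E → e ∉ˢ F → r F < r (F ∪ ⁅ e ⁆))

  isFlatᵇ⁻ : ∀ {F} → isFlatᵇ M F ≡ true → IsFlat F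
  isFlatᵇ⁻ {F} h = does⁻ (F ⊆? E) (proj₁ (∧-true⁻ h)) , strict
    where
    strict : ∀ e → e ∈ˢ E → e ∉ˢ F → r F < r (F ∪ ⁅ e ⁆)
    strict e e∈E e∉F with allᶠ⁻ _ (proj₂ (∧-true⁻ {F ⊆ᵇ E} h)) e
    ... | q rewrite dec-true (e ∈? E) e∈E | dec-false (e ∈? F) e∉F = ℕₚ.<ᵇ⇒< (r F) _ (subst T (sym q) _)

  isFlatᵇ⁺ : ∀ {F} → IsFlat F → isFlatᵇ M F ≡ true
  isFlatᵇ⁺ {F} (F⊆E , strict) = ∧-true⁺ (dec-true (F ⊆? E) F⊆E) (allᶠ⁺ _ each)
    where
    T⇒≡ : ∀ {b} → T b → b ≡ true
    T⇒≡ {true} _ = refl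
    each : ∀ e → (if (e ∈ᵇ E) ∧ not (e ∈ᵇ F) then r F <ᵇ r (F ∪ ⁅ e ⁆) else true) ≡ true
    each e with e ∈? E | e ∈? F
    ... | yes e∈E | yes e∈F = refl
    ... | yes e∈E | no e∉F  = T⇒≡ (ℕₚ.<⇒<ᵇ (strict e e∈E e∉F))
    ... | no _    | _       = refl

  ∈-flats⁻ : ∀ {F} → F ∈ flats M → IsFlat F
  ∈-flats⁻ F∈ = isFlatᵇ⁻ (proj₂ (∈-filter⁻ (λ F → isFlatᵇ M F Data.Bool.≟ true) {xs = allSubsets n} F∈))

  ∈-flats⁺ : ∀ {F} → IsFlat F → F ∈ flats M
  ∈-flats⁺ {F} flat = ∈-filter⁺ (λ F → isFlatᵇ M F Data.Bool.≟ true) (∈-allSubsets F) (isFlatᵇ⁺ flat)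

  abstract
    isFlat? : ∀ F → Dec (IsFlat F)
    isFlat? F = map′ isFlatᵇ⁻ isFlatᵇ⁺ (isFlatᵇ M F Data.Bool.≟ true)

  E-flat : IsFlat E
  E-flat = ⊆-refl , λ e e∈E e∉E → contradiction e∈E e∉E

  module MatroidProperties (isM : IsMatroid M) where
    open IsMatroid isM

    r-mono : ∀ {X Y} → X ⊆ Y → Y ⊆ E → r X ≤ r Y
    r-mono {X} {Y} = R2 X Y

    -- Diminishing returns: `Y` adds at most as much rank to `K` as to the smaller set `X`. This is
    -- `R3` for `K` and `X ∪ Y`, whose intersection contains `X`.
    submodular : ∀ {X K Y} → X ⊆ K → K ⊆ E → Y ⊆ E → r (K ∪ Y) + r X ≤ r K + r (X ∪ Y)
    submodular {X} {K} {Y} X⊆K K⊆E Y⊆E = ℕₚ.≤-trans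
      (ℕₚ.+-mono-≤ (r-mono (∪-lub (p⊆p∪q _) (⊆-trans (q⊆p∪q X Y) (q⊆p∪q K _))) (∪-lub K⊆E X∪Y⊆E))
                   (r-mono (λ x∈ → x∈p∩q⁺ (X⊆K x∈ , p⊆p∪q Y x∈)) (⊆-trans (p∩q⊆p K _) K⊆E)))
      (R3 K (X ∪ Y) K⊆E X∪Y⊆E)
      where
      X∪Y⊆E : X ∪ Y ⊆ E
      X∪Y⊆E = ∪-lub (⊆-trans X⊆K K⊆E) Y⊆E

    r-strict : ∀ {F G} → IsFlat F → F ⊂ G → G ⊆ E → r F < r G
    r-strict (_ , strict) (F⊆G , x , x∈G , x∉F) G⊆E =
      ℕₚ.<-≤-trans (strict x (G⊆E x∈G) x∉F) (r-mono (∪-lub F⊆G (⁅⁆⊆ x∈G)) G⊆E)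

    r-∪-⁅⁆≤ : ∀ {X} → X ⊆ E → ∀ {e} → e ∈ˢ E → r (X ∪ ⁅ e ⁆) ≤ suc (r X)
    r-∪-⁅⁆≤ {X} X⊆E {e} e∈E = ℕₚ.≤-trans (ℕₚ.m≤m+n _ _) (ℕₚ.≤-trans (R3 X ⁅ e ⁆ X⊆E (⁅⁆⊆ e∈E))
      (ℕₚ.≤-trans (ℕₚ.+-monoʳ-≤ (r X) (subst (r ⁅ e ⁆ ≤_) (∣⁅x⁆∣≡1 e) (R1 ⁅ e ⁆ (⁅⁆⊆ e∈E)))) (ℕₚ.≤-reflexive (ℕₚ.+-comm (r X) 1))))

    -- The rank count behind the vanishing of powers of σ. Adding `a` to `F` already uses one unit
    -- of rank, so `H` adds at most `d` to `F ∪ ⁅ a ⁆`, and by diminishing returns at most `d` to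
    -- the larger flat `L`.
    r-∪-descend : ∀ {F L H a d} → IsFlat F → F ⊆ L → L ⊆ E → H ⊆ E → a ∈ˢ H → a ∉ˢ F → a ∈ˢ L →
      r (F ∪ H) ≤ r F + suc d → r (L ∪ H) ≤ r L + d
    r-∪-descend {F} {L} {H} {a} {d} (F⊆E , jump) F⊆L L⊆E H⊆E a∈H a∉F a∈L r≤ =
      ℕₚ.+-cancelʳ-≤ (r X) (r (L ∪ H)) (r L + d) (begin
        r (L ∪ H) + r X        ≤⟨ submodular (∪-lub F⊆L (⁅⁆⊆ a∈L)) L⊆E H⊆E ⟩
        r L + r (X ∪ H)        ≤⟨ ℕₚ.+-monoʳ-≤ (r L) (r-mono (∪-lub (∪-lub (p⊆p∪q H) (⁅⁆⊆ (q⊆p∪q F H a∈H))) (q⊆p∪q F H)) (∪-lub F⊆E H⊆E)) ⟩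
        r L + r (F ∪ H)        ≤⟨ ℕₚ.+-monoʳ-≤ (r L) r≤ ⟩
        r L + (r F + suc d)    ≡⟨ cong (r L +_) (trans (ℕₚ.+-suc (r F) d) (ℕₚ.+-comm (suc (r F)) d)) ⟩
        r L + (d + suc (r F))  ≤⟨ ℕₚ.+-monoʳ-≤ (r L) (ℕₚ.+-monoʳ-≤ d (jump a (H⊆E a∈H) a∉F)) ⟩
        r L + (d + r X)        ≡⟨ ℕₚ.+-assoc (r L) d (r X) ⟨
        r L + d + r X          ∎)
      where
      open ℕₚ.≤-Reasoning
      X : Subset n
      X = F ∪ ⁅ a ⁆

    record Closure (X : Subset n) : Set where
      field
        cl      : Subset n
        flat    : IsFlat cl
        ⊆cl     : X ⊆ cl
        r-cl    : r cl ≡ r X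
        least   : ∀ {K} → IsFlat K → X ⊆ K → cl ⊆ K

    -- Elements that do not raise the rank are added until none is left. Each round enlarges `X` and
    -- consumes one unit of fuel, so the bound `n < ∣ X ∣ + t` persists; at `t = 0` it contradicts
    -- the size of the ambient set.
    closure-fuel : ∀ t X → X ⊆ E → n < ∣ X ∣ + t → Closure X
    closure-fuel zero X X⊆E n< = contradiction (∣p∣≤n X) (ℕₚ.<⇒≱ (subst (n <_) (ℕₚ.+-identityʳ _) n<))
    closure-fuel (suc t) X X⊆E n<
      with Finₚ.any? (λ e → (e ∈? E) ×-dec (¬? (e ∈? X) ×-dec (r (X ∪ ⁅ e ⁆) ℕₚ.≤? r X)))
    ... | no none = record
      { cl = X ; flat = X⊆E , λ e e∈E e∉X → ℕₚ.≰⇒> (λ le → none (e , e∈E , e∉X , le))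
      ; ⊆cl = ⊆-refl ; r-cl = refl ; least = λ _ X⊆K → X⊆K }
    ... | yes (e , e∈E , e∉X , le) = record
      { cl = C.cl ; flat = C.flat ; ⊆cl = ⊆-trans (p⊆p∪q _) C.⊆cl
      ; r-cl = trans C.r-cl (ℕₚ.≤-antisym le (r-mono (p⊆p∪q _) X∪e⊆E))
      ; least = λ {K} flatK X⊆K → C.least flatK (∪-lub X⊆K (⁅⁆⊆ (e∈K flatK X⊆K))) }
      where
      X∪e⊆E : X ∪ ⁅ e ⁆ ⊆ E
      X∪e⊆E = ∪-lub X⊆E (⁅⁆⊆ e∈E)
      grows : X ⊂ X ∪ ⁅ e ⁆
      grows = p⊆p∪q _ , e , q⊆p∪q X _ (x∈⁅x⁆ e) , e∉X
      module C = Closure (closure-fuel t (X ∪ ⁅ e ⁆) X∪e⊆E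
        (ℕₚ.<-≤-trans n< (ℕₚ.≤-trans (ℕₚ.≤-reflexive (ℕₚ.+-suc ∣ X ∣ t)) (ℕₚ.+-monoˡ-≤ t (p⊂q⇒∣p∣<∣q∣ grows)))))
      -- If `e` were outside the flat `K`, it would raise the rank of `K` although it does not raise
      -- the rank of the subset `X`, against diminishing returns.
      e∈K : ∀ {K} → IsFlat K → X ⊆ K → e ∈ˢ K
      e∈K {K} (K⊆E , strict) X⊆K = decidable-stable (e ∈? K) λ e∉K →
        ℕₚ.<-irrefl refl (ℕₚ.<-≤-trans (strict e e∈E e∉K)
          (ℕₚ.+-cancelʳ-≤ (r X) _ _ (ℕₚ.≤-trans (submodular X⊆K K⊆E (⁅⁆⊆ e∈E)) (ℕₚ.+-monoʳ-≤ (r K) le))))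

    closure : ∀ X → X ⊆ E → Closure X
    closure X X⊆E = closure-fuel (suc n) X X⊆E (ℕₚ.m≤n+m (suc n) ∣ X ∣)

    -- The closure of `F ∪ ⁅ a ⁆`. Among the flats above `F`, those that contain `a` are those that
    -- contain `B`; this is how a linear relation at `a` turns into a relation for σ of a flat of
    -- relative rank 1.
    cover : ∀ {F} → IsFlat F → ∀ {a} → a ∈ˢ E → a ∉ˢ F →
      ∃ λ B → IsFlat B × F ⊂ B × a ∈ˢ B × r B ≡ suc (r F) × (∀ {K} → IsFlat K → F ⊆ K → a ∈ˢ K → B ⊆ K)
    cover {F} (F⊆E , strict) {a} a∈E a∉F =
      C.cl , C.flat , (⊆-trans (p⊆p∪q _) C.⊆cl , a , a∈cl , a∉F) , a∈cl ,
      trans C.r-cl (ℕₚ.≤-antisym (r-∪-⁅⁆≤ F⊆E a∈E) (strict a a∈E a∉F)) ,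
      λ flatK F⊆K a∈K → C.least flatK (∪-lub F⊆K (⁅⁆⊆ a∈K))
      where
      module C = Closure (closure (F ∪ ⁅ a ⁆) (∪-lub F⊆E (⁅⁆⊆ a∈E)))
      a∈cl : a ∈ˢ C.cl
      a∈cl = C.⊆cl (q⊆p∪q F _ (x∈⁅x⁆ a))

    r∅≡0 : r ∅ ≡ 0
    r∅≡0 = ℕₚ.n≤0⇒n≡0 (subst (r ∅ ≤_) (∣⊥∣≡0 n) (R1 ∅ ⊥⊆))

    ∅-flat : Loopless M → IsFlat ∅
    ∅-flat loopless = ⊥⊆ , λ e e∈E _ →
      subst (r ∅ <_) (sym (trans (cong r (∪-identityˡ ⁅ e ⁆)) (loopless e e∈E))) (s≤s (ℕₚ.≤-reflexive r∅≡0))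

-- The functionals below only use ring arithmetic. Keeping the ring abstract stops the type checker
-- from unfolding rational arithmetic.
record Scalars : Set₁ where
  infixl 6 _⊕_
  infix  8 ⊖_
  field
    K                 : Set
    _⊕_ _⊗_           : K → K → K
    ⊖_                : K → K
    𝟘 𝟙               : K
    isCommutativeRing : IsCommutativeRing _≡_ _⊕_ _⊗_ ⊖_ 𝟘 𝟙

  commutativeRing : CommutativeRing 0ℓ 0ℓ
  commutativeRing = record { isCommutativeRing = isCommutativeRing }

  open IsCommutativeRing isCommutativeRing public
    using () renaming (+-assoc to ⊕-assoc; +-comm to ⊕-comm; +-identityˡ to ⊕-identityˡ; +-identityʳ to ⊕-identityʳ;
                       -‿inverseˡ to ⊖-inverseˡ; -‿inverseʳ to ⊖-inverseʳ)
  open import Algebra.Properties.Ring (CommutativeRing.ring commutativeRing) public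
    using () renaming (-0#≈0# to ⊖𝟘)
  open import Algebra.Properties.Group (CommutativeRing.+-group commutativeRing) public
    using () renaming (∙-cancelʳ to ⊕-cancelʳ)
  open ListSum commutativeRing public
  open ≡-Reasoning

  𝟘⊕𝟘 : ∀ {x y} → x ≡ 𝟘 → y ≡ 𝟘 → x ⊕ y ≡ 𝟘
  𝟘⊕𝟘 refl refl = ⊕-identityˡ 𝟘

  ⊖-⊕-cancel : ∀ x y → (x ⊕ ⊖ y) ⊕ y ≡ x
  ⊖-⊕-cancel x y = trans (⊕-assoc x (⊖ y) y) (trans (cong (x ⊕_) (⊖-inverseˡ y)) (⊕-identityʳ x))

  ⊕-⊖-cancel : ∀ x y → (x ⊕ y) ⊕ ⊖ y ≡ x
  ⊕-⊖-cancel x y = trans (⊕-assoc x y (⊖ y)) (trans (cong (x ⊕_) (⊖-inverseʳ y)) (⊕-identityʳ x))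

-- For a linear operator s and sequences Φ₀, Φ₁, … of functions, U is "shift + s". A sequence killed by
-- Uʳ is determined by its first r terms, which are arbitrary.
module Sequences (𝕂 : Scalars) {X : Set} (s : (X → Scalars.K 𝕂) → (X → Scalars.K 𝕂))
  (s-cong : ∀ {f g} → f ≗ g → s f ≗ s g) (s-𝟘 : s (λ _ → Scalars.𝟘 𝕂) ≗ (λ _ → Scalars.𝟘 𝕂)) where
  open Scalars 𝕂

  Seq : Set
  Seq = ℕ → X → K

  U : Seq → Seq
  U Φ e x = Φ (suc e) x ⊕ s (Φ e) x

  U^ : ℕ → Seq → Seq
  U^ zero    Φ = Φ
  U^ (suc j) Φ = U (U^ j Φ)

  U-cong : ∀ {Φ Ψ : Seq} → (∀ e → Φ e ≗ Ψ e) → ∀ e → U Φ e ≗ U Ψ e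
  U-cong h e x = cong₂ _⊕_ (h (suc e) x) (s-cong (h e) x)

  U^-cong : ∀ j {Φ Ψ : Seq} → (∀ e → Φ e ≗ Ψ e) → ∀ e → U^ j Φ e ≗ U^ j Ψ e
  U^-cong zero    h = h
  U^-cong (suc j) h = U-cong (U^-cong j h)

  U^-𝟘 : ∀ j e → U^ j (λ _ _ → 𝟘) e ≗ (λ _ → 𝟘)
  U^-𝟘 zero    e x = refl
  U^-𝟘 (suc j) e x = 𝟘⊕𝟘 (U^-𝟘 j (suc e) x) (trans (s-cong (U^-𝟘 j e) x) (s-𝟘 x))

  -- `U^ j Φ e` involves only the terms of `Φ` from index `e` to `e + j`.
  U^-agree : ∀ r {Φ Ψ : Seq} → (∀ e → e < r → Φ e ≗ Ψ e) → ∀ j e → e + j < r → U^ j Φ e ≗ U^ j Ψ e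
  U^-agree r h zero    e lt = h e (subst (_< r) (ℕₚ.+-identityʳ e) lt)
  U^-agree r h (suc j) e lt x = cong₂ _⊕_ (U^-agree r h j (suc e) lt′ x)
    (s-cong (U^-agree r h j e (ℕₚ.<-trans (ℕₚ.n<1+n _) lt′)) x)
    where lt′ = subst (_< r) (ℕₚ.+-suc e j) lt

  -- One factor `U` is removed at a time. The sequences `U^ r Φ` and `U^ r Ψ` agree at index 0,
  -- where only the given initial terms enter, and then everywhere, because their common image under
  -- `U` is a first-order recurrence.
  U^-unique : ∀ r {Φ Ψ : Seq} → (∀ e → U^ r Φ e ≗ U^ r Ψ e) → (∀ e → e < r → Φ e ≗ Ψ e) → ∀ e → Φ e ≗ Ψ e
  U^-unique zero    same agree = same
  U^-unique (suc r) {Φ} {Ψ} same agree = U^-unique r down (λ e lt → agree e (ℕₚ.m<n⇒m<1+n lt))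
    where
    down : ∀ e → U^ r Φ e ≗ U^ r Ψ e
    down zero    = U^-agree (suc r) agree r zero (ℕₚ.n<1+n r)
    down (suc e) x = ⊕-cancelʳ (s (U^ r Φ e) x) _ _
      (trans (same e x) (cong (U^ r Ψ (suc e) x ⊕_) (sym (s-cong (down e) x))))

  module Fill (r : ℕ) (init : Seq) where

    -- The values of `U^ j fill` at index 0: for `j < r` those forced by `init`, and zero from `r`
    -- on, which makes `U^ r fill` vanish.
    y : ℕ → X → K
    y j x = if does (j ℕₚ.<? r) then U^ j init 0 x else 𝟘

    -- The table of the values `U^ j fill e`: the definition of `U` is solved for the entry at
    -- `suc e`, starting from the boundary column `y`.
    Z : ℕ → ℕ → X → K
    Z zero    j   = y j
    Z (suc e) j x = Z e (suc j) x ⊕ ⊖ s (Z e j) x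

    fill : Seq
    fill e = Z e 0

    U^-fill : ∀ j e → U^ j fill e ≗ Z e j
    U^-fill zero    e x = refl
    U^-fill (suc j) e x = trans (cong₂ _⊕_ (U^-fill j (suc e) x) (s-cong (U^-fill j e) x))
      (⊖-⊕-cancel (Z e (suc j) x) (s (Z e j) x))

    Z-𝟘 : ∀ e j → r ≤ j → Z e j ≗ (λ _ → 𝟘)
    Z-𝟘 zero    j r≤j x rewrite dec-false (j ℕₚ.<? r) (ℕₚ.≤⇒≯ r≤j) = refl
    Z-𝟘 (suc e) j r≤j x = 𝟘⊕𝟘 (Z-𝟘 e (suc j) (ℕₚ.m≤n⇒m≤1+n r≤j) x)
      (trans (cong ⊖_ (trans (s-cong (Z-𝟘 e j r≤j) x) (s-𝟘 x))) ⊖𝟘)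

    fill-U^ : ∀ e → U^ r fill e ≗ (λ _ → 𝟘)
    fill-U^ e x = trans (U^-fill r e x) (Z-𝟘 e r ℕₚ.≤-refl x)

    Z-init : ∀ e j → e + j < r → Z e j ≗ U^ j init e
    Z-init zero    j lt x rewrite dec-true (j ℕₚ.<? r) lt = refl
    Z-init (suc e) j lt x = trans
      (cong₂ (λ p q → p ⊕ ⊖ q) (Z-init e (suc j) (subst (_< r) (sym (ℕₚ.+-suc e j)) lt) x)
        (s-cong (Z-init e j (ℕₚ.<-trans (ℕₚ.n<1+n _) lt)) x))
      (⊕-⊖-cancel (U^ j init (suc e) x) (s (U^ j init e) x))

    fill-init : ∀ e → e < r → fill e ≗ init e
    fill-init e lt = Z-init e 0 (subst (_< r) (sym (ℕₚ.+-identityʳ e)) lt)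

    -- Entries of `Z` arise from `init` by addition, negation and `s` only, so `fill` inherits every
    -- property stable under these; it is used for support and symmetry.
    module Closed (C : (X → K) → Set) (C-𝟘 : C (λ _ → 𝟘))
      (C-⊕ : ∀ {f g} → C f → C g → C (λ x → f x ⊕ g x))
      (C-⊖ : ∀ {f} → C f → C (λ x → ⊖ f x)) (C-s : ∀ {f} → C f → C (s f))
      (C-init : ∀ e → C (init e)) where

      U^-closed : ∀ j e → C (U^ j init e)
      U^-closed zero    e = C-init e
      U^-closed (suc j) e = C-⊕ (U^-closed j (suc e)) (C-s (U^-closed j e))

      Z-closed : ∀ e j → C (Z e j)
      Z-closed zero    j with does (j ℕₚ.<? r)
      ... | true  = U^-closed j 0
      ... | false = C-𝟘
      Z-closed (suc e) j = C-⊕ (Z-closed e (suc j)) (C-⊖ (C-s (Z-closed e j)))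

      fill-closed : ∀ e → C (fill e)
      fill-closed e = Z-closed e 0

  single : (X → K) → Seq
  single f zero    = f
  single f (suc e) = λ _ → 𝟘

  s^ : ℕ → (X → K) → (X → K)
  s^ zero    f = f
  s^ (suc j) f = s (s^ j f)

  U^-single : ∀ j f e → U^ j (single f) e ≗ single (s^ j f) e
  U^-single zero    f e       x = refl
  U^-single (suc j) f zero    x = trans (cong₂ _⊕_ (U^-single j f 1 x) (s-cong (U^-single j f 0) x)) (⊕-identityˡ _)
  U^-single (suc j) f (suc e) x = 𝟘⊕𝟘 (U^-single j f (suc (suc e)) x)
    (trans (s-cong (U^-single j f (suc e)) x) (s-𝟘 x))

  module Commuting (t : (X → K) → (X → K)) (C : (X → K) → Set)
    (t-cong : ∀ {f g} → f ≗ g → t f ≗ t g) (t-⊕ : ∀ f g → t (λ x → f x ⊕ g x) ≗ (λ x → t f x ⊕ t g x))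
    (C-⊕ : ∀ {f g} → C f → C g → C (λ x → f x ⊕ g x)) (C-s : ∀ {f} → C f → C (s f))
    (comm : ∀ {f} → C f → s (t f) ≗ t (s f)) where

    U^-C : ∀ j {Φ : Seq} → (∀ e → C (Φ e)) → ∀ e → C (U^ j Φ e)
    U^-C zero    h   = h
    U^-C (suc j) h e = C-⊕ (U^-C j h (suc e)) (C-s (U^-C j h e))

    U^-commute : ∀ j {Φ : Seq} → (∀ e → C (Φ e)) → ∀ e → U^ j (λ e → t (Φ e)) e ≗ t (U^ j Φ e)
    U^-commute zero    h e x = refl
    U^-commute (suc j) {Φ} h e x = trans
      (cong₂ _⊕_ (U^-commute j h (suc e) x) (trans (s-cong (U^-commute j h e) x) (comm (U^-C j h e) x)))
      (sym (t-⊕ (U^ j Φ (suc e)) (s (U^ j Φ e)) x))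

-- Enumerations of subsets without repetition, and sums over flats.

_≟ˢ_ : ∀ {n} (X Y : Subset n) → Dec (X ≡ Y)
_≟ˢ_ = Vecₚ.≡-dec Data.Bool._≟_

concatMap-allPairs : ∀ {A B : Set} {R : B → B → Set} (f : A → List B) {xs} →
  AllPairs (λ x y → ∀ v w → v ∈ f x → w ∈ f y → R v w) xs → (∀ x → AllPairs R (f x)) → AllPairs R (concatMap f xs)
concatMap-allPairs f []          each = []
concatMap-allPairs f {x ∷ xs} (across ∷ rest) each = AllPairsₚ.++⁺ (each x) (concatMap-allPairs f rest each)
  (All.tabulate λ v∈ → All.tabulate λ w∈ →
    let y , y∈ , w∈y = find (∈-concatMap⁻ f {xs = xs} w∈) in All.lookup across y∈ _ _ v∈ w∈y)

lookup-allPairs : ∀ {A : Set} {R : A → A → Set} → (∀ {x y} → R x y → R y x) → ∀ {xs} → AllPairs R xs →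
  ∀ i j → i ≢ j → R (lookup xs i) (lookup xs j)
lookup-allPairs R-sym (Rx ∷ R) Fin.zero    Fin.zero    ne = contradiction refl ne
lookup-allPairs R-sym {x ∷ xs} (Rx ∷ R) Fin.zero    (Fin.suc j) ne = All.lookup Rx (∈-lookup {xs = xs} j)
lookup-allPairs R-sym {x ∷ xs} (Rx ∷ R) (Fin.suc i) Fin.zero    ne = R-sym (All.lookup Rx (∈-lookup {xs = xs} i))
lookup-allPairs R-sym (Rx ∷ R) (Fin.suc i) (Fin.suc j) ne = lookup-allPairs R-sym R i j (ne ∘ cong Fin.suc)

lookup-injective : ∀ {A : Set} {xs : List A} → Unique xs → ∀ i j → lookup xs i ≡ lookup xs j → i ≡ j
lookup-injective uniq i j eq = decidable-stable (i Fin.≟ j) (λ ne → lookup-allPairs (λ ne′ → ne′ ∘ sym) uniq i j ne eq)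

allSubsets-unique : ∀ n → Unique (allSubsets n)
allSubsets-unique zero    = [] ∷ []
allSubsets-unique (suc n) = Uniqueₚ.++⁺ (Uniqueₚ.map⁺ Vecₚ.∷-injectiveʳ (allSubsets-unique n))
  (Uniqueₚ.map⁺ Vecₚ.∷-injectiveʳ (allSubsets-unique n)) disjoint
  where
  disjoint : ∀ {X} → ¬ (X ∈ map (true ∷_) (allSubsets n) × X ∈ map (false ∷_) (allSubsets n))
  disjoint (p , q) with ∈-map⁻ (true ∷_) p | ∈-map⁻ (false ∷_) q
  ... | _ , _ , refl | _ , _ , ()

-- Listing `false` before `true` makes the list a linear extension of inclusion with the small sets
-- first. `build` recurses into the tail before it treats the head, so it meets the large flats
-- first.
subsetsUp : ∀ n → List (Subset n)
subsetsUp zero    = [] ∷ []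
subsetsUp (suc n) = map (false ∷_) (subsetsUp n) ++ map (true ∷_) (subsetsUp n)

∈-subsetsUp : ∀ {n} (X : Subset n) → X ∈ subsetsUp n
∈-subsetsUp []          = here refl
∈-subsetsUp (false ∷ X) = ∈-++⁺ˡ (∈-map⁺ (false ∷_) (∈-subsetsUp X))
∈-subsetsUp {suc n} (true ∷ X) = ∈-++⁺ʳ (map (false ∷_) (subsetsUp n)) (∈-map⁺ (true ∷_) (∈-subsetsUp X))

∷-⊈ : ∀ {n} {X Y : Subset n} {b} → ¬ Y ⊆ X → ¬ b ∷ Y ⊆ b ∷ X
∷-⊈ Y⊈X sub = Y⊈X (drop-∷-⊆ sub)

subsetsUp-sorted : ∀ n → AllPairs (λ X Y → ¬ Y ⊆ X) (subsetsUp n)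
subsetsUp-sorted zero    = [] ∷ []
subsetsUp-sorted (suc n) = AllPairsₚ.++⁺
  (AllPairsₚ.map⁺ (AllPairs.map ∷-⊈ (subsetsUp-sorted n)))
  (AllPairsₚ.map⁺ (AllPairs.map ∷-⊈ (subsetsUp-sorted n)))
  (All.tabulate λ X∈ → All.tabulate λ Y∈ → across (∈-map⁻ (false ∷_) X∈) (∈-map⁻ (true ∷_) Y∈))
  where
  across : ∀ {X Y} → (∃ λ X′ → X′ ∈ subsetsUp n × X ≡ false ∷ X′) → (∃ λ Y′ → Y′ ∈ subsetsUp n × Y ≡ true ∷ Y′) → ¬ Y ⊆ X
  across (_ , _ , refl) (_ , _ , refl) sub with sub Data.Vec.here
  ... | ()

flats-unique : ∀ {n} (M : MatroidData n) → Unique (flats M)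
flats-unique {n} M = Uniqueₚ.filter⁺ (λ F → isFlatᵇ M F Data.Bool.≟ true) (allSubsets-unique n)

module FlatSums (𝕂 : Scalars) {n : ℕ} (M : MatroidData n) where
  open Scalars 𝕂
  open Flats M

  ∑-at : ∀ {G} → IsFlat G → (f : Subset n → K) → ∑ (flats M) (λ L → if does (L ≟ˢ G) then f L else 𝟘) ≡ f G
  ∑-at {G} flatG f = ∑-single (flats-unique M) (∈-flats⁺ flatG) (λ L → does (L ≟ˢ G)) f
    (dec-true (G ≟ˢ G) refl) (λ L _ → does⁻ (L ≟ˢ G))

  ∑-at-∅ : IsFlat ∅ → (f : Subset n → K) → ∑ (flats M) (λ L → if isEmptyᵇ L then f L else 𝟘) ≡ f ∅
  ∑-at-∅ flat∅ f = ∑-single (flats-unique M) (∈-flats⁺ flat∅) isEmptyᵇ f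
    (dec-true (_⊆?_ {n} ∅ ∅) ⊆-refl) (λ L _ h → ⊆-antisym (does⁻ (L ⊆? ∅) h) ⊥⊆)

-- Words in the flats, standing for monomials in the variables x_L.

Word : ℕ → Set
Word n = List (Subset n)

pow : ∀ {n} → Subset n → ℕ → Word n → Word n
pow G e m = replicate e G ++ m

∈-replicate⁻ : ∀ {A : Set} {x y : A} e → x ∈ replicate e y → x ≡ y
∈-replicate⁻ (suc e) (here refl) = refl
∈-replicate⁻ (suc e) (there x∈)  = ∈-replicate⁻ e x∈

∈-pow⁻ : ∀ {n} {G L : Subset n} e {m} → L ∈ pow G e m → L ≡ G ⊎ L ∈ m
∈-pow⁻ {G = G} e L∈ with ∈-++⁻ (replicate e G) L∈
... | inj₁ p = inj₁ (∈-replicate⁻ e p)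
... | inj₂ q = inj₂ q

∈-pow⁺ : ∀ {n} {G L : Subset n} e {m} → L ∈ m → L ∈ pow G e m
∈-pow⁺ {G = G} e L∈ = ∈-++⁺ʳ (replicate e G) L∈

pow-∷ : ∀ {n} (G : Subset n) e K m → K ∷ pow G e m ↭ pow G e (K ∷ m)
pow-∷ G e K m = ↭-sym (↭ₚ.shift K (replicate e G) m)

_without_ : ∀ {n} → Word n → Subset n → Word n
w without G = filter (λ L → ¬? (L ≟ˢ G)) w

count : ∀ {n} → Subset n → Word n → ℕ
count G w = length (filter (_≟ˢ G) w)

↭-pow-without : ∀ {n} (G : Subset n) w → w ↭ pow G (count G w) (w without G)
↭-pow-without G []      = ↭-refl
↭-pow-without G (L ∷ w) with L ≟ˢ G
... | yes refl = prep L (↭-pow-without G w)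
... | no _     = ↭-trans (prep L (↭-pow-without G w)) (pow-∷ G (count G w) L (w without G))

count-↭ : ∀ {n} (G : Subset n) {w w′} → w ↭ w′ → count G w ≡ count G w′
count-↭ G p = ↭ₚ.↭-length (↭ₚ.filter-↭ (_≟ˢ G) p)

count-∉ : ∀ {n} {G : Subset n} {m} → G ∉ m → count G m ≡ 0
count-∉ {G = G} {m} G∉m = cong length (Listₚ.filter-none (_≟ˢ G) (All.tabulate λ { L∈ refl → G∉m L∈ }))

∈⇒count≢0 : ∀ {n} {G : Subset n} {w} → G ∈ w → count G w ≢ 0
∈⇒count≢0 {G = G} {w} G∈w eq with filter (_≟ˢ G) w | ∈-filter⁺ (_≟ˢ G) G∈w refl
∈⇒count≢0 G∈w () | _ ∷ _ | here _
∈⇒count≢0 G∈w () | _ ∷ _ | there _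

count-pow : ∀ {n} {G : Subset n} e {m} → G ∉ m → count G (pow G e m) ≡ e
count-pow zero    G∉m = count-∉ G∉m
count-pow {G = G} (suc e) G∉m with G ≟ˢ G
... | yes _  = cong suc (count-pow e G∉m)
... | no G≢G = contradiction refl G≢G

without-pow : ∀ {n} {G : Subset n} e {m} → G ∉ m → pow G e m without G ≡ m
without-pow {G = G} zero {m} G∉m = Listₚ.filter-all (λ L → ¬? (L ≟ˢ G)) (All.tabulate λ { L∈ refl → G∉m L∈ })
without-pow {G = G} (suc e) G∉m with G ≟ˢ G
... | yes _  = without-pow e G∉m
... | no G≢G = contradiction refl G≢G

Comparable : ∀ {n} → Subset n → Subset n → Set
Comparable X Y = X ⊆ Y ⊎ Y ⊆ X

comparable? : ∀ {n} (X Y : Subset n) → Dec (Comparable X Y)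
comparable? X Y = (X ⊆? Y) ⊎-dec (Y ⊆? X)

Comparable-sym : ∀ {n} {X Y : Subset n} → Comparable X Y → Comparable Y X
Comparable-sym = λ { (inj₁ p) → inj₂ p ; (inj₂ p) → inj₁ p }

module Words {n : ℕ} (M : MatroidData n) where
  open Flats M

  -- the words indexing nonzero monomials of the Chow ring of M / F
  record Ok (F : Subset n) (w : Word n) : Set where
    field
      flat  : ∀ {L} → L ∈ w → IsFlat L
      above : ∀ {L} → L ∈ w → F ⊂ L
      chain : ∀ {L L′} → L ∈ w → L′ ∈ w → Comparable L L′
  open Ok

  abstract
    ok? : ∀ F w → Dec (Ok F w)
    ok? F w = map′
      (λ h → record { flat  = λ L∈ → proj₁ (All.lookup h L∈)
                    ; above = λ L∈ → proj₁ (proj₂ (All.lookup h L∈))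
                    ; chain = λ L∈ L′∈ → All.lookup (proj₂ (proj₂ (All.lookup h L∈))) L′∈ })
      (λ ok → All.tabulate λ L∈ → flat ok L∈ , above ok L∈ , All.tabulate λ L′∈ → chain ok L∈ L′∈)
      (All.all? (λ L → isFlat? L ×-dec ((F ⊂? L) ×-dec All.all? (comparable? L) w)) w)

  ok-⊆ : ∀ {F w w′} → (∀ {L} → L ∈ w′ → L ∈ w) → Ok F w → Ok F w′
  ok-⊆ sub ok = record
    { flat = flat ok ∘ sub ; above = above ok ∘ sub ; chain = λ p q → chain ok (sub p) (sub q) }

  ok-↭ : ∀ {F w w′} → w ↭ w′ → Ok F w → Ok F w′
  ok-↭ p = ok-⊆ (↭ₚ.∈-resp-↭ (↭-sym p))

  ok-tail : ∀ {F L w} → Ok F (L ∷ w) → Ok F w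
  ok-tail = ok-⊆ there

  ok-[] : ∀ {F} → Ok F []
  ok-[] = record { flat = λ () ; above = λ () ; chain = λ () }

  ok-∷ : ∀ {F L w} → IsFlat L → F ⊂ L → (∀ {L′} → L′ ∈ w → Comparable L L′) → Ok F w → Ok F (L ∷ w)
  ok-∷ {F} {L} {w} flatL F⊂L cmp ok = record
    { flat  = λ { (here refl) → flatL ; (there p) → flat ok p }
    ; above = λ { (here refl) → F⊂L ; (there p) → above ok p }
    ; chain = λ { (here refl) (here refl) → inj₁ ⊆-refl
                ; (here refl) (there q) → cmp q
                ; (there p) (here refl) → Comparable-sym (cmp p)
                ; (there p) (there q) → chain ok p q } }

  ok-raise : ∀ {F G w} → (∀ {L} → L ∈ w → G ⊂ L) → Ok F w → Ok G w
  ok-raise above′ ok = record { flat = flat ok ; above = above′ ; chain = chain ok }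

  ok-lower : ∀ {F G w} → F ⊆ G → Ok G w → Ok F w
  ok-lower F⊆G ok = record
    { flat = flat ok ; above = λ L∈ → ⊆-⊂-trans F⊆G (above ok L∈) ; chain = chain ok }

  ok-∉ : ∀ {G m} → Ok G m → G ∉ m
  ok-∉ ok G∈m = ⊂-irref refl (above ok G∈m)

  ok-pow : ∀ {F G} → IsFlat G → F ⊂ G → ∀ e {m} → Ok G m → Ok F (pow G e m)
  ok-pow flatG F⊂G zero    ok = ok-lower (p⊂q⇒p⊆q F⊂G) ok
  ok-pow {F} {G} flatG F⊂G (suc e) {m} ok = ok-∷ flatG F⊂G cmp (ok-pow flatG F⊂G e ok)
    where
    cmp : ∀ {L} → L ∈ pow G e m → Comparable G L
    cmp L∈ with ∈-pow⁻ e L∈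
    ... | inj₁ refl = inj₁ ⊆-refl
    ... | inj₂ L∈m  = inj₁ (p⊂q⇒p⊆q (above ok L∈m))

  ok-∷-raise : ∀ {F G L} e {m} → Ok F (L ∷ pow G e m) → G ⊂ L → Ok G m → Ok G (L ∷ m)
  ok-∷-raise {G = G} e okF G⊂L okG = ok-∷ (flat okF (here refl)) G⊂L
    (λ p → chain okF (here refl) (there (∈-pow⁺ {G = G} e p))) okG

  -- The letters of a nonempty `Ok` word form a chain and so have a smallest member `G`. The word is
  -- the monomial x_G^(suc e) times a monomial in variables strictly above `G`; all inductions on
  -- words run over this `G`.
  record MinSplit (F : Subset n) (w : Word n) : Set where
    field
      G     : Subset n
      e     : ℕ
      m     : Word n
      perm  : w ↭ pow G (suc e) m
      flatG : IsFlat G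
      F⊂G   : F ⊂ G
      okm   : Ok G m

  minSplit : ∀ {F} L w → Ok F (L ∷ w) → MinSplit F (L ∷ w)
  minSplit L [] ok = record
    { G = L ; e = 0 ; m = [] ; perm = ↭-refl ; flatG = flat ok (here refl) ; F⊂G = above ok (here refl) ; okm = ok-[] }
  minSplit {F} L (L′ ∷ w) ok = go (minSplit L′ w (ok-tail ok))
    where
    go : MinSplit F (L′ ∷ w) → MinSplit F (L ∷ L′ ∷ w)
    go S with chain ok (here refl) (there (↭ₚ.∈-resp-↭ (↭-sym (MinSplit.perm S)) (here refl)))
    ... | inj₁ L⊆G with ⊆⇒≡⊎⊂ L⊆G
    ...   | inj₁ refl = record { G = L ; e = suc e ; m = m ; perm = prep L perm ; flatG = flatG ; F⊂G = F⊂G ; okm = okm }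
      where open MinSplit S
    ...   | inj₂ L⊂G = record
            { G = L ; e = 0 ; m = L′ ∷ w ; perm = ↭-refl ; flatG = flat ok (here refl) ; F⊂G = above ok (here refl)
            ; okm = ok-raise (λ p → L⊂ (∈-pow⁻ (suc e) (↭ₚ.∈-resp-↭ perm p))) (ok-tail ok) }
      where
      open MinSplit S
      L⊂ : ∀ {L″} → L″ ≡ G ⊎ L″ ∈ m → L ⊂ L″
      L⊂ (inj₁ refl) = L⊂G
      L⊂ (inj₂ p)    = ⊂-trans L⊂G (above okm p)
    go S | inj₂ G⊆L with ⊆⇒≡⊎⊂ G⊆L
    ...   | inj₁ refl = record { G = L ; e = suc e ; m = m ; perm = prep L perm ; flatG = flatG ; F⊂G = F⊂G ; okm = okm }
      where open MinSplit S
    ...   | inj₂ G⊂L = record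
            { G = G ; e = e ; m = L ∷ m ; perm = ↭-trans (prep L perm) (pow-∷ G (suc e) L m) ; flatG = flatG ; F⊂G = F⊂G
            ; okm = ok-∷-raise (suc e) (ok-↭ (prep L perm) ok) G⊂L okm }
      where open MinSplit S

  ok-split-at : ∀ {F B w} → Ok F w → (∀ {L} → L ∈ w → B ⊆ L) → Ok B (w without B)
  ok-split-at {F} {B} {w} ok B⊆ = ok-raise strict (ok-⊆ (proj₁ ∘ ∈-w) ok)
    where
    ∈-w : ∀ {L} → L ∈ w without B → L ∈ w × L ≢ B
    ∈-w = ∈-filter⁻ (λ L → ¬? (L ≟ˢ B))
    strict : ∀ {L} → L ∈ w without B → B ⊂ L
    strict L∈ with ⊆⇒≡⊎⊂ (B⊆ (proj₁ (∈-w L∈)))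
    ... | inj₁ refl = contradiction refl (proj₂ (∈-w L∈))
    ... | inj₂ B⊂L  = B⊂L

-- Functionals on D(F), powers of σ, and coefficients.

module Functionals (𝕂 : Scalars) {n : ℕ} (M : MatroidData n) (isM : IsMatroid M) where
  open Scalars 𝕂
  open Flats M
  open MatroidProperties isM
  open Words M
  open FlatSums 𝕂 M public
  open Ok
  open ≡-Reasoning

  Fun : Set
  Fun = Word n → K

  -- multiplication by the linear form Σ x_L over the flats L with p L, acting on functionals
  op : (Subset n → Bool) → Fun → Fun
  op p φ w = ∑ (flats M) (λ L → if p L then φ (L ∷ w) else 𝟘)

  -- On a functional supported strictly above `G` only the flats strictly above `G` contribute, so
  -- there it is multiplication by the sum of the variables larger than x_G.
  s : Fun → Fun
  s = op (λ _ → true)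

  θ : Fin n → Fun → Fun
  θ a = op (a ∈ᵇ_)

  σ : Subset n → Fun → Fun
  σ G = op (G ⊆ᵇ_)

  if-𝟘 : ∀ b {x : K} → x ≡ 𝟘 → (if b then x else 𝟘) ≡ 𝟘
  if-𝟘 true  h = h
  if-𝟘 false h = refl

  if-⊕ : ∀ b (x y : K) → (if b then x ⊕ y else 𝟘) ≡ (if b then x else 𝟘) ⊕ (if b then y else 𝟘)
  if-⊕ true  x y = refl
  if-⊕ false x y = sym (⊕-identityˡ 𝟘)

  if-∑ : ∀ {A : Set} b (xs : List A) f → (if b then ∑ xs f else 𝟘) ≡ ∑ xs (λ x → if b then f x else 𝟘)
  if-∑ true  xs f = refl
  if-∑ false xs f = sym (∑-0 xs)

  op-ext : ∀ p q (φ ψ : Fun) w w′ →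
    (∀ L → IsFlat L → (if p L then φ (L ∷ w) else 𝟘) ≡ (if q L then ψ (L ∷ w′) else 𝟘)) → op p φ w ≡ op q ψ w′
  op-ext p q φ ψ w w′ h = ∑-cong∈ (flats M) (λ L L∈ → h L (∈-flats⁻ L∈))

  op-zero : ∀ p (φ : Fun) w → (∀ L → IsFlat L → p L ≡ true → φ (L ∷ w) ≡ 𝟘) → op p φ w ≡ 𝟘
  op-zero p φ w h = ∑-zero∈ (flats M) (λ L L∈ → go L L∈)
    where
    go : ∀ L → L ∈ flats M → (if p L then φ (L ∷ w) else 𝟘) ≡ 𝟘
    go L L∈ with p L in eq
    ... | true  = h L (∈-flats⁻ L∈) eq
    ... | false = refl

  op-cong : ∀ p {φ ψ : Fun} → φ ≗ ψ → op p φ ≗ op p ψ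
  op-cong p h w = ∑-cong (flats M) (λ L → cong (λ z → if p L then z else 𝟘) (h (L ∷ w)))

  op-𝟘 : ∀ p → op p (λ _ → 𝟘) ≗ (λ _ → 𝟘)
  op-𝟘 p w = op-zero p (λ _ → 𝟘) w (λ _ _ _ → refl)

  op-⊕ : ∀ p (φ ψ : Fun) → op p (λ w → φ w ⊕ ψ w) ≗ (λ w → op p φ w ⊕ op p ψ w)
  op-⊕ p φ ψ w = trans (∑-cong (flats M) (λ L → if-⊕ (p L) _ _)) (∑-+ (flats M) _ _)

  Sym : Fun → Set
  Sym φ = ∀ {w w′} → w ↭ w′ → φ w ≡ φ w′

  Supp : Subset n → Fun → Set
  Supp F φ = ∀ w → ¬ Ok F w → φ w ≡ 𝟘

  op-comm : ∀ p q {φ} → Sym φ → op p (op q φ) ≗ op q (op p φ)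
  op-comm p q {φ} symφ w = begin
    ∑ (flats M) (λ L → if p L then ∑ (flats M) (λ L′ → if q L′ then φ (L′ ∷ L ∷ w) else 𝟘) else 𝟘)
      ≡⟨ ∑-cong (flats M) (λ L → if-∑ (p L) (flats M) _) ⟩
    ∑ (flats M) (λ L → ∑ (flats M) (λ L′ → if p L then (if q L′ then φ (L′ ∷ L ∷ w) else 𝟘) else 𝟘))
      ≡⟨ ∑-swap (flats M) (flats M) _ ⟩
    ∑ (flats M) (λ L′ → ∑ (flats M) (λ L → if p L then (if q L′ then φ (L′ ∷ L ∷ w) else 𝟘) else 𝟘))
      ≡⟨ ∑-cong (flats M) (λ L′ → ∑-cong (flats M) (λ L → trans (if-swap (p L) (q L′))
           (cong (λ z → if q L′ then (if p L then z else 𝟘) else 𝟘) (symφ (swap L′ L ↭-refl))))) ⟩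
    ∑ (flats M) (λ L′ → ∑ (flats M) (λ L → if q L′ then (if p L then φ (L ∷ L′ ∷ w) else 𝟘) else 𝟘))
      ≡⟨ ∑-cong (flats M) (λ L′ → sym (if-∑ (q L′) (flats M) _)) ⟩
    ∑ (flats M) (λ L′ → if q L′ then ∑ (flats M) (λ L → if p L then φ (L ∷ L′ ∷ w) else 𝟘) else 𝟘) ∎

  op-Sym : ∀ p {φ} → Sym φ → Sym (op p φ)
  op-Sym p {φ} symφ w↭w′ = op-ext p p φ φ _ _ (λ L _ → cong (λ z → if p L then z else 𝟘) (symφ (prep L w↭w′)))

  op-Supp : ∀ p {F φ} → Supp F φ → Supp F (op p φ)
  op-Supp p {φ = φ} supp w ¬ok = op-zero p φ w (λ L _ _ → supp (L ∷ w) (¬ok ∘ ok-tail))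

  op^ : ℕ → (Subset n → Bool) → Fun → Fun
  op^ zero    p φ = φ
  op^ (suc d) p φ = op p (op^ d p φ)

  op^-suc : ∀ d p φ → op^ (suc d) p φ ≗ op^ d p (op p φ)
  op^-suc zero    p φ w = refl
  op^-suc (suc d) p φ w = op-cong p (op^-suc d p φ) w

  op^-cong : ∀ d p {φ ψ : Fun} → φ ≗ ψ → op^ d p φ ≗ op^ d p ψ
  op^-cong zero    p h = h
  op^-cong (suc d) p h = op-cong p (op^-cong d p h)

  op^-𝟘 : ∀ d p → op^ d p (λ _ → 𝟘) ≗ (λ _ → 𝟘)
  op^-𝟘 zero    p w = refl
  op^-𝟘 (suc d) p w = trans (op-cong p (op^-𝟘 d p) w) (op-𝟘 p w)

  op^-⊕ : ∀ d p (φ ψ : Fun) → op^ d p (λ w → φ w ⊕ ψ w) ≗ (λ w → op^ d p φ w ⊕ op^ d p ψ w)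
  op^-⊕ zero    p φ ψ w = refl
  op^-⊕ (suc d) p φ ψ w = trans (op-cong p (op^-⊕ d p φ ψ) w) (op-⊕ p (op^ d p φ) (op^ d p ψ) w)

  op^-Sym : ∀ d p {φ} → Sym φ → Sym (op^ d p φ)
  op^-Sym zero    p h = h
  op^-Sym (suc d) p h = op-Sym p (op^-Sym d p h)

  op^-Supp : ∀ d p {F φ} → Supp F φ → Supp F (op^ d p φ)
  op^-Supp zero    p h = h
  op^-Supp (suc d) p h = op-Supp p (op^-Supp d p h)

  op^-comm : ∀ d p q {φ} → Sym φ → op^ d p (op q φ) ≗ op q (op^ d p φ)
  op^-comm zero    p q symφ w = refl
  op^-comm (suc d) p q symφ w = trans (op-cong p (op^-comm d p q symφ) w) (op-comm p q (op^-Sym d p symφ) w)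

  op^-∷ : ∀ d p {φ} → Sym φ → ∀ L w → op^ d p φ (L ∷ w) ≡ op^ d p (λ v → φ (L ∷ v)) w
  op^-∷ zero    p symφ L w = refl
  op^-∷ (suc d) p {φ} symφ L w = op-ext p p (op^ d p φ) (op^ d p (λ v → φ (L ∷ v))) (L ∷ w) w (λ L′ _ → cong (λ z → if p L′ then z else 𝟘)
    (trans (op^-Sym d p symφ (swap L′ L ↭-refl)) (op^-∷ d p symφ L (L′ ∷ w))))

  -- the functionals on the Chow ring of M / F, in the presentation that also has the variable x_E
  record Ann (F : Subset n) (φ : Fun) : Set where
    field
      supp : Supp F φ
      sym↭ : Sym φ
      lin  : ∀ {a} → a ∈ˢ E → a ∉ˢ F → ∀ w → θ a φ w ≡ 𝟘
  open Ann public

  -- unlike Ann, inherited by multiples x_L φ (see ∷-Quasi)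
  record Quasi (F : Subset n) (φ : Fun) : Set where
    field
      sym↭  : Sym φ
      pairs : ∀ L L′ w → ¬ Comparable L L′ → φ (L ∷ L′ ∷ w) ≡ 𝟘
      base  : ∀ L w → ¬ Comparable F L → φ (L ∷ w) ≡ 𝟘
      lin   : ∀ {a} → a ∈ˢ E → a ∉ˢ F → ∀ w → θ a φ w ≡ 𝟘

  Ann⇒Quasi : ∀ {F φ} → Ann F φ → Quasi F φ
  Ann⇒Quasi A = record
    { sym↭ = sym↭ A
    ; pairs = λ L L′ w inc → supp A _ (λ ok → inc (chain ok (here refl) (there (here refl))))
    ; base = λ L w inc → supp A _ (λ ok → inc (inj₁ (p⊂q⇒p⊆q (above ok (here refl)))))
    ; lin = lin A }

  -- With the letter `L` in front, comparability with the new base `L` is comparability of two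
  -- letters; so the new `base` condition comes from the old `pairs`, and no support condition over
  -- `L` is needed to iterate.
  ∷-Quasi : ∀ {F φ L} → F ⊆ L → Quasi F φ → Quasi L (λ w → φ (L ∷ w))
  ∷-Quasi {F} {φ} {L} F⊆L Q = record
    { sym↭ = λ p → Q.sym↭ (prep L p)
    ; pairs = λ L₁ L₂ w inc → trans (Q.sym↭ (↭-trans (swap L L₁ ↭-refl) (prep L₁ (swap L L₂ ↭-refl)))) (Q.pairs L₁ L₂ (L ∷ w) inc)
    ; base = λ L₁ w inc → Q.pairs L L₁ w inc
    ; lin = λ {a} a∈E a∉L w → trans
        (op-ext (a ∈ᵇ_) (a ∈ᵇ_) (λ v → φ (L ∷ v)) φ w (L ∷ w) (λ L₁ _ → cong (λ z → if a ∈ᵇ L₁ then z else 𝟘) (Q.sym↭ (swap L L₁ ↭-refl))))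
        (Q.lin a∈E (a∉L ∘ F⊆L) (L ∷ w)) }
    where module Q = Quasi Q

  -- Pick a ∈ H \ F. As θ a vanishes, σ H may be replaced by the sum of the -x_L with a ∈ L ⊉ H, and
  -- multiplying by x_L passes from F to the larger flat L.
  σ-power-vanishes : ∀ d {F φ H} → IsFlat F → Quasi F φ → H ⊆ E → ¬ H ⊆ F →
    r (F ∪ H) ≤ r F + d → ∀ w → op^ d (H ⊆ᵇ_) φ w ≡ 𝟘
  σ-power-vanishes zero {F} {φ} {H} (F⊆E , strict) Q H⊆E H⊈F r≤ w with ⊈⇒∃∉ H⊈F
  ... | a , a∈H , a∉F = contradiction (ℕₚ.≤-trans (r-mono (∪-lub (p⊆p∪q H) (⁅⁆⊆ (q⊆p∪q F H a∈H))) (∪-lub F⊆E H⊆E))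
          (subst (r (F ∪ H) ≤_) (ℕₚ.+-identityʳ (r F)) r≤)) (ℕₚ.<⇒≱ (strict a (H⊆E a∈H) a∉F))
  σ-power-vanishes (suc d) {F} {φ} {H} flatF@(F⊆E , strict) Q H⊆E H⊈F r≤ w with ⊈⇒∃∉ H⊈F
  ... | a , a∈H , a∉F = begin
    op^ (suc d) p φ w                            ≡⟨ op^-suc d p φ w ⟩
    op^ d p (op p φ) w                           ≡⟨ ⊕-identityʳ _ ⟨
    op^ d p (op p φ) w ⊕ 𝟘                       ≡⟨ cong (op^ d p (op p φ) w ⊕_) rest ⟨
    op^ d p (op p φ) w ⊕ op^ d p (op q φ) w      ≡⟨ op^-⊕ d p (op p φ) (op q φ) w ⟨
    op^ d p (λ v → op p φ v ⊕ op q φ v) w        ≡⟨ op^-cong d p (λ v → trans (sym (split v)) (Q.lin (H⊆E a∈H) a∉F v)) w ⟩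
    op^ d p (λ _ → 𝟘) w                          ≡⟨ op^-𝟘 d p w ⟩
    𝟘 ∎
    where
    module Q = Quasi Q
    p q : Subset n → Bool
    p L = H ⊆ᵇ L
    q L = (a ∈ᵇ L) ∧ not (H ⊆ᵇ L)

    split : ∀ v → θ a φ v ≡ op p φ v ⊕ op q φ v
    split v = trans (∑-cong (flats M) (λ L → term L)) (∑-+ (flats M) _ _)
      where
      term : ∀ L → (if a ∈ᵇ L then φ (L ∷ v) else 𝟘) ≡ (if p L then φ (L ∷ v) else 𝟘) ⊕ (if q L then φ (L ∷ v) else 𝟘)
      term L with a ∈? L | H ⊆? L
      ... | yes _   | yes _   = sym (⊕-identityʳ _)
      ... | yes _   | no _    = sym (⊕-identityˡ _)
      ... | no a∉L  | yes H⊆L = contradiction (H⊆L a∈H) a∉L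
      ... | no _    | no _    = sym (⊕-identityˡ _)

    rest : op^ d p (op q φ) w ≡ 𝟘
    rest = trans (op^-comm d p q Q.sym↭ w) (op-zero q (op^ d p φ) w each)
      where
      each : ∀ L → IsFlat L → q L ≡ true → op^ d p φ (L ∷ w) ≡ 𝟘
      each L flatL@(L⊆E , _) qL with a ∈? L | H ⊆? L | comparable? F L
      ... | yes a∈L | no H⊈L | no inc = trans (op^-∷ d p Q.sym↭ L w)
              (trans (op^-cong d p (λ v → Q.base L v inc) w) (op^-𝟘 d p w))
      ... | yes a∈L | no H⊈L | yes (inj₂ L⊆F) = contradiction (L⊆F a∈L) a∉F
      ... | yes a∈L | no H⊈L | yes (inj₁ F⊆L) = trans (op^-∷ d p Q.sym↭ L w)
              (σ-power-vanishes d flatL (∷-Quasi F⊆L Q) H⊆E H⊈L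
                (r-∪-descend flatF F⊆L L⊆E H⊆E a∈H a∉F a∈L r≤) w)

  open Sequences 𝕂 s (op-cong (λ _ → true)) (op-𝟘 (λ _ → true)) public

  -- the coefficient functional of x_G^e
  part : Subset n → Fun → Seq
  part G φ e m = if does (ok? G m) then φ (pow G e m) else 𝟘

  part-ok : ∀ {G} φ e {m} → Ok G m → part G φ e m ≡ φ (pow G e m)
  part-ok {G} φ e {m} ok rewrite dec-true (ok? G m) ok = refl

  part-¬ok : ∀ {G} φ e {m} → ¬ Ok G m → part G φ e m ≡ 𝟘
  part-¬ok {G} φ e {m} ¬ok rewrite dec-false (ok? G m) ¬ok = refl

  part-Sym : ∀ {G φ} → Sym φ → ∀ e → Sym (part G φ e)
  part-Sym {G} {φ} symφ e {m} {m′} p with ok? G m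
  ... | yes ok = trans (symφ (↭ₚ.++⁺ˡ (replicate e G) p)) (sym (part-ok φ e (ok-↭ p ok)))
  ... | no ¬ok = sym (part-¬ok φ e (¬ok ∘ ok-↭ (↭-sym p)))

  part-Supp : ∀ {G} φ e → Supp G (part G φ e)
  part-Supp φ e m = part-¬ok φ e

  -- σ of `G` is x_G plus the sum of the larger variables. The first summand shifts the exponent of
  -- x_G, the second acts on the coefficients as `s`; together they are `U`.
  U-part : ∀ {F G φ} → Supp F φ → Sym φ → IsFlat G → F ⊂ G → ∀ e → U (part G φ) e ≗ part G (σ G φ) e
  U-part {F} {G} {φ} suppφ symφ flatG F⊂G e m with ok? G m
  ... | no ¬ok = trans (⊕-identityˡ _) (op-zero (λ _ → true) (part G φ e) m (λ L _ _ → part-¬ok φ e (¬ok ∘ ok-tail)))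
  ... | yes okm = begin
    φ (pow G (suc e) m) ⊕ s (part G φ e) m
      ≡⟨ cong₂ _⊕_ (sym (∑-at flatG (λ L → φ (L ∷ pow G e m)))) refl ⟩
    ∑ (flats M) (λ L → if does (L ≟ˢ G) then φ (L ∷ pow G e m) else 𝟘) ⊕ ∑ (flats M) (λ L → part G φ e (L ∷ m))
      ≡⟨ ∑-+ (flats M) _ _ ⟨
    ∑ (flats M) (λ L → (if does (L ≟ˢ G) then φ (L ∷ pow G e m) else 𝟘) ⊕ part G φ e (L ∷ m))
      ≡⟨ ∑-cong∈ (flats M) (λ L L∈ → term L (∈-flats⁻ L∈)) ⟩
    σ G φ (pow G e m) ∎
    where
    term : ∀ L → IsFlat L → (if does (L ≟ˢ G) then φ (L ∷ pow G e m) else 𝟘) ⊕ part G φ e (L ∷ m) ≡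
                            (if G ⊆ᵇ L then φ (L ∷ pow G e m) else 𝟘)
    term L flatL with L ≟ˢ G | G ⊆? L
    ... | yes refl | yes _   = trans (cong (φ (L ∷ pow G e m) ⊕_) (part-¬ok φ e (λ ok → ok-∉ ok (here refl)))) (⊕-identityʳ _)
    ... | yes refl | no G⊈G  = ⊥-elim (G⊈G ⊆-refl)
    ... | no _     | no G⊈L  = trans (⊕-identityˡ _) (part-¬ok φ e (λ ok → G⊈L (p⊂q⇒p⊆q (above ok (here refl)))))
    ... | no L≢G   | yes G⊆L = trans (⊕-identityˡ _) (case ok? G (L ∷ m) of λ
      { (yes ok) → trans (part-ok φ e ok) (symφ (↭-sym (pow-∷ G e L m)))
      ; (no ¬ok) → trans (part-¬ok φ e ¬ok) (sym (suppφ _ (λ okF → ¬ok (ok-∷-raise e okF G⊂L okm)))) })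
      where
      G⊂L : G ⊂ L
      G⊂L with ⊆⇒≡⊎⊂ G⊆L
      ... | inj₁ refl = contradiction refl L≢G
      ... | inj₂ p    = p

  U^-part : ∀ j {F G φ} → Supp F φ → Sym φ → IsFlat G → F ⊂ G →
            ∀ e → U^ j (part G φ) e ≗ part G (op^ j (G ⊆ᵇ_) φ) e
  U^-part zero    suppφ symφ flatG F⊂G e m = refl
  U^-part (suc j) {F} {G} {φ} suppφ symφ flatG F⊂G e m = trans
    (U-cong (U^-part j suppφ symφ flatG F⊂G) e m)
    (U-part (op^-Supp j (G ⊆ᵇ_) suppφ) (op^-Sym j (G ⊆ᵇ_) symφ) flatG F⊂G e m)

  -- A letter `L` containing `a` that stands beside `G` in a chain must lie strictly above `G`, as
  -- `a ∉ G`. The exponent is positive in order that a letter `G` is present.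
  θ-part : ∀ {F G φ} → Supp F φ → Sym φ → IsFlat G → F ⊂ G → ∀ {a} → a ∉ˢ G → ∀ e {m} → Ok G m →
           θ a (part G φ (suc e)) m ≡ θ a φ (pow G (suc e) m)
  θ-part {F} {G} {φ} suppφ symφ flatG F⊂G {a} a∉G e {m} okm = op-ext (a ∈ᵇ_) (a ∈ᵇ_) (part G φ (suc e)) φ m (pow G (suc e) m) term
    where
    term : ∀ L → IsFlat L → (if a ∈ᵇ L then part G φ (suc e) (L ∷ m) else 𝟘) ≡
                            (if a ∈ᵇ L then φ (L ∷ pow G (suc e) m) else 𝟘)
    term L flatL with a ∈? L
    ... | no _    = refl
    ... | yes a∈L with ok? G (L ∷ m)
    ...   | yes ok = symφ (↭-sym (pow-∷ G (suc e) L m))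
    ...   | no ¬ok = sym (suppφ _ (λ okF → ¬ok (ok-∷-raise (suc e) okF (G⊂L (chain okF (there (here refl)) (here refl))) okm)))
      where
      G⊂L : Comparable G L → G ⊂ L
      G⊂L (inj₁ G⊆L) = G⊆L , a , a∈L , a∉G
      G⊂L (inj₂ L⊆G) = contradiction (L⊆G a∈L) a∉G

  part-Ann : ∀ {F G φ} → Ann F φ → IsFlat G → F ⊂ G → ∀ e → Ann G (part G φ (suc e))
  part-Ann {F} {G} {φ} A flatG F⊂G e = record
    { supp = part-Supp φ (suc e)
    ; sym↭ = part-Sym (sym↭ A) (suc e)
    ; lin = λ {a} a∈E a∉G m → case ok? G m of λ
      { (yes ok) → trans (θ-part (supp A) (sym↭ A) flatG F⊂G a∉G e ok) (lin A a∈E (a∉G ∘ p⊂q⇒p⊆q F⊂G) _)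
      ; (no ¬ok) → op-Supp (a ∈ᵇ_) (part-Supp φ (suc e)) m ¬ok } }

  ρ : Subset n → Subset n → ℕ
  ρ F G = r G ∸ r F

  r+ρ : ∀ {F G} → F ⊆ G → G ⊆ E → r F + ρ F G ≡ r G
  r+ρ F⊆G G⊆E = ℕₚ.m+[n∸m]≡n (r-mono F⊆G G⊆E)

  ρ-pos : ∀ {F G} → IsFlat F → F ⊂ G → G ⊆ E → 0 < ρ F G
  ρ-pos flatF F⊂G G⊆E = ℕₚ.m<n⇒0<n∸m (r-strict flatF F⊂G G⊆E)

  Ann-σ-vanishes : ∀ {F G φ} → IsFlat F → Ann F φ → IsFlat G → F ⊂ G → op^ (ρ F G) (G ⊆ᵇ_) φ ≗ (λ _ → 𝟘)
  Ann-σ-vanishes {F} {G} flatF A (G⊆E , _) F⊂G = σ-power-vanishes (ρ F G) flatF (Ann⇒Quasi A) G⊆E (⊂⇒⊉ F⊂G)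
    (ℕₚ.≤-trans (r-mono (∪-lub F⊆G ⊆-refl) G⊆E) (ℕₚ.≤-reflexive (sym (r+ρ F⊆G G⊆E))))
    where
    F⊆G : F ⊆ G
    F⊆G = p⊂q⇒p⊆q F⊂G

  part-𝟘 : ∀ G {φ : Fun} e → φ ≗ (λ _ → 𝟘) → part G φ e ≗ (λ _ → 𝟘)
  part-𝟘 G e h m = if-𝟘 (does (ok? G m)) (h (pow G e m))

  fuel-step : ∀ {t} {F G : Subset n} → n < ∣ F ∣ + suc t → F ⊂ G → n < ∣ G ∣ + t
  fuel-step {t} {F} n< F⊂G = ℕₚ.<-≤-trans n< (ℕₚ.≤-trans (ℕₚ.≤-reflexive (ℕₚ.+-suc ∣ F ∣ t)) (ℕₚ.+-monoˡ-≤ t (p⊂q⇒∣p∣<∣q∣ F⊂G)))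

  no-fuel : ∀ {F : Subset n} {A : Set} → n < ∣ F ∣ + 0 → A
  no-fuel {F} n< = contradiction (∣p∣≤n F) (ℕₚ.<⇒≱ (subst (n <_) (ℕₚ.+-identityʳ _) n<))

  -- Descending induction on the smallest letter `G` of a word. The first ρ coefficients at `G`
  -- vanish by induction and by hypothesis; since the ρ-th power of σ kills `φ`, `U^-unique` extends
  -- this to all exponents. The auxiliary `F′` bounds the letters from below while `φ` stays a
  -- functional over `F`.
  Ann-determined : ∀ {F φ} → IsFlat F → Ann F φ → φ [] ≡ 𝟘 →
    (∀ {G} → IsFlat G → F ⊂ G → ∀ e → suc e < ρ F G → part G φ (suc e) ≗ (λ _ → 𝟘)) → φ ≗ (λ _ → 𝟘)
  Ann-determined {F} {φ} flatF A φ[] parts w with ok? F w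
  ... | no ¬ok = supp A w ¬ok
  ... | yes ok = go (suc n) F ⊆-refl (ℕₚ.m≤n+m (suc n) ∣ F ∣) w ok
    where
    go : ∀ t F′ → F ⊆ F′ → n < ∣ F′ ∣ + t → ∀ w → Ok F′ w → φ w ≡ 𝟘
    go zero F′ _ n< _ _ = no-fuel {F′} n<
    go (suc t) F′ F⊆F′ n< []      ok = φ[]
    go (suc t) F′ F⊆F′ n< (L ∷ w) ok = trans (sym↭ A perm) (trans (sym (part-ok φ (suc e) okm))
      (U^-unique (ρ F G) {part G φ} {λ _ _ → 𝟘}
        (λ e′ m′ → trans (U^-part (ρ F G) (supp A) (sym↭ A) flatG F⊂G′ e′ m′)
          (trans (part-𝟘 G e′ (Ann-σ-vanishes flatF A flatG F⊂G′) m′) (sym (U^-𝟘 (ρ F G) e′ m′))))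
        low (suc e) m))
      where
      open MinSplit (minSplit L w ok)
      F⊂G′ : F ⊂ G
      F⊂G′ = ⊆-⊂-trans F⊆F′ F⊂G
      low : ∀ e → e < ρ F G → part G φ e ≗ (λ _ → 𝟘)
      low (suc e) lt m = parts flatG F⊂G′ e lt m
      -- The coefficient of exponent 0 is `φ` itself on words strictly above `G`, which the
      -- induction covers.
      low zero    lt m with ok? G m
      ... | yes okm = go t G (p⊂q⇒p⊆q F⊂G′) (fuel-step n< F⊂G) m okm
      ... | no _    = refl

-- Existence of functionals with prescribed coefficients.

module Extension (𝕂 : Scalars) {n : ℕ} (M : MatroidData n) (isM : IsMatroid M)
  {F : Subset n} (flatF : Flats.IsFlat M F) (f₀ : Scalars.K 𝕂) (ψ : Subset n → ℕ → Functionals.Fun 𝕂 M isM)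
  (ψ-Ann : ∀ {G} → Flats.IsFlat M G → F ⊂ G → ∀ e → Functionals.Ann 𝕂 M isM G (ψ G e)) where
  open Scalars 𝕂
  open Flats M
  open MatroidProperties isM
  open Words M
  open Functionals 𝕂 M isM
  open Ok
  open ≡-Reasoning

  -- The exponents are shifted: `ψ G e` is prescribed for x_G^(suc e), while the coefficient of
  -- exponent 0 is inherited from the functional `φ` already built on the words above `G`.
  init : Subset n → Fun → Seq
  init G φ zero    = part G φ 0
  init G φ (suc e) = ψ G e

  module _ (G : Subset n) (φ : Fun) where
    open Fill (ρ F G) (init G φ) public

  step : Subset n → Fun → ℕ → Fun
  step G φ zero    w = φ w
  step G φ (suc e) w = fill G φ (suc e) (w without G)

  -- The tail, which holds the larger flats, is built first. Treating `G` changes the values only on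
  -- words that contain the letter `G`.
  build : List (Subset n) → Fun
  build []       []      = f₀
  build []       (_ ∷ _) = 𝟘
  build (G ∷ Us) w       = step G (build Us) (count G w) w

  module _ {G} (flatG : IsFlat G) (F⊂G : F ⊂ G) (φ : Fun) where

    fill-Supp : ∀ e → Supp G (fill G φ e)
    fill-Supp = Closed.fill-closed G φ (Supp G) (λ _ _ → refl) (λ f g w ¬ok → 𝟘⊕𝟘 (f w ¬ok) (g w ¬ok))
      (λ f w ¬ok → trans (cong ⊖_ (f w ¬ok)) ⊖𝟘) (op-Supp (λ _ → true))
      λ { zero → part-Supp φ 0 ; (suc e) → supp (ψ-Ann flatG F⊂G e) }

    fill-Sym : Sym φ → ∀ e → Sym (fill G φ e)
    fill-Sym symφ = Closed.fill-closed G φ Sym (λ _ → refl) (λ f g p → cong₂ _⊕_ (f p) (g p))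
      (λ f p → cong ⊖_ (f p)) (op-Sym (λ _ → true))
      λ { zero → part-Sym symφ 0 ; (suc e) → sym↭ (ψ-Ann flatG F⊂G e) }

  record Good (Us : List (Subset n)) (φ : Fun) : Set where
    field
      suppφ : Supp F φ
      symφ  : Sym φ
      φ[]   : φ [] ≡ f₀
      power : ∀ {G} → G ∈ Us → ∀ e → U^ (ρ F G) (part G φ) e ≗ (λ _ → 𝟘)
      coeff : ∀ {G} → G ∈ Us → ∀ e → suc e < ρ F G → part G φ (suc e) ≗ ψ G e

  build-Good : ∀ {Us} → (∀ {G} → G ∈ Us → IsFlat G × F ⊂ G) → AllPairs (λ G H → ¬ H ⊆ G) Us → Good Us (build Us)
  build-Good {[]} flats sorted = record
    { suppφ = λ { [] ¬ok → contradiction ok-[] ¬ok ; (_ ∷ _) _ → refl }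
    ; symφ = λ p → build[]-sym p
    ; φ[] = refl ; power = λ () ; coeff = λ () }
    where
    build[]-sym : Sym (build [])
    build[]-sym {[]}    {[]}    p = refl
    build[]-sym {[]}    {_ ∷ _} p with ↭ₚ.↭-length p
    ... | ()
    build[]-sym {_ ∷ _} {[]}    p with ↭ₚ.↭-length p
    ... | ()
    build[]-sym {_ ∷ _} {_ ∷ _} p = refl
  build-Good {G ∷ Us} allflat (G⊉ ∷ sorted) = record
    { suppφ = suppφ′ ; symφ = symφ′ ; φ[] = G.φ[] ; power = power′ ; coeff = coeff′ }
    where
    module G = Good (build-Good (allflat ∘ there) sorted)
    φ : Fun
    φ = build Us
    flatG : IsFlat G
    flatG = proj₁ (allflat (here refl))
    F⊂G : F ⊂ G
    F⊂G = proj₂ (allflat (here refl))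

    suppφ′ : Supp F (build (G ∷ Us))
    suppφ′ w ¬ok with count G w | ↭-pow-without G w
    ... | zero  | _ = G.suppφ w ¬ok
    ... | suc e | p = fill-Supp flatG F⊂G φ (suc e) (w without G) (λ ok → ¬ok (ok-↭ (↭-sym p) (ok-pow flatG F⊂G (suc e) ok)))

    step-sym : ∀ e → Sym (step G φ e)
    step-sym zero    = G.symφ
    step-sym (suc e) p = fill-Sym flatG F⊂G φ G.symφ (suc e) (↭ₚ.filter-↭ (λ L → ¬? (L ≟ˢ G)) p)

    symφ′ : Sym (build (G ∷ Us))
    symφ′ {w} {w′} p = trans (cong (λ e → step G φ e w) (count-↭ G p)) (step-sym (count G w′) p)

    new : ∀ e → part G (build (G ∷ Us)) e ≗ fill G φ e
    new e m with ok? G m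
    ... | no ¬ok = sym (fill-Supp flatG F⊂G φ e m ¬ok)
    ... | yes ok = trans (cong (λ c → step G φ c (pow G e m)) (count-pow e (ok-∉ ok))) (go e)
      where
      go : ∀ e → step G φ e (pow G e m) ≡ fill G φ e m
      go (suc e) = cong (fill G φ (suc e)) (without-pow (suc e) (ok-∉ ok))
      -- `fill` reproduces `init` only at exponents below ρ; exponent 0 is among them because
      -- `F ⊂ G` makes ρ positive.
      go zero    = trans (sym (part-ok φ 0 ok)) (sym (fill-init G φ 0 (ρ-pos flatF F⊂G (proj₁ flatG)) m))

    -- The words seen by the coefficients at `H` have all their letters above `H`, and the order of
    -- the list excludes `H ⊆ G`; hence `G` does not occur in them and the new step leaves them
    -- alone.
    old : ∀ {H} → H ∈ Us → ∀ e → part H (build (G ∷ Us)) e ≗ part H φ e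
    old {H} H∈ e m with ok? H m
    ... | no _   = refl
    ... | yes ok = cong (λ c → step G φ c (pow H e m)) (count-∉ {G = G} (λ G∈ → absurd (∈-pow⁻ e G∈)))
      where
      H⊈G : ¬ H ⊆ G
      H⊈G = All.lookup G⊉ H∈
      absurd : ¬ (G ≡ H ⊎ G ∈ m)
      absurd (inj₁ refl) = H⊈G ⊆-refl
      absurd (inj₂ G∈m)  = H⊈G (p⊂q⇒p⊆q (above ok G∈m))

    power′ : ∀ {H} → H ∈ G ∷ Us → ∀ e → U^ (ρ F H) (part H (build (G ∷ Us))) e ≗ (λ _ → 𝟘)
    power′ (here refl) e m = trans (U^-cong (ρ F G) new e m) (fill-U^ G φ e m)
    power′ {H} (there H∈)  e m = trans (U^-cong (ρ F H) (old H∈) e m) (G.power H∈ e m)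

    coeff′ : ∀ {H} → H ∈ G ∷ Us → ∀ e → suc e < ρ F H → part H (build (G ∷ Us)) (suc e) ≗ ψ H e
    coeff′ (here refl) e lt m = trans (new (suc e) m) (fill-init G φ (suc e) lt m)
    coeff′ (there H∈)  e lt m = trans (old H∈ (suc e) m) (G.coeff H∈ e lt m)

  above? : ∀ G → Dec (IsFlat G × F ⊂ G)
  above? G = isFlat? G ×-dec (F ⊂? G)

  upper : List (Subset n)
  upper = filter above? (subsetsUp n)

  φ : Fun
  φ = build upper

  open Good (build-Good {upper} (λ G∈ → proj₂ (∈-filter⁻ above? {xs = subsetsUp n} G∈)) (AllPairsₚ.filter⁺ above? (subsetsUp-sorted n)))

  ∈-upper : ∀ {G} → IsFlat G → F ⊂ G → G ∈ upper
  ∈-upper {G} flatG F⊂G = ∈-filter⁺ above? (∈-subsetsUp G) (flatG , F⊂G)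

  -- A word with all letters above `G` is a power of x_G times a word strictly above `G`, so its
  -- value is an entry of the coefficient sequence at `G`, where `U^ (ρ F G)` gives zero.
  σ-power : ∀ {G} → IsFlat G → F ⊂ G → ∀ w → (∀ {L} → L ∈ w → G ⊆ L) → op^ (ρ F G) (G ⊆ᵇ_) φ w ≡ 𝟘
  σ-power {G} flatG F⊂G w G⊆ with ok? F w
  ... | no ¬ok = op^-Supp (ρ F G) (G ⊆ᵇ_) suppφ w ¬ok
  ... | yes ok = begin
    op^ (ρ F G) (G ⊆ᵇ_) φ w
      ≡⟨ op^-Sym (ρ F G) (G ⊆ᵇ_) symφ (↭-pow-without G w) ⟩
    op^ (ρ F G) (G ⊆ᵇ_) φ (pow G (count G w) (w without G))
      ≡⟨ part-ok (op^ (ρ F G) (G ⊆ᵇ_) φ) (count G w) (ok-split-at ok G⊆) ⟨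
    part G (op^ (ρ F G) (G ⊆ᵇ_) φ) (count G w) (w without G)
      ≡⟨ U^-part (ρ F G) suppφ symφ flatG F⊂G (count G w) (w without G) ⟨
    U^ (ρ F G) (part G φ) (count G w) (w without G)
      ≡⟨ power (∈-upper flatG F⊂G) (count G w) (w without G) ⟩
    𝟘 ∎

  module Linear {a} (a∈E : a ∈ˢ E) (a∉F : a ∉ˢ F) where

    -- Let `A` be the flat covering `F` through `a`. Within the support, the letters containing `a`
    -- are those above `A`, so `θ a` is σ of `A`; as `ρ F A` is 1, the first power already vanishes.
    θ-all-above : ∀ w → (∀ {L} → L ∈ w → IsFlat L × F ⊂ L × a ∈ˢ L) → θ a φ w ≡ 𝟘
    θ-all-above w a∈ with cover flatF a∈E a∉F
    ... | A , flatA , F⊂A , a∈A , rA , least = begin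
      θ a φ w ≡⟨ op-ext (a ∈ᵇ_) (A ⊆ᵇ_) φ φ w w term ⟩
      op^ 1 (A ⊆ᵇ_) φ w ≡⟨ cong (λ d → op^ d (A ⊆ᵇ_) φ w) ρ≡1 ⟨
      op^ (ρ F A) (A ⊆ᵇ_) φ w ≡⟨ σ-power flatA F⊂A w (λ L∈ → let flatL , F⊂L , a∈L = a∈ L∈ in least flatL (p⊂q⇒p⊆q F⊂L) a∈L) ⟩
      𝟘 ∎
      where
      ρ≡1 : ρ F A ≡ 1
      ρ≡1 = trans (cong (_∸ r F) rA) (ℕₚ.m+n∸n≡m 1 (r F))
      term : ∀ L → IsFlat L → (if a ∈ᵇ L then φ (L ∷ w) else 𝟘) ≡ (if A ⊆ᵇ L then φ (L ∷ w) else 𝟘)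
      term L flatL with a ∈? L | A ⊆? L
      ... | yes _   | yes _   = refl
      ... | no _    | no _    = refl
      ... | no a∉L  | yes A⊆L = contradiction (A⊆L a∈A) a∉L
      ... | yes a∈L | no A⊈L  = suppφ (L ∷ w) (λ ok → A⊈L (least flatL (p⊂q⇒p⊆q (above ok (here refl))) a∈L))

    -- Ξ is compared with the sequence Ξ₀, 0, 0, …: both are killed by U^ (ρ F G).
    module AtFlat {G} (flatG : IsFlat G) (F⊂G : F ⊂ G) (a∉G : a ∉ˢ G)
      (IH : ∀ w → Ok G w → θ a φ w ≡ 𝟘) where

      Ξ : Seq
      Ξ e = θ a (part G φ e)

      d : ℕ
      d = ρ F G

      -- `θ a` commutes with `s` on symmetric functionals, hence with `U^ d`, which kills the
      -- coefficients at `G`.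
      U^-Ξ : ∀ e → U^ d Ξ e ≗ (λ _ → 𝟘)
      U^-Ξ e m = trans (U^-commute d {part G φ} (λ e → part-Sym symφ e) e m)
        (trans (op-cong (a ∈ᵇ_) (power (∈-upper flatG F⊂G) e) m) (op-𝟘 (a ∈ᵇ_) m))
        where open Commuting (θ a) Sym (op-cong (a ∈ᵇ_)) (op-⊕ (a ∈ᵇ_)) (λ f g p → cong₂ _⊕_ (f p) (g p))
                     (op-Sym (λ _ → true)) (op-comm (λ _ → true) (a ∈ᵇ_))

      Ξ-low : ∀ e → suc e < d → Ξ (suc e) ≗ (λ _ → 𝟘)
      Ξ-low e lt m = trans (op-cong (a ∈ᵇ_) (coeff (∈-upper flatG F⊂G) e lt) m) (lin (ψ-Ann flatG F⊂G e) a∈E a∉G m)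

      module AtCover {B} (flatB : IsFlat B) (G⊂B : G ⊂ B) (a∈B : a ∈ˢ B) (rB : r B ≡ suc (r G))
        (least : ∀ {L} → IsFlat L → G ⊆ L → a ∈ˢ L → B ⊆ L) where

        F⊂B : F ⊂ B
        F⊂B = ⊂-trans F⊂G G⊂B

        allB? : ∀ w → Dec (All (λ L → B ⊆ L) w)
        allB? = All.all? (B ⊆?_)

        guardB : Fun → Fun
        guardB χ w = if does (allB? w) then χ w else 𝟘

        -- On words with all letters above `B`, a letter above `G` containing `a` is the same as a
        -- letter above `B`. On the other words over `G`, cutting down to letters above `G` loses
        -- nothing: some letter of the word misses `a`, and a letter containing `a` comparable with
        -- it lies above it. There `IH` gives zero.
        Ξ₀≡ : Ξ 0 ≗ guardB (σ B φ)
        Ξ₀≡ w with ok? G w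
        ... | no ¬ok = trans (op-Supp (a ∈ᵇ_) (part-Supp φ 0) w ¬ok) (sym rhs)
          where
          rhs : guardB (σ B φ) w ≡ 𝟘
          rhs with allB? w
          ... | no _   = refl
          ... | yes B⊆ = op-Supp (B ⊆ᵇ_) suppφ w (λ ok → ¬ok (ok-raise (λ L∈ → ⊂-⊆-trans G⊂B (All.lookup B⊆ L∈)) ok))
        ... | yes ok with allB? w
        ...   | yes B⊆ = op-ext (a ∈ᵇ_) (B ⊆ᵇ_) (part G φ 0) φ w w term
          where
          term : ∀ L → IsFlat L → (if a ∈ᵇ L then part G φ 0 (L ∷ w) else 𝟘) ≡ (if B ⊆ᵇ L then φ (L ∷ w) else 𝟘)
          term L flatL with a ∈? L | B ⊆? L
          ... | no _    | no _    = refl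
          ... | no a∉L  | yes B⊆L = contradiction (B⊆L a∈B) a∉L
          ... | yes a∈L | no B⊈L  = part-¬ok φ 0 (λ okL → B⊈L (least flatL (p⊂q⇒p⊆q (above okL (here refl))) a∈L))
          ... | yes a∈L | yes B⊆L with ok? G (L ∷ w)
          ...   | yes _   = refl
          ...   | no ¬okL = sym (suppφ (L ∷ w) (λ okF → ¬okL (ok-∷-raise 0 okF (⊂-⊆-trans G⊂B B⊆L) ok)))
        ...   | no ¬B⊆ = trans (op-ext (a ∈ᵇ_) (a ∈ᵇ_) (part G φ 0) φ w w term) (IH w ok)
          where
          term : ∀ L → IsFlat L → (if a ∈ᵇ L then part G φ 0 (L ∷ w) else 𝟘) ≡ (if a ∈ᵇ L then φ (L ∷ w) else 𝟘)
          term L flatL with a ∈? L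
          ... | no _    = refl
          ... | yes a∈L with ok? G (L ∷ w)
          ...   | yes _   = refl
          ...   | no ¬okL = sym (suppφ (L ∷ w) (λ okF → ¬B⊆ (All.tabulate λ {L′} L′∈ →
                    decidable-stable (B ⊆? L′) (λ B⊈L′ → ¬okL (ok-∷-raise 0 okF (G⊂L okF L′∈ B⊈L′) ok)))))
            where
            G⊂L : Ok F (L ∷ w) → ∀ {L′} → L′ ∈ w → ¬ B ⊆ L′ → G ⊂ L
            G⊂L okF {L′} L′∈ B⊈L′ with chain okF (here refl) (there L′∈)
            ... | inj₁ L⊆L′ = ⊥-elim (B⊈L′ (least (flat ok L′∈) (p⊂q⇒p⊆q (above ok L′∈)) (L⊆L′ a∈L)))
            ... | inj₂ L′⊆L = ⊂-⊆-trans (above ok L′∈) L′⊆L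

        guardB-yes : ∀ χ {w} → All (λ L → B ⊆ L) w → guardB χ w ≡ χ w
        guardB-yes χ {w} B⊆ rewrite dec-true (allB? w) B⊆ = refl

        guardB-no : ∀ χ {w} → ¬ All (λ L → B ⊆ L) w → guardB χ w ≡ 𝟘
        guardB-no χ {w} ¬B⊆ rewrite dec-false (allB? w) ¬B⊆ = refl

        s-guardB : ∀ χ → s (guardB χ) ≗ guardB (σ B χ)
        s-guardB χ w = case allB? w of λ
          { (no ¬B⊆) → trans (op-zero (λ _ → true) (guardB χ) w (λ L _ _ → guardB-no χ (λ { (_ ∷ B⊆) → ¬B⊆ B⊆ })))
                             (sym (guardB-no (σ B χ) ¬B⊆))
          ; (yes B⊆) → trans (op-ext (λ _ → true) (B ⊆ᵇ_) (guardB χ) χ w w (λ L _ → term B⊆ L))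
                             (sym (guardB-yes (σ B χ) B⊆)) }
          where
          term : All (λ L → B ⊆ L) w → ∀ L → guardB χ (L ∷ w) ≡ (if B ⊆ᵇ L then χ (L ∷ w) else 𝟘)
          term B⊆ L = case B ⊆? L of λ
            { (yes B⊆L) → trans (guardB-yes χ (B⊆L ∷ B⊆)) (cong (λ b → if b then χ (L ∷ w) else 𝟘) (sym (dec-true (B ⊆? L) B⊆L)))
            ; (no B⊈L) → trans (guardB-no χ (λ { (B⊆L ∷ _) → B⊈L B⊆L }))
                               (cong (λ b → if b then χ (L ∷ w) else 𝟘) (sym (dec-false (B ⊆? L) B⊈L))) }

        s^-Ξ₀ : ∀ j → s^ j (Ξ 0) ≗ guardB (op^ (suc j) (B ⊆ᵇ_) φ)
        s^-Ξ₀ zero    = Ξ₀≡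
        s^-Ξ₀ (suc j) w = trans (op-cong (λ _ → true) (s^-Ξ₀ j) w) (s-guardB (op^ (suc j) (B ⊆ᵇ_) φ) w)

        -- `B` covers `G`, so its relative rank is one more than `d`. That is the power of σ of `B`
        -- reached after `d` applications of `s` to `Ξ 0`, which already contains one factor.
        suc-d : suc d ≡ ρ F B
        suc-d = trans (sym (ℕₚ.+-∸-assoc 1 (r-mono (p⊂q⇒p⊆q F⊂G) (proj₁ flatG)))) (cong (_∸ r F) (sym rB))

        s^d-Ξ₀ : s^ d (Ξ 0) ≗ (λ _ → 𝟘)
        s^d-Ξ₀ w = trans (s^-Ξ₀ d w) rest
          where
          rest : guardB (op^ (suc d) (B ⊆ᵇ_) φ) w ≡ 𝟘
          rest with allB? w
          ... | no _   = refl
          ... | yes B⊆ = trans (cong (λ j → op^ j (B ⊆ᵇ_) φ w) suc-d) (σ-power flatB F⊂B w (λ L∈ → All.lookup B⊆ L∈))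

        Ξ≡single : ∀ e → Ξ e ≗ single (Ξ 0) e
        Ξ≡single = U^-unique d {Ξ} {single (Ξ 0)}
          (λ e m → trans (U^-Ξ e m) (sym (trans (U^-single d (Ξ 0) e m) (single-𝟘 e m))))
          λ { zero _ m → refl ; (suc e) lt m → Ξ-low e lt m }
          where
          single-𝟘 : ∀ e → single (s^ d (Ξ 0)) e ≗ (λ _ → 𝟘)
          single-𝟘 zero    m = s^d-Ξ₀ m
          single-𝟘 (suc e) m = refl

      Ξ-suc : ∀ e → Ξ (suc e) ≗ (λ _ → 𝟘)
      Ξ-suc e m with cover flatG a∈E a∉G
      ... | B , flatB , G⊂B , a∈B , rB , least = AtCover.Ξ≡single flatB G⊂B a∈B rB least (suc e) m

    -- If the smallest letter contains `a`, so do all letters. Otherwise the value is an entry of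
    -- `Ξ` at a positive exponent; its vanishing uses the claim for words strictly above that
    -- letter.
    θ-zero : ∀ t G → F ⊆ G → n < ∣ G ∣ + t → ∀ w → Ok G w → θ a φ w ≡ 𝟘
    θ-zero zero G _ n< _ _ = no-fuel {G} n<
    θ-zero (suc t) G′ F⊆G′ n< []      ok = θ-all-above [] (λ ())
    θ-zero (suc t) G′ F⊆G′ n< (L ∷ w) ok with a ∈? MinSplit.G (minSplit L w ok)
    ... | no a∉G = begin
      θ a φ (L ∷ w)            ≡⟨ op-Sym (a ∈ᵇ_) symφ perm ⟩
      θ a φ (pow G (suc e) m)  ≡⟨ θ-part suppφ symφ flatG F⊂G₀ a∉G e okm ⟨
      θ a (part G φ (suc e)) m ≡⟨ AtFlat.Ξ-suc flatG F⊂G₀ a∉G (θ-zero t G (p⊂q⇒p⊆q F⊂G₀) (fuel-step n< F⊂G)) e m ⟩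
      𝟘 ∎
      where
      open MinSplit (minSplit L w ok)
      F⊂G₀ : F ⊂ G
      F⊂G₀ = ⊆-⊂-trans F⊆G′ F⊂G
    ... | yes a∈G = θ-all-above (L ∷ w) (λ {L′} L′∈ → flat ok L′∈ , ⊆-⊂-trans F⊆G′ (above ok L′∈) , contains (∈-pow⁻ (suc e) (↭ₚ.∈-resp-↭ perm L′∈)))
      where
      open MinSplit (minSplit L w ok)
      contains : ∀ {L′} → L′ ≡ G ⊎ L′ ∈ m → a ∈ˢ L′
      contains (inj₁ refl) = a∈G
      contains (inj₂ L′∈m) = p⊂q⇒p⊆q (above okm L′∈m) a∈G

  extension-Ann : Ann F φ
  extension-Ann = record
    { supp = suppφ ; sym↭ = symφ
    ; lin = λ {a} a∈E a∉F w → case ok? F w of λ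
      { (yes ok) → Linear.θ-zero a∈E a∉F (suc n) F ⊆-refl (ℕₚ.m≤n+m (suc n) ∣ F ∣) w ok
      ; (no ¬ok) → op-Supp (a ∈ᵇ_) suppφ w ¬ok } }

  extension-[] : φ [] ≡ f₀
  extension-[] = φ[]

  extension-part : ∀ {G} → IsFlat G → F ⊂ G → ∀ e → suc e < ρ F G → part G φ (suc e) ≗ ψ G e
  extension-part flatG F⊂G = coeff (∈-upper flatG F⊂G)

-- Normal words: chains of flats with bounded exponents.

module NormalWords {n : ℕ} (M : MatroidData n) where
  open Flats M
  open Words M

  flatsAbove : Subset n → List (Subset n)
  flatsAbove F = filter (F ⊂?_) (flats M)

  ∈-flatsAbove⁻ : ∀ {F G} → G ∈ flatsAbove F → IsFlat G × F ⊂ G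
  ∈-flatsAbove⁻ {F} G∈ = let p , q = ∈-filter⁻ (F ⊂?_) {xs = flats M} G∈ in ∈-flats⁻ p , q

  ∈-flatsAbove⁺ : ∀ {F G} → IsFlat G → F ⊂ G → G ∈ flatsAbove F
  ∈-flatsAbove⁺ {F} flatG F⊂G = ∈-filter⁺ (F ⊂?_) (∈-flats⁺ flatG) F⊂G

  -- Words of length k of the form G₁^e₁ G₂^e₂ … with F ⊂ G₁ ⊂ G₂ ⊂ … and 1 ≤ eᵢ < rk Gᵢ - rk Gᵢ₋₁. The first
  -- argument is fuel (at least k); the exponent in a block is suc e.
  normalWords : ℕ → Subset n → ℕ → List (Word n)
  block : ℕ → ℕ → Subset n → ℕ → List (Word n)

  normalWords t       F zero    = [] ∷ []
  normalWords zero    F (suc k) = []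
  normalWords (suc t) F (suc k) =
    concatMap (λ G → concatMap (block t k G) (downFrom (r G ∸ r F ∸ 1))) (flatsAbove F)

  block t k G e = if e ≤ᵇ k then map (pow G (suc e)) (normalWords t G (k ∸ e)) else []

  ∈-block⁻ : ∀ {t k G w} e → w ∈ block t k G e → e ≤ k × ∃ λ w′ → w′ ∈ normalWords t G (k ∸ e) × w ≡ pow G (suc e) w′
  ∈-block⁻ {k = k} {G} e w∈ with e ≤ᵇ k in eq
  ... | true = ℕₚ.≤ᵇ⇒≤ e k (subst T (sym eq) _) , ∈-map⁻ (pow G (suc e)) w∈

  ∈-block⁺ : ∀ {t k G w} e → e ≤ k → w ∈ normalWords t G (k ∸ e) → pow G (suc e) w ∈ block t k G e
  ∈-block⁺ {k = k} {G} e e≤k w∈ with e ≤ᵇ k | ℕₚ.≤⇒≤ᵇ e≤k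
  ... | true | _ = ∈-map⁺ (pow G (suc e)) w∈

  record Head (t : ℕ) (F : Subset n) (k : ℕ) (w : Word n) : Set where
    field
      G     : Subset n
      flatG : IsFlat G
      F⊂G   : F ⊂ G
      e     : ℕ
      e<    : suc e < r G ∸ r F
      e≤k   : e ≤ k
      w′    : Word n
      w′∈   : w′ ∈ normalWords t G (k ∸ e)
      w≡    : w ≡ pow G (suc e) w′

  ∈-normalWords⁻ : ∀ {t F k w} → w ∈ normalWords (suc t) F (suc k) → Head t F k w
  ∈-normalWords⁻ {t} {F} {k} w∈ with find (∈-concatMap⁻ _ {xs = flatsAbove F} w∈)
  ... | G , G∈ , w∈G with find (∈-concatMap⁻ (block t k G) {xs = downFrom (r G ∸ r F ∸ 1)} w∈G)
  ... | e , e∈ , w∈e with ∈-flatsAbove⁻ {F} G∈ | ∈-block⁻ {t} {k} {G} e w∈e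
  ... | flatG , F⊂G | e≤k , w′ , w′∈ , w≡ = record
    { G = G ; flatG = flatG ; F⊂G = F⊂G ; e = e ; e< = bound (r G ∸ r F) (∈-downFrom⁻ e∈) ; e≤k = e≤k
    ; w′ = w′ ; w′∈ = w′∈ ; w≡ = w≡ }
    where
    bound : ∀ d → e < d ∸ 1 → suc e < d
    bound (suc d) lt = s≤s lt

  ∈-normalWords⁺ : ∀ {t F k G w} → IsFlat G → F ⊂ G → ∀ e → suc e < r G ∸ r F → e ≤ k →
    w ∈ normalWords t G (k ∸ e) → pow G (suc e) w ∈ normalWords (suc t) F (suc k)
  ∈-normalWords⁺ {t} {F} {k} {G} flatG F⊂G e e< e≤k w∈ =
    ∈-concatMap⁺ (λ G → concatMap (block t k G) (downFrom (r G ∸ r F ∸ 1))) {xs = flatsAbove F}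
      (lose (∈-flatsAbove⁺ flatG F⊂G)
        (∈-concatMap⁺ (block t k G) (lose (∈-downFrom⁺ (ℕₚ.∸-monoˡ-≤ 1 e<)) (∈-block⁺ e e≤k w∈))))

  normalWords-ok : ∀ t F k {w} → w ∈ normalWords t F k → Ok F w
  normalWords-ok t       F zero    (here refl) = ok-[]
  normalWords-ok (suc t) F (suc k) {w} w∈ = subst (Ok F) (sym w≡) (ok-pow flatG F⊂G (suc e) (normalWords-ok t G (k ∸ e) w′∈))
    where open Head (∈-normalWords⁻ {t} {F} {k} w∈)

  normalWords-fuel : ∀ t t′ F k → k ≤ t → k ≤ t′ → normalWords t F k ≡ normalWords t′ F k
  normalWords-fuel t       t′       F zero    _ _ = refl
  normalWords-fuel (suc t) (suc t′) F (suc k) (s≤s k≤t) (s≤s k≤t′) =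
    Listₚ.concatMap-cong (λ G → Listₚ.concatMap-cong (λ e → cong (λ l → if e ≤ᵇ k then map (pow G (suc e)) l else [])
      (normalWords-fuel t t′ G (k ∸ e) (ℕₚ.≤-trans (ℕₚ.m∸n≤m k e) k≤t) (ℕₚ.≤-trans (ℕₚ.m∸n≤m k e) k≤t′)))
      (downFrom (r G ∸ r F ∸ 1))) (flatsAbove F)

  -- The first letter of a word recovers the flat of its first block, and the multiplicity of that
  -- letter recovers the exponent, since the rest lies strictly above it.
  normalWords-unique : ∀ t F k → Unique (normalWords t F k)
  normalWords-unique t       F zero    = [] ∷ []
  normalWords-unique zero    F (suc k) = []
  normalWords-unique (suc t) F (suc k) = concatMap-allPairs _
    (AllPairs.map (λ {G} {G′} ne v w p q eq → ne (letter G G′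
        (find (∈-concatMap⁻ (block t k G) {xs = downFrom (r G ∸ r F ∸ 1)} p))
        (find (∈-concatMap⁻ (block t k G′) {xs = downFrom (r G′ ∸ r F ∸ 1)}
          (subst (_∈ concatMap (block t k G′) (downFrom (r G′ ∸ r F ∸ 1))) (sym eq) q)))))
      (Uniqueₚ.filter⁺ (F ⊂?_) (flats-unique M)))
    (λ G → concatMap-allPairs (block t k G)
      (AllPairs.map (λ {e} {e′} ne v w p q eq → ne (exponent (∈-block⁻ e p) (∈-block⁻ e′ (subst (_∈ block t k G e′) (sym eq) q))))
        (Uniqueₚ.downFrom⁺ (r G ∸ r F ∸ 1)))
      (block-unique G))
    where
    block-unique : ∀ G e → Unique (block t k G e)
    block-unique G e with e ≤ᵇ k
    ... | true  = Uniqueₚ.map⁺ (λ {w} {w′} → Listₚ.++-cancelˡ (replicate (suc e) G) w w′) (normalWords-unique t G (k ∸ e))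
    ... | false = []

    exponent : ∀ {G e e′ v} → e ≤ k × (∃ λ w → w ∈ normalWords t G (k ∸ e) × v ≡ pow G (suc e) w) →
               e′ ≤ k × (∃ λ w → w ∈ normalWords t G (k ∸ e′) × v ≡ pow G (suc e′) w) → e ≡ e′
    exponent {G} {e} {e′} (_ , w , w∈ , refl) (_ , w′ , w′∈ , eq) = ℕₚ.suc-injective
      (trans (sym (count-pow (suc e) (ok-∉ (normalWords-ok t G (k ∸ e) w∈))))
        (trans (cong (count G) eq) (count-pow (suc e′) (ok-∉ (normalWords-ok t G (k ∸ e′) w′∈)))))

    letter : ∀ G G′ {v} {es es′ : List ℕ} → (∃ λ e → e ∈ es × v ∈ block t k G e) → (∃ λ e → e ∈ es′ × v ∈ block t k G′ e) → G ≡ G′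
    letter G G′ (e , _ , p) (e′ , _ , q) with ∈-block⁻ {t} {k} {G} e p | ∈-block⁻ {t} {k} {G′} e′ q
    ... | _ , _ , _ , refl | _ , _ , _ , eq = Listₚ.∷-injectiveˡ eq

  normalCount : Subset n → ℕ → ℕ
  normalCount F k = length (normalWords k F k)

-- Functionals are determined by their values on normal words, which are arbitrary.

module AnnBasis (𝕂 : Scalars) {n : ℕ} (M : MatroidData n) (isM : IsMatroid M) where
  open Scalars 𝕂
  open Flats M
  open MatroidProperties isM
  open Words M
  open NormalWords M
  open Functionals 𝕂 M isM
  open ≡-Reasoning

  Ann-𝟘 : ∀ {F} → Ann F (λ _ → 𝟘)
  Ann-𝟘 = record { supp = λ _ _ → refl ; sym↭ = λ _ → refl ; lin = λ {a} _ _ w → op-𝟘 (a ∈ᵇ_) w }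

  Ann-⊕ : ∀ {F φ ψ} → Ann F φ → Ann F ψ → Ann F (λ w → φ w ⊕ ψ w)
  Ann-⊕ {φ = φ} {ψ} A B = record
    { supp = λ w ¬ok → 𝟘⊕𝟘 (supp A w ¬ok) (supp B w ¬ok)
    ; sym↭ = λ p → cong₂ _⊕_ (sym↭ A p) (sym↭ B p)
    ; lin = λ {a} a∈E a∉F w → trans (op-⊕ (a ∈ᵇ_) φ ψ w) (𝟘⊕𝟘 (lin A a∈E a∉F w) (lin B a∈E a∉F w)) }

  ⊗-𝟘 : ∀ c → c ⊗ 𝟘 ≡ 𝟘
  ⊗-𝟘 = IsCommutativeRing.zeroʳ isCommutativeRing

  op-⊗ : ∀ p c (φ : Fun) → op p (λ w → c ⊗ φ w) ≗ (λ w → c ⊗ op p φ w)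
  op-⊗ p c φ w = trans (∑-cong (flats M) (λ L → if-⊗ (p L) (φ (L ∷ w)))) (∑-*ˡ (flats M) c _)
    where
    if-⊗ : ∀ b x → (if b then c ⊗ x else 𝟘) ≡ c ⊗ (if b then x else 𝟘)
    if-⊗ true  x = refl
    if-⊗ false x = sym (⊗-𝟘 c)

  Ann-⊗ : ∀ {F φ} c → Ann F φ → Ann F (λ w → c ⊗ φ w)
  Ann-⊗ {φ = φ} c A = record
    { supp = λ w ¬ok → trans (cong (c ⊗_) (supp A w ¬ok)) (⊗-𝟘 c)
    ; sym↭ = λ p → cong (c ⊗_) (sym↭ A p)
    ; lin = λ {a} a∈E a∉F w → trans (op-⊗ (a ∈ᵇ_) c φ w) (trans (cong (c ⊗_) (lin A a∈E a∉F w)) (⊗-𝟘 c)) }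

  Ann-∑ : ∀ {F} {A : Set} (xs : List A) (c : A → K) {φ : A → Fun} → (∀ x → Ann F (φ x)) →
          Ann F (λ w → ∑ xs (λ x → c x ⊗ φ x w))
  Ann-∑ []       c h = Ann-𝟘
  Ann-∑ (x ∷ xs) c h = Ann-⊕ (Ann-⊗ (c x) (h x)) (Ann-∑ xs c h)

  trunc : ℕ → Fun → Fun
  trunc k φ w = if does (length w ℕₚ.≟ k) then φ w else 𝟘

  trunc-≡ : ∀ {k} φ {w} → length w ≡ k → trunc k φ w ≡ φ w
  trunc-≡ {k} φ {w} eq rewrite dec-true (length w ℕₚ.≟ k) eq = refl

  trunc-≢ : ∀ {k} φ {w} → length w ≢ k → trunc k φ w ≡ 𝟘
  trunc-≢ {k} φ {w} ne rewrite dec-false (length w ℕₚ.≟ k) ne = refl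

  -- The relations are homogeneous, so the component of degree `k` of a functional satisfies them as
  -- well.
  trunc-Ann : ∀ {F φ} k → Ann F φ → Ann F (trunc k φ)
  trunc-Ann {F} {φ} k A = record
    { supp = λ w ¬ok → if-𝟘 (does (length w ℕₚ.≟ k)) (supp A w ¬ok)
    ; sym↭ = λ {w} {w′} p → cong₂ (λ l z → if does (l ℕₚ.≟ k) then z else 𝟘) (↭ₚ.↭-length p) (sym↭ A p)
    ; lin = λ {a} a∈E a∉F w → lin′ a∈E a∉F w }
    where
    lin′ : ∀ {a} → a ∈ˢ E → a ∉ˢ F → ∀ w → θ a (trunc k φ) w ≡ 𝟘
    lin′ {a} a∈E a∉F w = case suc (length w) ℕₚ.≟ k of λ
      { (yes eq) → trans (op-ext (a ∈ᵇ_) (a ∈ᵇ_) (trunc k φ) φ w w (λ L _ → cong (λ z → if a ∈ᵇ L then z else 𝟘) (trunc-≡ φ eq)))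
                         (lin A a∈E a∉F w)
      ; (no ne) → op-zero (a ∈ᵇ_) (trunc k φ) w (λ L _ _ → trunc-≢ φ ne) }

  -- `Ann-determined` is applied to the component of degree `suc k`. Its value at the empty word is
  -- zero by degree, and its coefficient of x_G^(suc e) lives in degree `k ∸ e`, where the induction
  -- applies.
  normalWords-determine : ∀ t k → k ≤ t → ∀ {F φ} → IsFlat F → Ann F φ →
    (∀ w → w ∈ normalWords t F k → φ w ≡ 𝟘) → ∀ w → length w ≡ k → φ w ≡ 𝟘
  normalWords-determine t       zero    _ flatF A vanish [] _ = vanish [] (here refl)
  normalWords-determine (suc t) (suc k) (s≤s k≤t) {F} {φ} flatF A vanish w len =
    trans (sym (trunc-≡ φ len)) (Ann-determined flatF (trunc-Ann (suc k) A) refl parts w)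
    where
    parts : ∀ {G} → IsFlat G → F ⊂ G → ∀ e → suc e < ρ F G → part G (trunc (suc k) φ) (suc e) ≗ (λ _ → 𝟘)
    parts {G} flatG F⊂G e lt m with ok? G m
    ... | no _   = refl
    ... | yes ok with length (pow G (suc e) m) ℕₚ.≟ suc k
    ...   | no ne  = trunc-≢ φ ne
    ...   | yes eq = trans (trunc-≡ φ eq) (trans (sym (part-ok φ (suc e) ok))
              (normalWords-determine t (k ∸ e) (ℕₚ.≤-trans (ℕₚ.m∸n≤m k e) k≤t) flatG (part-Ann A flatG F⊂G e) vanish′ m
                (trans (sym (ℕₚ.m+n∸m≡n e (length m))) (cong (_∸ e) e+m≡k))))
      where
      e+m≡k : e + length m ≡ k
      e+m≡k = trans (sym (trans (Listₚ.length-++ (replicate e G)) (cong (_+ length m) (Listₚ.length-replicate e)))) (ℕₚ.suc-injective eq)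
      e≤k : e ≤ k
      e≤k = subst (e ≤_) e+m≡k (ℕₚ.m≤m+n e (length m))
      vanish′ : ∀ v → v ∈ normalWords t G (k ∸ e) → part G φ (suc e) v ≡ 𝟘
      vanish′ v v∈ = if-𝟘 (does (ok? G v)) (vanish _ (∈-normalWords⁺ flatG F⊂G e lt e≤k v∈))

  -- By induction each coefficient of x_G^(suc e) can be chosen as a functional over `G` with the
  -- wanted values on the normal words of the remaining degree; `Extension` assembles these choices.
  normalWords-free : ∀ t k → k ≤ t → ∀ {F} → IsFlat F → (f : Fun) →
    ∃ λ φ → Ann F φ × (∀ w → w ∈ normalWords t F k → φ w ≡ f w)
  normalWords-free t zero _ flatF f = X.φ , X.extension-Ann , λ { _ (here refl) → X.extension-[] }
    where module X = Extension 𝕂 M isM flatF (f []) (λ _ _ _ → 𝟘) (λ _ _ _ → Ann-𝟘)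
  normalWords-free (suc t) (suc k) (s≤s k≤t) {F} flatF f = X.φ , X.extension-Ann , agree
    where
    IH : ∀ {G} → IsFlat G → ∀ e → ∃ λ φ → Ann G φ × (∀ w → w ∈ normalWords t G (k ∸ e) → φ w ≡ f (pow G (suc e) w))
    IH {G} flatG e = normalWords-free t (k ∸ e) (ℕₚ.≤-trans (ℕₚ.m∸n≤m k e) k≤t) flatG (λ w → f (pow G (suc e) w))

    -- The induction needs a proof of flatness, whereas `Extension` asks for data at every subset;
    -- the zero functional serves as default at non-flats.
    choose : ∀ {G} → Dec (IsFlat G) → ℕ → Fun
    choose (yes flatG) e = proj₁ (IH flatG e)
    choose (no _)      e = λ _ → 𝟘

    choose-Ann : ∀ {G} (d : Dec (IsFlat G)) e → Ann G (choose d e)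
    choose-Ann (yes flatG) e = proj₁ (proj₂ (IH flatG e))
    choose-Ann (no _)      e = Ann-𝟘

    choose-agree : ∀ {G} (d : Dec (IsFlat G)) e → IsFlat G → ∀ w → w ∈ normalWords t G (k ∸ e) → choose d e w ≡ f (pow G (suc e) w)
    choose-agree (yes flatG) e _     = proj₂ (proj₂ (IH flatG e))
    choose-agree (no ¬flat)  e flatG = contradiction flatG ¬flat

    module X = Extension 𝕂 M isM flatF 𝟘 (λ G → choose (isFlat? G)) (λ {G} _ _ → choose-Ann (isFlat? G))

    agree : ∀ w → w ∈ normalWords (suc t) F (suc k) → X.φ w ≡ f w
    agree w w∈ = begin
      X.φ w                   ≡⟨ cong X.φ w≡ ⟩
      X.φ (pow G (suc e) w′)  ≡⟨ part-ok X.φ (suc e) (normalWords-ok t G (k ∸ e) w′∈) ⟨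
      part G X.φ (suc e) w′   ≡⟨ X.extension-part flatG F⊂G e e< w′ ⟩
      choose (isFlat? G) e w′ ≡⟨ choose-agree (isFlat? G) e flatG w′ w′∈ ⟩
      f (pow G (suc e) w′)    ≡⟨ cong f w≡ ⟨
      f w                     ∎
      where open Head (∈-normalWords⁻ {t} {F} {k} w∈)

-- Eliminating x_E = - Σ_{a ∈ L ≠ E} x_L: functionals on words without the letter E.
module Top (𝕂 : Scalars) {n : ℕ} (M : MatroidData n) (isM : IsMatroid M) where
  open Scalars 𝕂
  open Flats M
  open MatroidProperties isM
  open Words M
  open Functionals 𝕂 M isM
  open Ok
  open ≡-Reasoning

  -- The functionals on the ring in its original presentation: `E` is not a letter, and only the
  -- differences of the linear forms for `a` and `b` vanish.
  record TopFree (φ : Fun) : Set where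
    field
      supp : Supp ∅ φ
      sym↭ : Sym φ
      free : ∀ w → E ∈ w → φ w ≡ 𝟘
      lin  : ∀ {a b} → a ∈ˢ E → b ∈ˢ E → ∀ w → θ a φ w ≡ θ b φ w

  op-⊖ : ∀ p (φ : Fun) → op p (λ w → ⊖ φ w) ≗ (λ w → ⊖ op p φ w)
  op-⊖ p φ w = trans (∑-cong (flats M) (λ L → if-⊖ (p L) (φ (L ∷ w)))) (∑-neg (flats M) _)
    where
    if-⊖ : ∀ b x → (if b then ⊖ x else 𝟘) ≡ ⊖ (if b then x else 𝟘)
    if-⊖ true  x = refl
    if-⊖ false x = sym ⊖𝟘

  module _ {a₀} (a₀∈E : a₀ ∈ˢ E) where

    -- The action of x_E after elimination: minus the sum of the variables whose flat contains `a₀`.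
    -- On a `TopFree` functional the term of `E` itself contributes nothing.
    τ : Fun → Fun
    τ φ w = ⊖ θ a₀ φ w

    τ^ : ℕ → Fun → Fun
    τ^ zero    φ = φ
    τ^ (suc i) φ = τ (τ^ i φ)

    τ-TopFree : ∀ {φ} → TopFree φ → TopFree (τ φ)
    τ-TopFree {φ} A = record
      { supp = λ w ¬ok → trans (cong ⊖_ (op-Supp (a₀ ∈ᵇ_) A.supp w ¬ok)) ⊖𝟘
      ; sym↭ = λ p → cong ⊖_ (op-Sym (a₀ ∈ᵇ_) A.sym↭ p)
      ; free = λ w E∈ → trans (cong ⊖_ (op-zero (a₀ ∈ᵇ_) φ w (λ L _ _ → A.free (L ∷ w) (there E∈)))) ⊖𝟘
      ; lin = λ {a} {b} a∈E b∈E w → begin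
          θ a (τ φ) w          ≡⟨ op-⊖ (a ∈ᵇ_) (θ a₀ φ) w ⟩
          ⊖ θ a (θ a₀ φ) w     ≡⟨ cong ⊖_ (op-comm (a ∈ᵇ_) (a₀ ∈ᵇ_) A.sym↭ w) ⟩
          ⊖ θ a₀ (θ a φ) w     ≡⟨ cong ⊖_ (op-cong (a₀ ∈ᵇ_) (A.lin a∈E b∈E) w) ⟩
          ⊖ θ a₀ (θ b φ) w     ≡⟨ cong ⊖_ (op-comm (a₀ ∈ᵇ_) (b ∈ᵇ_) A.sym↭ w) ⟩
          ⊖ θ b (θ a₀ φ) w     ≡⟨ op-⊖ (b ∈ᵇ_) (θ a₀ φ) w ⟨
          θ b (τ φ) w          ∎ }
      where module A = TopFree A

    τ^-TopFree : ∀ i {φ} → TopFree φ → TopFree (τ^ i φ)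
    τ^-TopFree zero    A = A
    τ^-TopFree (suc i) A = τ-TopFree (τ^-TopFree i A)

    module _ {φ} (A : TopFree φ) where

      ext : Fun
      ext w = τ^ (count E w) φ (w without E)

      module τA i = TopFree (τ^-TopFree i A)

      ok-top : ∀ w → Ok ∅ (w without E) → Ok ∅ w
      ok-top w ok = ok-↭ (↭-sym (↭-pow-without E w)) (go (count E w))
        where
        go : ∀ e → Ok ∅ (pow E e (w without E))
        go zero    = ok
        go (suc e) = ok-∷ E-flat (⊥⊆ , a₀ , a₀∈E , ∉⊥) (λ L∈ → inj₂ (proj₁ (flat (go e) L∈))) (go e)

      ext-Sym : Sym ext
      ext-Sym {w} {w′} p = trans (cong (λ i → τ^ i φ (w without E)) (count-↭ E p))
        (τA.sym↭ (count E w′) (↭ₚ.filter-↭ (λ L → ¬? (L ≟ˢ E)) p))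

      -- The letter `E` contributes an application of `τ`, that is minus `θ a₀`, and the remaining
      -- letters contribute `θ a`. The two agree up to sign on a `TopFree` functional, so they
      -- cancel.
      ext-lin : ∀ {a} → a ∈ˢ E → ∀ w → θ a ext w ≡ 𝟘
      ext-lin {a} a∈E w = begin
        θ a ext w
          ≡⟨ ∑-cong (flats M) term ⟩
        ∑ (flats M) (λ L → (if does (L ≟ˢ E) then τ^ (suc i) φ v else 𝟘) ⊕ (if a ∈ᵇ L then τ^ i φ (L ∷ v) else 𝟘))
          ≡⟨ ∑-+ (flats M) _ _ ⟩
        ∑ (flats M) (λ L → if does (L ≟ˢ E) then τ^ (suc i) φ v else 𝟘) ⊕ θ a (τ^ i φ) v
          ≡⟨ cong₂ _⊕_ (∑-at E-flat (λ _ → τ^ (suc i) φ v)) (τA.lin i a∈E a₀∈E v) ⟩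
        ⊖ θ a₀ (τ^ i φ) v ⊕ θ a₀ (τ^ i φ) v
          ≡⟨ ⊖-inverseˡ _ ⟩
        𝟘 ∎
        where
        i = count E w
        v = w without E
        term : ∀ L → (if a ∈ᵇ L then ext (L ∷ w) else 𝟘) ≡
          (if does (L ≟ˢ E) then τ^ (suc i) φ v else 𝟘) ⊕ (if a ∈ᵇ L then τ^ i φ (L ∷ v) else 𝟘)
        term L with L ≟ˢ E
        ... | no _ = sym (⊕-identityˡ _)
        ... | yes refl rewrite dec-true (a ∈? E) a∈E =
              sym (trans (cong (τ^ (suc i) φ v ⊕_) (τA.free i (E ∷ v) (here refl))) (⊕-identityʳ _))

      ext-Ann : Ann ∅ ext
      ext-Ann = record
        { supp = λ w ¬ok → τA.supp (count E w) (w without E) (¬ok ∘ ok-top w)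
        ; sym↭ = ext-Sym
        ; lin = λ a∈E _ w → ext-lin a∈E w }

      ext-free : ∀ {w} → E ∉ w → ext w ≡ φ w
      ext-free {w} E∉w = cong₂ (λ i v → τ^ i φ v) (count-∉ E∉w) (without-pow 0 E∉w)

  extend-top : ∀ {φ} → TopFree φ → ∃ λ ext → Ann ∅ ext × (∀ w → E ∉ w → ext w ≡ φ w)
  extend-top {φ} A with nonempty? E
  ... | yes (a₀ , a₀∈E) = ext a₀∈E A , ext-Ann a₀∈E A , λ w → ext-free a₀∈E A
  ... | no empty = φ , record
        { supp = TopFree.supp A ; sym↭ = TopFree.sym↭ A ; lin = λ a∈E _ _ → contradiction (_ , a∈E) empty } , λ _ _ → refl

  -- Induction on the multiplicity of `E`: in the relation at `a₀` all terms other than that of `E`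
  -- have one letter `E` less, so they vanish, and the term of `E` must vanish too.
  top-determined : ∀ k {φ} → Ann ∅ φ → (∀ w → E ∉ w → length w ≡ k → φ w ≡ 𝟘) → ∀ w → length w ≡ k → φ w ≡ 𝟘
  top-determined k {φ} A vanish w len with nonempty? E
  ... | yes (a₀ , a₀∈E) = go (count E w) w refl len
    where
    go : ∀ i w → count E w ≡ i → length w ≡ k → φ w ≡ 𝟘
    go zero w none len = vanish w (λ E∈w → ∈⇒count≢0 E∈w none) len
    go (suc i) w count≡ len = begin
      φ w                                       ≡⟨ sym↭ A w↭ ⟩
      φ (E ∷ v)                                 ≡⟨ ∑-at E-flat (λ L → φ (L ∷ v)) ⟨
      ∑ (flats M) (λ L → if does (L ≟ˢ E) then φ (L ∷ v) else 𝟘) ≡⟨ ∑-cong (flats M) term ⟩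
      θ a₀ φ v                                  ≡⟨ lin A a₀∈E ∉⊥ v ⟩
      𝟘 ∎
      where
      v : Word n
      v = pow E i (w without E)
      w↭ : w ↭ E ∷ v
      w↭ = subst (λ c → w ↭ pow E c (w without E)) count≡ (↭-pow-without E w)
      E∉ : E ∉ w without E
      E∉ p = proj₂ (∈-filter⁻ (λ L → ¬? (L ≟ˢ E)) {xs = w} p) refl
      term : ∀ L → (if does (L ≟ˢ E) then φ (L ∷ v) else 𝟘) ≡ (if a₀ ∈ᵇ L then φ (L ∷ v) else 𝟘)
      term L with L ≟ˢ E
      ... | yes refl rewrite dec-true (a₀ ∈? E) a₀∈E = refl
      ... | no L≢E = sym (if-𝟘 (a₀ ∈ᵇ L) (go i (L ∷ v) count-v (trans (sym (↭ₚ.↭-length w↭)) len)))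
        where
        count-v : count E (L ∷ v) ≡ i
        count-v with L ≟ˢ E
        ... | yes L≡E = contradiction L≡E L≢E
        ... | no _    = count-pow i E∉
  -- With an empty ground set no `Ok` word contains `E`, since letters must be strictly above `∅`.
  ... | no empty = case ok? ∅ w of λ
    { (no ¬ok) → supp A w ¬ok
    ; (yes ok) → vanish w (λ E∈w → empty (let _ , x , x∈E , _ = above ok E∈w in x , x∈E)) len }

  topFree : Fun → Fun
  topFree φ w = if does (count E w ℕₚ.≟ 0) then φ w else 𝟘

  topFree-∉ : ∀ φ {w} → E ∉ w → topFree φ w ≡ φ w
  topFree-∉ φ {w} E∉w rewrite dec-true (count E w ℕₚ.≟ 0) (count-∉ E∉w) = refl

  topFree-∈ : ∀ φ {w} → E ∈ w → topFree φ w ≡ 𝟘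
  topFree-∈ φ {w} E∈w rewrite dec-false (count E w ℕₚ.≟ 0) (∈⇒count≢0 E∈w) = refl

  restrict-top : ∀ {φ} → Ann ∅ φ → TopFree (topFree φ)
  restrict-top {φ} A = record
    { supp = λ w ¬ok → if-𝟘 (does (count E w ℕₚ.≟ 0)) (supp A w ¬ok)
    ; sym↭ = λ p → cong₂ (λ i x → if does (i ℕₚ.≟ 0) then x else 𝟘) (count-↭ E p) (sym↭ A p)
    ; free = λ w E∈w → topFree-∈ φ E∈w
    ; lin = λ a∈E b∈E w → ⊕-cancelʳ (topFree (λ v → φ (E ∷ v)) w) _ _ (trans (θ-topFree a∈E w) (sym (θ-topFree b∈E w))) }
    where
    -- The relation at `a` with the term of `E` split off. The second summand does not depend on
    -- `a`, so comparing the relations at `a` and `b` cancels it.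
    θ-topFree : ∀ {a} → a ∈ˢ E → ∀ w → θ a (topFree φ) w ⊕ topFree (λ v → φ (E ∷ v)) w ≡ 𝟘
    θ-topFree {a} a∈E w = case E ∈ʷ? w of λ
      { (yes E∈w) → 𝟘⊕𝟘 (op-zero (a ∈ᵇ_) (topFree φ) w (λ L _ _ → topFree-∈ φ (there E∈w))) (topFree-∈ (λ v → φ (E ∷ v)) E∈w)
      ; (no E∉w) → begin
          θ a (topFree φ) w ⊕ topFree (λ v → φ (E ∷ v)) w
            ≡⟨ cong (θ a (topFree φ) w ⊕_) (trans (topFree-∉ (λ v → φ (E ∷ v)) E∉w) (sym (∑-at E-flat (λ L → φ (L ∷ w))))) ⟩
          θ a (topFree φ) w ⊕ ∑ (flats M) (λ L → if does (L ≟ˢ E) then φ (L ∷ w) else 𝟘)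
            ≡⟨ ∑-+ (flats M) _ _ ⟨
          ∑ (flats M) (λ L → (if a ∈ᵇ L then topFree φ (L ∷ w) else 𝟘) ⊕ (if does (L ≟ˢ E) then φ (L ∷ w) else 𝟘))
            ≡⟨ ∑-cong (flats M) (λ L → term L E∉w) ⟩
          θ a φ w
            ≡⟨ lin A a∈E ∉⊥ w ⟩
          𝟘 ∎ }
      where
      _∈ʷ?_ : ∀ L w → Dec (L ∈ w)
      L ∈ʷ? w = any? (L ≟ˢ_) w
      term : ∀ L → E ∉ w → (if a ∈ᵇ L then topFree φ (L ∷ w) else 𝟘) ⊕ (if does (L ≟ˢ E) then φ (L ∷ w) else 𝟘) ≡
                   (if a ∈ᵇ L then φ (L ∷ w) else 𝟘)
      term L E∉w = case L ≟ˢ E of λ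
        { (yes refl) → trans (cong₂ _⊕_ (if-𝟘 (a ∈ᵇ E) (topFree-∈ φ (here refl)))
                          (cong (λ b → if b then φ (E ∷ w) else 𝟘) (trans (dec-true (E ≟ˢ E) refl) (sym (dec-true (a ∈? E) a∈E)))))
                        (⊕-identityˡ _)
        ; (no L≢E) → trans (cong₂ _⊕_ (cong (λ z → if a ∈ᵇ L then z else 𝟘) (topFree-∉ φ {L ∷ w} (λ { (here refl) → L≢E refl ; (there p) → E∉w p })))
                          (cong (λ b → if b then φ (L ∷ w) else 𝟘) (dec-false (L ≟ˢ E) L≢E)))
                        (⊕-identityʳ _) }

-- Exponent vectors and their correspondence with words.

T⇒≡true : ∀ {b} → T b → b ≡ true
T⇒≡true {true} _ = refl

≡true⇒T : ∀ {b} → b ≡ true → T b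
≡true⇒T refl = _

module Monomials where

  ≡ᵐ⁻ : ∀ {m} (u v : Monomial m) → (u ≡ᵐ v) ≡ true → u ≗ v
  ≡ᵐ⁻ u v h i = ℕₚ.≡ᵇ⇒≡ (u i) (v i) (≡true⇒T (allᶠ⁻ _ h i))

  ≡ᵐ⁺ : ∀ {m} (u v : Monomial m) → u ≗ v → (u ≡ᵐ v) ≡ true
  ≡ᵐ⁺ u v h = allᶠ⁺ _ (λ i → T⇒≡true (ℕₚ.≡⇒≡ᵇ (u i) (v i) (h i)))

  ≡ᵐ-congʳ : ∀ {m} (e u v : Monomial m) → u ≗ v → (e ≡ᵐ u) ≡ (e ≡ᵐ v)
  ≡ᵐ-congʳ e u v h = bool-ext (λ p → ≡ᵐ⁺ e v (λ i → trans (≡ᵐ⁻ e u p i) (h i))) (λ p → ≡ᵐ⁺ e u (λ i → trans (≡ᵐ⁻ e v p i) (sym (h i))))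

  -- e = u · v tested by divisibility and division, as in the definition of multiplication by a monomial
  quotient-≡ᵐ : ∀ {m} (u e v : Monomial m) → (u ≤ᵐ e) ∧ ((e ∸ᵐ u) ≡ᵐ v) ≡ (e ≡ᵐ (v +ᵐ u))
  quotient-≡ᵐ u e v = bool-ext to from
    where
    to : (u ≤ᵐ e) ∧ ((e ∸ᵐ u) ≡ᵐ v) ≡ true → (e ≡ᵐ (v +ᵐ u)) ≡ true
    to h = ≡ᵐ⁺ e (v +ᵐ u) (λ i → trans (sym (ℕₚ.m∸n+n≡m (ℕₚ.≤ᵇ⇒≤ (u i) (e i) (≡true⇒T (allᶠ⁻ _ (proj₁ (∧-true⁻ h)) i)))))
                            (cong (_+ u i) (≡ᵐ⁻ (e ∸ᵐ u) v (proj₂ (∧-true⁻ {u ≤ᵐ e} h)) i)))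
    from : (e ≡ᵐ (v +ᵐ u)) ≡ true → (u ≤ᵐ e) ∧ ((e ∸ᵐ u) ≡ᵐ v) ≡ true
    from h = ∧-true⁺ (allᶠ⁺ _ (λ i → T⇒≡true (ℕₚ.≤⇒≤ᵇ (subst (u i ≤_) (sym (≡ᵐ⁻ e (v +ᵐ u) h i)) (ℕₚ.m≤n+m (u i) (v i))))))
                     (≡ᵐ⁺ (e ∸ᵐ u) v (λ i → trans (cong (_∸ u i) (≡ᵐ⁻ e (v +ᵐ u) h i)) (ℕₚ.m+n∸n≡m (v i) (u i))))

  deg : ∀ {m} → Monomial m → ℕ
  deg {zero}  u = 0
  deg {suc m} u = u Fin.zero + deg (u ∘ Fin.suc)

  deg-unit+ : ∀ {m} (i : Fin m) u → deg (unitMon i +ᵐ u) ≡ suc (deg u)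
  deg-unit+ Fin.zero    u = refl
  deg-unit+ (Fin.suc i) u = trans (cong (u Fin.zero +_) (deg-unit+ i (u ∘ Fin.suc))) (ℕₚ.+-suc _ _)

  monomials-sound : ∀ m k {e} → e ∈ monomials m k → deg e ≡ k
  monomials-sound zero    zero    e∈ = refl
  monomials-sound (suc m) k {e} e∈
    with find (∈-concatMap⁻ (λ a → map (consMon a) (monomials m (k ∸ a))) {xs = upTo (suc k)} e∈)
  ... | a , a∈ , e∈a with ∈-map⁻ (consMon a) e∈a
  ... | e′ , e′∈ , refl = trans (cong (a +_) (monomials-sound m (k ∸ a) e′∈)) (ℕₚ.m+[n∸m]≡n (ℕₚ.≤-pred (∈-upTo⁻ a∈)))

  -- Monomials are functions, so one of degree `k` is met in the list only up to pointwise equality.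
  monomials-complete : ∀ m k (u : Monomial m) → deg u ≡ k → ∃ λ e → e ∈ monomials m k × e ≗ u
  monomials-complete zero    .0 u refl = (λ ()) , here refl , λ ()
  monomials-complete (suc m) k  u eq
    with monomials-complete m (k ∸ u Fin.zero) (u ∘ Fin.suc) (trans (sym (ℕₚ.m+n∸m≡n (u Fin.zero) _)) (cong (_∸ u Fin.zero) eq))
  ... | e , e∈ , e≗ = consMon (u Fin.zero) e ,
    ∈-concatMap⁺ (λ a → map (consMon a) (monomials m (k ∸ a)))
      (lose (∈-upTo⁺ (s≤s (subst (u Fin.zero ≤_) eq (ℕₚ.m≤m+n _ _)))) (∈-map⁺ (consMon (u Fin.zero)) e∈)) ,
    λ { Fin.zero → refl ; (Fin.suc i) → e≗ i }

  monomials-distinct : ∀ m k → AllPairs (λ e e′ → ¬ e ≗ e′) (monomials m k)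
  monomials-distinct zero    zero    = [] ∷ []
  monomials-distinct zero    (suc k) = []
  monomials-distinct (suc m) k = concatMap-allPairs (λ a → map (consMon a) (monomials m (k ∸ a)))
    (AllPairs.map (λ ne v w p q eq → ne (first (∈-map⁻ _ p) (∈-map⁻ _ q) eq)) (Uniqueₚ.upTo⁺ (suc k)))
    (λ a → AllPairsₚ.map⁺ (AllPairs.map (λ ne eq → ne (eq ∘ Fin.suc)) (monomials-distinct m (k ∸ a))))
    where
    first : ∀ {a a′ v w} {l l′ : List (Monomial m)} → (∃ λ e → e ∈ l × v ≡ consMon a e) → (∃ λ e → e ∈ l′ × w ≡ consMon a′ e) → v ≗ w → a ≡ a′
    first (_ , _ , refl) (_ , _ , refl) eq = eq Fin.zero

  wordOf : ∀ {n m} → (Fin m → Subset n) → Monomial m → Word n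
  wordOf {m = zero}  x u = []
  wordOf {m = suc m} x u = pow (x Fin.zero) (u Fin.zero) (wordOf (x ∘ Fin.suc) (u ∘ Fin.suc))

  wordOf-cong : ∀ {n m} (x : Fin m → Subset n) {u v} → u ≗ v → wordOf x u ≡ wordOf x v
  wordOf-cong {m = zero}  x h = refl
  wordOf-cong {m = suc m} x h = cong₂ (pow (x Fin.zero)) (h Fin.zero) (wordOf-cong (x ∘ Fin.suc) (h ∘ Fin.suc))

  wordOf-unit+ : ∀ {n m} (x : Fin m → Subset n) i u → wordOf x (unitMon i +ᵐ u) ↭ x i ∷ wordOf x u
  wordOf-unit+ x Fin.zero    u = ↭-refl
  wordOf-unit+ x (Fin.suc i) u = ↭-trans
    (↭ₚ.++⁺ˡ (replicate (u Fin.zero) (x Fin.zero)) (wordOf-unit+ (x ∘ Fin.suc) i (u ∘ Fin.suc)))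
    (↭-sym (pow-∷ (x Fin.zero) (u Fin.zero) (x (Fin.suc i)) (wordOf (x ∘ Fin.suc) (u ∘ Fin.suc))))

  ∈-wordOf⁻ : ∀ {n m} (x : Fin m → Subset n) u {L} → L ∈ wordOf x u → ∃ λ i → L ≡ x i
  ∈-wordOf⁻ {m = suc m} x u L∈ with ∈-pow⁻ (u Fin.zero) L∈
  ... | inj₁ eq  = Fin.zero , eq
  ... | inj₂ L∈′ = let i , eq = ∈-wordOf⁻ (x ∘ Fin.suc) (u ∘ Fin.suc) L∈′ in Fin.suc i , eq

  length-pow : ∀ {n} (G : Subset n) e m → length (pow G e m) ≡ e + length m
  length-pow G e m = trans (Listₚ.length-++ (replicate e G)) (cong (_+ length m) (Listₚ.length-replicate e))

  length-wordOf : ∀ {n m} (x : Fin m → Subset n) u → length (wordOf x u) ≡ deg u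
  length-wordOf {m = zero}  x u = refl
  length-wordOf {m = suc m} x u = trans (length-pow (x Fin.zero) (u Fin.zero) _) (cong (u Fin.zero +_) (length-wordOf (x ∘ Fin.suc) (u ∘ Fin.suc)))

  count-pow-≢ : ∀ {n} {G H : Subset n} e m → H ≢ G → count G (pow H e m) ≡ count G m
  count-pow-≢ zero    m ne = refl
  count-pow-≢ {G = G} {H} (suc e) m ne with H ≟ˢ G
  ... | yes eq = contradiction eq ne
  ... | no _   = count-pow-≢ e m ne

  count-wordOf : ∀ {n m} (x : Fin m → Subset n) → (∀ {i j} → x i ≡ x j → i ≡ j) → ∀ u i → count (x i) (wordOf x u) ≡ u i
  count-wordOf x inj u Fin.zero = count-pow (u Fin.zero) λ p →
    let i , eq = ∈-wordOf⁻ (x ∘ Fin.suc) (u ∘ Fin.suc) p in contradiction (inj eq) λ ()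
  count-wordOf x inj u (Fin.suc i) = trans
    (count-pow-≢ {G = x (Fin.suc i)} (u Fin.zero) (wordOf (x ∘ Fin.suc) (u ∘ Fin.suc)) (λ eq → contradiction (inj eq) λ ()))
    (count-wordOf (x ∘ Fin.suc) (Finₚ.suc-injective ∘ inj) (u ∘ Fin.suc) i)

  exponents : ∀ {n m} → (Fin m → Subset n) → Word n → Monomial m
  exponents x w i = count (x i) w

  exponents-∷ : ∀ {n m} (x : Fin m → Subset n) → (∀ {i j} → x i ≡ x j → i ≡ j) → ∀ i w →
    exponents x (x i ∷ w) ≗ unitMon i +ᵐ exponents x w
  exponents-∷ x inj i w j with x i ≟ˢ x j | i Fin.≟ j
  ... | yes _  | yes _  = refl
  ... | no _   | no _   = refl
  ... | yes eq | no ne  = contradiction (inj eq) ne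
  ... | no ne  | yes eq = contradiction (cong x eq) ne

  wordOf-exponents : ∀ {n m} (x : Fin m → Subset n) → (∀ {i j} → x i ≡ x j → i ≡ j) → ∀ w →
    (∀ {L} → L ∈ w → ∃ λ i → L ≡ x i) → wordOf x (exponents x w) ↭ w
  wordOf-exponents {m = m} x inj [] letters = nil m x
    where
    nil : ∀ m (x : Fin m → Subset _) → wordOf x (λ _ → 0) ↭ []
    nil zero    x = ↭-refl
    nil (suc m) x = nil m (x ∘ Fin.suc)
  wordOf-exponents x inj (L ∷ w) letters with letters (here refl)
  ... | i , refl = ↭-trans (subst (_↭ x i ∷ wordOf x (exponents x w)) (sym (wordOf-cong x (exponents-∷ x inj i w))) (wordOf-unit+ x i (exponents x w)))
                           (prep (x i) (wordOf-exponents x inj w (letters ∘ there)))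

  deg-exponents : ∀ {n m} (x : Fin m → Subset n) → (∀ {i j} → x i ≡ x j → i ≡ j) → ∀ w →
    (∀ {L} → L ∈ w → ∃ λ i → L ≡ x i) → deg (exponents x w) ≡ length w
  deg-exponents x inj w letters = trans (sym (length-wordOf x (exponents x w))) (↭ₚ.↭-length (wordOf-exponents x inj w letters))

-- The graded pieces of the Chow ring and their dimensions.

ℚ-scalars : Scalars
ℚ-scalars = record { isCommutativeRing = ℚₚ.+-*-isCommutativeRing }

module ChowRing {n : ℕ} (M : MatroidData n) (isM : IsMatroid M) (loopless : Loopless M) (k : ℕ) where
  open import Data.Rational using (_*_; _-_) renaming (_+_ to _⊕_)
  open Flats M
  open MatroidProperties isM
  open Words M
  open NormalWords M
  open Functionals ℚ-scalars M isM
  open AnnBasis ℚ-scalars M isM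
  open Top ℚ-scalars M isM
  open LinearAlgebra
  open ListSum ℚₚ.+-*-commutativeRing
  open Monomials
  open Ok
  open ≡-Reasoning

  flat∅ : IsFlat ∅
  flat∅ = ∅-flat loopless

  Proper : Subset n → Set
  Proper L = IsFlat L × ¬ L ⊆ ∅ × L ≢ E

  properᵇ : Subset n → Bool
  properᵇ L = not (isEmptyᵇ L) ∧ not (L ≡ˢ E)

  properᵇ⁻ : ∀ {L} → properᵇ L ≡ true → ¬ L ⊆ ∅ × L ≢ E
  properᵇ⁻ {L} h with L ⊆? ∅ | L ⊆? E | E ⊆? L
  ... | no ne | no L⊈E | _      = ne , λ { refl → L⊈E ⊆-refl }
  ... | no ne | yes _  | no E⊈L = ne , λ { refl → E⊈L ⊆-refl }

  properᵇ⁺ : ∀ {L} → ¬ L ⊆ ∅ → L ≢ E → properᵇ L ≡ true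
  properᵇ⁺ {L} ne L≢E with L ⊆? ∅ | L ⊆? E | E ⊆? L
  ... | yes L⊆∅ | _       | _       = ⊥-elim (ne L⊆∅)
  ... | no _    | no _    | _       = refl
  ... | no _    | yes _   | no _    = refl
  ... | no _    | yes L⊆E | yes E⊆L = contradiction (⊆-antisym L⊆E E⊆L) L≢E

  ∈-chowVars⁻ : ∀ {L} → L ∈ chowVars M → Proper L
  ∈-chowVars⁻ L∈ = let p , q = ∈-filter⁻ (λ F → properᵇ F Data.Bool.≟ true) {xs = flats M} L∈ in ∈-flats⁻ p , properᵇ⁻ q

  ∈-chowVars⁺ : ∀ {L} → Proper L → L ∈ chowVars M
  ∈-chowVars⁺ (flatL , ne , L≢E) = ∈-filter⁺ (λ F → properᵇ F Data.Bool.≟ true) (∈-flats⁺ flatL) (properᵇ⁺ ne L≢E)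

  v# : ℕ
  v# = nVars M

  x : Fin v# → Subset n
  x = var M

  x-injective : ∀ {i j} → x i ≡ x j → i ≡ j
  x-injective {i} {j} = lookup-injective (Uniqueₚ.filter⁺ (λ F → properᵇ F Data.Bool.≟ true) (flats-unique M)) i j

  x-proper : ∀ i → Proper (x i)
  x-proper i = ∈-chowVars⁻ (∈-lookup {xs = chowVars M} i)

  proper-x : ∀ {L} → Proper L → ∃ λ i → L ≡ x i
  proper-x p = index (∈-chowVars⁺ p) , lookup-index (∈-chowVars⁺ p)

  proper-above : ∀ {L} → Proper L → ∅ ⊂ L
  proper-above (_ , ne , _) = ⊥⊆ , ⊈⇒∃∉ ne

  above-nonempty : ∀ {L : Subset n} → ∅ ⊂ L → ¬ L ⊆ ∅
  above-nonempty = ⊂⇒⊉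

  ∑-lookup : ∀ {A : Set} (xs : List A) (f : A → ℚ) → ∑ (allFin (length xs)) (λ i → f (lookup xs i)) ≡ ∑ xs f
  ∑-lookup []       f = refl
  ∑-lookup (y ∷ ys) f = trans (∑-allFin-suc (length ys) (λ i → f (lookup (y ∷ ys) i))) (cong (f y ⊕_) (∑-lookup ys f))

  ∑-x : ∀ (f : Subset n → ℚ) → (∀ {L} → IsFlat L → ¬ Proper L → f L ≡ 0ℚ) → ∑ (allFin v#) (λ i → f (x i)) ≡ ∑ (flats M) f
  ∑-x f vanish = begin
    ∑ (allFin v#) (λ i → f (x i))                     ≡⟨ ∑-lookup (chowVars M) f ⟩
    ∑ (chowVars M) f                                  ≡⟨ ∑-filterᵇ properᵇ (flats M) f ⟩
    ∑ (flats M) (λ L → if properᵇ L then f L else 0ℚ) ≡⟨ ∑-cong∈ (flats M) (λ L L∈ → term L (∈-flats⁻ L∈)) ⟩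
    ∑ (flats M) f                                     ∎
    where
    term : ∀ L → IsFlat L → (if properᵇ L then f L else 0ℚ) ≡ f L
    term L flatL with properᵇ L in eq
    ... | true  = refl
    ... | false = sym (vanish flatL (λ { (_ , ne , L≢E) → contradiction (trans (sym (properᵇ⁺ ne L≢E)) eq) λ () }))

  θ-x : ∀ {φ} → TopFree φ → ∀ a w → θ a φ w ≡ ∑ (allFin v#) (λ i → if a ∈ᵇ x i then φ (x i ∷ w) else 0ℚ)
  θ-x {φ} A a w = sym (∑-x (λ L → if a ∈ᵇ L then φ (L ∷ w) else 0ℚ) (λ {L} flatL improper → if-𝟘 (a ∈ᵇ L) (vanish flatL improper)))
    where
    vanish : ∀ {L} → IsFlat L → ¬ Proper L → φ (L ∷ w) ≡ 0ℚ
    vanish {L} flatL improper with L ≟ˢ E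
    ... | yes refl = TopFree.free A (E ∷ w) (here refl)
    ... | no L≢E   = TopFree.supp A (L ∷ w) (λ ok → improper (flatL , above-nonempty (above ok (here refl)) , L≢E))

  coef : Fin n → Fin n → Fin v# → ℚ
  coef a b i = (if a ∈ᵇ x i then 1ℚ else 0ℚ) - (if b ∈ᵇ x i then 1ℚ else 0ℚ)

  ∑-coef : ∀ a b (f : Fin v# → ℚ) → ∑ (allFin v#) (λ i → coef a b i * f i) ≡
    ∑ (allFin v#) (λ i → if a ∈ᵇ x i then f i else 0ℚ) - ∑ (allFin v#) (λ i → if b ∈ᵇ x i then f i else 0ℚ)
  ∑-coef a b f = trans (∑-cong (allFin v#) (λ i → term (a ∈ᵇ x i) (b ∈ᵇ x i) (f i)))
    (∑-sub (allFin v#) (λ i → if a ∈ᵇ x i then f i else 0ℚ) (λ i → if b ∈ᵇ x i then f i else 0ℚ))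
    where
    open +-*-Solver using (solve; _:=_; _:*_; _:-_; con)
    term : ∀ p q y → ((if p then 1ℚ else 0ℚ) - (if q then 1ℚ else 0ℚ)) * y ≡ (if p then y else 0ℚ) - (if q then y else 0ℚ)
    term true  true  y = solve 1 (λ y → (con 1ℚ :- con 1ℚ) :* y := y :- y) refl y
    term true  false y = solve 1 (λ y → (con 1ℚ :- con 0ℚ) :* y := y :- con 0ℚ) refl y
    term false true  y = solve 1 (λ y → (con 0ℚ :- con 1ℚ) :* y := con 0ℚ :- y) refl y
    term false false y = solve 1 (λ y → (con 0ℚ :- con 0ℚ) :* y := con 0ℚ :- con 0ℚ) refl y

  B : List (Monomial v#)
  B = basisMon M k

  N : ℕ
  N = dimPoly M k

  e# : Fin N → Monomial v#
  e# j = lookup B j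

  deg-e# : ∀ j → deg (e# j) ≡ k
  deg-e# j = monomials-sound v# k (∈-lookup {xs = B} j)

  -- the value on a monomial of the functional with coordinates v
  hat : V N → Monomial v# → ℚ
  hat v u = ∑ (allFin N) (λ j → if e# j ≡ᵐ u then v j else 0ℚ)

  hat-cong : ∀ v {u u′} → u ≗ u′ → hat v u ≡ hat v u′
  hat-cong v {u} {u′} h = ∑-cong (allFin N) (λ j → cong (λ b → if b then v j else 0ℚ) (≡ᵐ-congʳ (e# j) u u′ h))

  e#-injective : ∀ i j → e# i ≗ e# j → i ≡ j
  e#-injective i j h = decidable-stable (i Fin.≟ j) (λ ne →
    lookup-allPairs {R = λ e e′ → ¬ e ≗ e′} (λ ne′ h′ → ne′ (λ l → sym (h′ l))) (monomials-distinct v# k) i j ne h)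

  hat-e# : ∀ v j {u} → e# j ≗ u → hat v u ≡ v j
  hat-e# v j {u} h = ∑-single (Uniqueₚ.allFin⁺ N) (∈-allFin j) (λ i → e# i ≡ᵐ u) v (≡ᵐ⁺ (e# j) u h)
    (λ i _ h′ → e#-injective i j (λ l → trans (≡ᵐ⁻ (e# i) u h′ l) (sym (h l))))

  degree-k : ∀ u → deg u ≡ k → ∃ λ j → e# j ≗ u
  degree-k u deg≡ with monomials-complete v# k u deg≡
  ... | e , e∈ , e≗ = index e∈ , λ i → trans (cong (λ f → f i) (sym (lookup-index e∈))) (e≗ i)

  *-if : ∀ p (c y : ℚ) → c * (if p then y else 0ℚ) ≡ y * (if p then c else 0ℚ)
  *-if true  c y = ℚₚ.*-comm c y
  *-if false c y = trans (ℚₚ.*-zeroʳ c) (sym (ℚₚ.*-zeroʳ y))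

  pairPoly : Fin v# → Fin v# → Poly v#
  pairPoly i i′ e = if e ≡ᵐ (unitMon i +ᵐ unitMon i′) then 1ℚ else 0ℚ

  dot-pair : ∀ v u i i′ → dot v (mulMon M k u (pairPoly i i′)) ≡ hat v ((unitMon i +ᵐ unitMon i′) +ᵐ u)
  dot-pair v u i i′ = ∑-cong (allFin N) term
    where
    y = unitMon i +ᵐ unitMon i′
    term : ∀ j → v j * mulMon M k u (pairPoly i i′) j ≡ (if e# j ≡ᵐ (y +ᵐ u) then v j else 0ℚ)
    term j = trans (cong (v j *_) (trans (if-∧ (u ≤ᵐ e# j) ((e# j ∸ᵐ u) ≡ᵐ y)) (cong (λ b → if b then 1ℚ else 0ℚ) (quotient-≡ᵐ u (e# j) y))))
      (trans (*-if (e# j ≡ᵐ (y +ᵐ u)) (v j) 1ℚ) (ℚₚ.*-identityˡ (if e# j ≡ᵐ (y +ᵐ u) then v j else 0ℚ)))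

  dot-lin : ∀ v u a b → dot v (mulMon M k u (linJ M a b)) ≡ ∑ (allFin v#) (λ i → coef a b i * hat v (unitMon i +ᵐ u))
  dot-lin v u a b = begin
    ∑ (allFin N) (λ j → v j * mulMon M k u (linJ M a b) j)
      ≡⟨ ∑-cong (allFin N) term ⟩
    ∑ (allFin N) (λ j → ∑ (allFin v#) (λ i → coef a b i * (if e# j ≡ᵐ (unitMon i +ᵐ u) then v j else 0ℚ)))
      ≡⟨ ∑-swap (allFin N) (allFin v#) (λ j i → coef a b i * (if e# j ≡ᵐ (unitMon i +ᵐ u) then v j else 0ℚ)) ⟩
    ∑ (allFin v#) (λ i → ∑ (allFin N) (λ j → coef a b i * (if e# j ≡ᵐ (unitMon i +ᵐ u) then v j else 0ℚ)))
      ≡⟨ ∑-cong (allFin v#) (λ i → ∑-*ˡ (allFin N) (coef a b i) (λ j → if e# j ≡ᵐ (unitMon i +ᵐ u) then v j else 0ℚ)) ⟩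
    ∑ (allFin v#) (λ i → coef a b i * hat v (unitMon i +ᵐ u)) ∎
    where
    term : ∀ j → v j * mulMon M k u (linJ M a b) j ≡ ∑ (allFin v#) (λ i → coef a b i * (if e# j ≡ᵐ (unitMon i +ᵐ u) then v j else 0ℚ))
    term j = begin
      v j * (if u ≤ᵐ e# j then ∑ (allFin v#) (λ i → if (e# j ∸ᵐ u) ≡ᵐ unitMon i then coef a b i else 0ℚ) else 0ℚ)
        ≡⟨ cong (v j *_) (if-∑ (u ≤ᵐ e# j) (allFin v#) (λ i → if (e# j ∸ᵐ u) ≡ᵐ unitMon i then coef a b i else 0ℚ)) ⟩
      v j * ∑ (allFin v#) (λ i → if u ≤ᵐ e# j then (if (e# j ∸ᵐ u) ≡ᵐ unitMon i then coef a b i else 0ℚ) else 0ℚ)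
        ≡⟨ ∑-*ˡ (allFin v#) (v j) (λ i → if u ≤ᵐ e# j then (if (e# j ∸ᵐ u) ≡ᵐ unitMon i then coef a b i else 0ℚ) else 0ℚ) ⟨
      ∑ (allFin v#) (λ i → v j * (if u ≤ᵐ e# j then (if (e# j ∸ᵐ u) ≡ᵐ unitMon i then coef a b i else 0ℚ) else 0ℚ))
        ≡⟨ ∑-cong (allFin v#) (λ i → trans
             (cong (v j *_) (trans (if-∧ (u ≤ᵐ e# j) ((e# j ∸ᵐ u) ≡ᵐ unitMon i)) (cong (λ p → if p then coef a b i else 0ℚ) (quotient-≡ᵐ u (e# j) (unitMon i)))))
             (*-if (e# j ≡ᵐ (unitMon i +ᵐ u)) (v j) (coef a b i))) ⟩
      ∑ (allFin v#) (λ i → coef a b i * (if e# j ≡ᵐ (unitMon i +ᵐ u) then v j else 0ℚ)) ∎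

  data GeneratorView (g : Generator v#) : Set where
    pair   : ∀ i i′ → ¬ Comparable (x i) (x i′) → g ≡ gen 2 (pairPoly i i′) → GeneratorView g
    linear : ∀ {a b} → a ∈ˢ E → b ∈ˢ E → g ≡ gen 1 (linJ M a b) → GeneratorView g

  incomparableᵇ⁻ : ∀ {X Y : Subset n} → incomparableᵇ X Y ≡ true → ¬ Comparable X Y
  incomparableᵇ⁻ {X} {Y} h with X ⊆? Y | Y ⊆? X
  ... | no p | no q = λ { (inj₁ X⊆Y) → p X⊆Y ; (inj₂ Y⊆X) → q Y⊆X }

  incomparableᵇ⁺ : ∀ {X Y : Subset n} → ¬ Comparable X Y → incomparableᵇ X Y ≡ true
  incomparableᵇ⁺ {X} {Y} h with X ⊆? Y | Y ⊆? X
  ... | yes p | _     = ⊥-elim (h (inj₁ p))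
  ... | no _  | yes q = ⊥-elim (h (inj₂ q))
  ... | no _  | no _  = refl

  ∈-if⁻ : ∀ {A : Set} b {y z : A} → y ∈ (if b then z ∷ [] else []) → b ≡ true × y ≡ z
  ∈-if⁻ true (here eq) = refl , eq

  ∈-if⁺ : ∀ {A : Set} {b} {z : A} → b ≡ true → z ∈ (if b then z ∷ [] else [])
  ∈-if⁺ refl = here refl

  genIᵢⱼ : Fin v# → Fin v# → List (Generator v#)
  genIᵢⱼ i i′ = if incomparableᵇ (x i) (x i′) then gen 2 (pairPoly i i′) ∷ [] else []

  genJₐᵦ : Fin n → Fin n → List (Generator v#)
  genJₐᵦ a b = if (a ∈ᵇ E) ∧ (b ∈ᵇ E) then gen 1 (linJ M a b) ∷ [] else []

  generators⁻ : ∀ {g} → g ∈ generators M → GeneratorView g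
  generators⁻ {g} g∈ = [ fromI , fromJ ]′ (∈-++⁻ (genI M) g∈)
    where
    fromI : g ∈ genI M → GeneratorView g
    fromI g∈I =
      let i  , _ , p = find (∈-concatMap⁻ (λ i → concatMap (genIᵢⱼ i) (allFin v#)) {xs = allFin v#} g∈I)
          i′ , _ , q = find (∈-concatMap⁻ (genIᵢⱼ i) {xs = allFin v#} p)
          inc , eq   = ∈-if⁻ (incomparableᵇ (x i) (x i′)) q
      in pair i i′ (incomparableᵇ⁻ inc) eq
    fromJ : g ∈ genJ M → GeneratorView g
    fromJ g∈J =
      let a , _ , p = find (∈-concatMap⁻ (λ a → concatMap (genJₐᵦ a) (allFin n)) {xs = allFin n} g∈J)
          b , _ , q = find (∈-concatMap⁻ (genJₐᵦ a) {xs = allFin n} p)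
          both , eq = ∈-if⁻ ((a ∈ᵇ E) ∧ (b ∈ᵇ E)) q
      in linear (does⁻ (a ∈? E) (proj₁ (∧-true⁻ both))) (does⁻ (b ∈? E) (proj₂ (∧-true⁻ {a ∈ᵇ E} both))) eq

  pair∈ : ∀ i i′ → ¬ Comparable (x i) (x i′) → gen 2 (pairPoly i i′) ∈ generators M
  pair∈ i i′ inc = ∈-++⁺ˡ (∈-concatMap⁺ (λ i → concatMap (genIᵢⱼ i) (allFin v#)) (lose (∈-allFin i)
    (∈-concatMap⁺ (genIᵢⱼ i) (lose (∈-allFin i′) (∈-if⁺ (incomparableᵇ⁺ inc))))))

  linear∈ : ∀ {a b} → a ∈ˢ E → b ∈ˢ E → gen 1 (linJ M a b) ∈ generators M
  linear∈ {a} {b} a∈E b∈E = ∈-++⁺ʳ (genI M) (∈-concatMap⁺ (λ a → concatMap (genJₐᵦ a) (allFin n)) (lose (∈-allFin a)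
    (∈-concatMap⁺ (genJₐᵦ a) (lose (∈-allFin b) (∈-if⁺ (∧-true⁺ (dec-true (a ∈? E) a∈E) (dec-true (b ∈? E) b∈E)))))))

  multiples : Generator v# → List (Deg M k)
  multiples g = if Generator.degree g ≤ᵇ k
                then map (λ u → mulMon M k u (Generator.poly g)) (monomials v# (k ∸ Generator.degree g)) else []

  idealSpan⁻ : ∀ {l} → l ∈ idealSpan M k → ∃ λ g → g ∈ generators M × Generator.degree g ≤ k ×
    ∃ λ u → u ∈ monomials v# (k ∸ Generator.degree g) × l ≡ mulMon M k u (Generator.poly g)
  idealSpan⁻ {l} l∈ = go (find (∈-concatMap⁻ multiples {xs = generators M} l∈))
    where
    guarded : ∀ {A : Set} b {xs : List A} {y} → y ∈ (if b then xs else []) → b ≡ true × y ∈ xs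
    guarded true p = refl , p
    go : (∃ λ g → g ∈ generators M × l ∈ multiples g) → _
    go (g , g∈ , l∈g) = let deg≤ , l∈ = guarded (Generator.degree g ≤ᵇ k) l∈g in
      g , g∈ , ℕₚ.≤ᵇ⇒≤ _ k (≡true⇒T deg≤) , ∈-map⁻ (λ u → mulMon M k u (Generator.poly g)) l∈

  idealSpan⁺ : ∀ {g u} → g ∈ generators M → Generator.degree g ≤ k → u ∈ monomials v# (k ∸ Generator.degree g) →
    mulMon M k u (Generator.poly g) ∈ idealSpan M k
  idealSpan⁺ {g} {u} g∈ deg≤ u∈ = ∈-concatMap⁺ multiples (lose g∈ in-multiples)
    where
    in-multiples : mulMon M k u (Generator.poly g) ∈ multiples g
    in-multiples = subst (λ b → mulMon M k u (Generator.poly g) ∈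
        (if b then map (λ u → mulMon M k u (Generator.poly g)) (monomials v# (k ∸ Generator.degree g)) else []))
      (sym (T⇒≡true (ℕₚ.≤⇒≤ᵇ deg≤))) (∈-map⁺ (λ u → mulMon M k u (Generator.poly g)) u∈)

  coords : Fun → V N
  coords φ j = φ (wordOf x (e# j))

  x≢E : ∀ w → (∀ {L} → L ∈ w → ∃ λ i → L ≡ x i) → E ∉ w
  x≢E w letters E∈w = let i , eq = letters E∈w in proj₂ (proj₂ (x-proper i)) (sym eq)

  hat-coords : ∀ {φ} u → deg u ≡ k → hat (coords φ) u ≡ φ (wordOf x u)
  hat-coords {φ} u deg≡ = let j , h = degree-k u deg≡ in trans (hat-e# (coords φ) j h) (cong φ (wordOf-cong x h))

  module _ {φ} (A : TopFree φ) where
    private module A = TopFree A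

    pair-⊥ : ∀ i i′ → ¬ Comparable (x i) (x i′) → 2 ≤ k → ∀ u → u ∈ monomials v# (k ∸ 2) →
             dot (coords φ) (mulMon M k u (pairPoly i i′)) ≡ 0ℚ
    pair-⊥ i i′ inc deg≤ u u∈ = begin
      dot (coords φ) (mulMon M k u (pairPoly i i′))         ≡⟨ dot-pair (coords φ) u i i′ ⟩
      hat (coords φ) ((unitMon i +ᵐ unitMon i′) +ᵐ u)       ≡⟨ hat-cong (coords φ) (λ l → ℕₚ.+-assoc (unitMon i l) (unitMon i′ l) (u l)) ⟩
      hat (coords φ) (unitMon i +ᵐ (unitMon i′ +ᵐ u))       ≡⟨ hat-coords {φ} (unitMon i +ᵐ (unitMon i′ +ᵐ u)) deg≡ ⟩
      φ (wordOf x (unitMon i +ᵐ (unitMon i′ +ᵐ u)))         ≡⟨ A.sym↭ (↭-trans (wordOf-unit+ x i (unitMon i′ +ᵐ u)) (prep (x i) (wordOf-unit+ x i′ u))) ⟩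
      φ (x i ∷ x i′ ∷ wordOf x u)                           ≡⟨ A.supp _ (λ ok → inc (chain ok (here refl) (there (here refl)))) ⟩
      0ℚ ∎
      where
      deg≡ : deg (unitMon i +ᵐ (unitMon i′ +ᵐ u)) ≡ k
      deg≡ = trans (deg-unit+ i (unitMon i′ +ᵐ u)) (trans (cong suc (deg-unit+ i′ u))
        (trans (cong (suc ∘ suc) (monomials-sound v# (k ∸ 2) u∈)) (ℕₚ.m+[n∸m]≡n deg≤)))

    linear-⊥ : ∀ {a b} → a ∈ˢ E → b ∈ˢ E → 1 ≤ k → ∀ u → u ∈ monomials v# (k ∸ 1) →
               dot (coords φ) (mulMon M k u (linJ M a b)) ≡ 0ℚ
    linear-⊥ {a} {b} a∈E b∈E deg≤ u u∈ = begin
      dot (coords φ) (mulMon M k u (linJ M a b))            ≡⟨ dot-lin (coords φ) u a b ⟩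
      ∑ (allFin v#) (λ i → coef a b i * hat (coords φ) (unitMon i +ᵐ u))
        ≡⟨ ∑-cong (allFin v#) (λ i → cong (coef a b i *_) (trans (hat-coords {φ} (unitMon i +ᵐ u) (deg≡ i)) (A.sym↭ (wordOf-unit+ x i u)))) ⟩
      ∑ (allFin v#) (λ i → coef a b i * φ (x i ∷ wordOf x u))
        ≡⟨ ∑-coef a b (λ i → φ (x i ∷ wordOf x u)) ⟩
      ∑ (allFin v#) (λ i → if a ∈ᵇ x i then φ (x i ∷ wordOf x u) else 0ℚ) - ∑ (allFin v#) (λ i → if b ∈ᵇ x i then φ (x i ∷ wordOf x u) else 0ℚ)
        ≡⟨ cong₂ _-_ (θ-x A a (wordOf x u)) (θ-x A b (wordOf x u)) ⟨
      θ a φ (wordOf x u) - θ b φ (wordOf x u)               ≡⟨ cong (_- θ b φ (wordOf x u)) (A.lin a∈E b∈E (wordOf x u)) ⟩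
      θ b φ (wordOf x u) - θ b φ (wordOf x u)               ≡⟨ ℚₚ.+-inverseʳ (θ b φ (wordOf x u)) ⟩
      0ℚ ∎
      where
      deg≡ : ∀ i → deg (unitMon i +ᵐ u) ≡ k
      deg≡ i = trans (deg-unit+ i u) (trans (cong suc (monomials-sound v# (k ∸ 1) u∈)) (ℕₚ.m+[n∸m]≡n deg≤))

    -- Pairing with a multiple of a quadratic generator evaluates `φ` at a word with two
    -- incomparable letters; pairing with a multiple of a linear generator gives the difference of
    -- `θ a φ` and `θ b φ` at a word.
    TopFree⇒⊥ : ∀ l → l ∈ idealSpan M k → dot (coords φ) l ≡ 0ℚ
    TopFree⇒⊥ l l∈ =
      let g , g∈ , deg≤ , u , u∈ , l≡ = idealSpan⁻ l∈ in
      trans (cong (dot (coords φ)) l≡) (go g (generators⁻ g∈) deg≤ u u∈)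
      where
      go : ∀ g → GeneratorView g → Generator.degree g ≤ k → ∀ u → u ∈ monomials v# (k ∸ Generator.degree g) →
           dot (coords φ) (mulMon M k u (Generator.poly g)) ≡ 0ℚ
      go _ (pair i i′ inc refl)   = pair-⊥ i i′ inc
      go _ (linear a∈E b∈E refl)  = linear-⊥ a∈E b∈E

  VarWord : ℕ → Word n → Set
  VarWord l w = length w ≡ l × All Proper w

  proper? : ∀ L → Dec (Proper L)
  proper? L = isFlat? L ×-dec (¬? (L ⊆? ∅) ×-dec ¬? (L ≟ˢ E))

  abstract
    varWord? : ∀ l w → Dec (VarWord l w)
    varWord? l w = (length w ℕₚ.≟ l) ×-dec All.all? proper? w

  letters : ∀ {w} → All Proper w → ∀ {L} → L ∈ w → ∃ λ i → L ≡ x i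
  letters ps L∈ = proper-x (All.lookup ps L∈)

  module FromVector (v : V N) (v⊥ : ∀ l → l ∈ idealSpan M k → dot v l ≡ 0ℚ) where

    -- The converse passage: a vector killing the ideal is read as a function of exponent vectors
    -- and extended by zero to words of other lengths or with letters that are not variables.
    φ : Fun
    φ w = if does (varWord? k w) then hat v (exponents x w) else 0ℚ

    φ-yes : ∀ {w} → VarWord k w → φ w ≡ hat v (exponents x w)
    φ-yes {w} p = cong (λ b → if b then hat v (exponents x w) else 0ℚ) (dec-true (varWord? k w) p)

    φ-no : ∀ {w} → ¬ VarWord k w → φ w ≡ 0ℚ
    φ-no {w} p = cong (λ b → if b then hat v (exponents x w) else 0ℚ) (dec-false (varWord? k w) p)

    VarWord-↭ : ∀ {l w w′} → w ↭ w′ → VarWord l w → VarWord l w′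
    VarWord-↭ p (len , ps) = trans (sym (↭ₚ.↭-length p)) len , ↭ₚ.All-resp-↭ p ps

    φ-sym : Sym φ
    φ-sym {w} {w′} p = case varWord? k w of λ
      { (yes q) → trans (φ-yes q) (trans (hat-cong v (λ i → count-↭ (x i) p)) (sym (φ-yes (VarWord-↭ p q))))
      ; (no ¬q) → trans (φ-no {w} ¬q) (sym (φ-no {w′} (¬q ∘ VarWord-↭ (↭-sym p)))) }

    pair-vanish : ∀ i i′ w → ¬ Comparable (x i) (x i′) → VarWord k (x i ∷ x i′ ∷ w) → φ (x i ∷ x i′ ∷ w) ≡ 0ℚ
    pair-vanish i i′ w inc q@(len , p ∷ p′ ∷ ps) = begin
      φ (x i ∷ x i′ ∷ w)                                       ≡⟨ φ-yes q ⟩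
      hat v (exponents x (x i ∷ x i′ ∷ w))                     ≡⟨ hat-cong v exps ⟩
      hat v ((unitMon i +ᵐ unitMon i′) +ᵐ u)                   ≡⟨ dot-pair v u i i′ ⟨
      dot v (mulMon M k u (pairPoly i i′))                     ≡⟨ v⊥ _ (idealSpan⁺ (pair∈ i i′ inc) 2≤k u∈) ⟩
      0ℚ ∎
      where
      2≤k : 2 ≤ k
      2≤k = subst (2 ≤_) len (s≤s (s≤s z≤n))
      complete : ∃ λ e → e ∈ monomials v# (k ∸ 2) × e ≗ exponents x w
      complete = monomials-complete v# (k ∸ 2) (exponents x w)
        (trans (deg-exponents x x-injective w (letters ps)) (cong (_∸ 2) len))
      u : Monomial v#
      u = proj₁ complete
      u∈ : u ∈ monomials v# (k ∸ 2)
      u∈ = proj₁ (proj₂ complete)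
      exps : exponents x (x i ∷ x i′ ∷ w) ≗ (unitMon i +ᵐ unitMon i′) +ᵐ u
      exps l = trans (exponents-∷ x x-injective i (x i′ ∷ w) l)
        (trans (cong (unitMon i l +_) (trans (exponents-∷ x x-injective i′ w l) (cong (unitMon i′ l +_) (sym (proj₂ (proj₂ complete) l)))))
               (sym (ℕₚ.+-assoc (unitMon i l) (unitMon i′ l) (u l))))

    incomparable-vanish : ∀ {L L′ w} → ¬ Comparable L L′ → VarWord k (L ∷ L′ ∷ w) → φ (L ∷ L′ ∷ w) ≡ 0ℚ
    incomparable-vanish {L} {L′} {w} inc q@(_ , p ∷ p′ ∷ _) = go (proper-x p) (proper-x p′) inc q
      where
      go : ∀ {L L′} → (∃ λ i → L ≡ x i) → (∃ λ i → L′ ≡ x i) → ¬ Comparable L L′ → VarWord k (L ∷ L′ ∷ w) → φ (L ∷ L′ ∷ w) ≡ 0ℚ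
      go (i , refl) (i′ , refl) = pair-vanish i i′ w

    ∈-↭ : ∀ {L : Subset n} {w} → L ∈ w → ∃ λ w′ → w ↭ L ∷ w′
    ∈-↭ {L} L∈ with ∈-∃++ L∈
    ... | ys , zs , refl = ys ++ zs , ↭ₚ.shift L ys zs

    -- A word in the variables that is not `Ok` has two incomparable letters; by symmetry they can
    -- be moved to the front, where the quadratic relations apply.
    φ-supp : Supp ∅ φ
    φ-supp w ¬ok = case varWord? k w of λ
      { (no ¬q) → φ-no {w} ¬q
      ; (yes q) → case All.all? (λ L → All.all? (comparable? L) w) w of λ
        { (yes cmp) → contradiction (chain-ok (proj₂ q) cmp) ¬ok
        ; (no ¬cmp) →
            let L , L∈ , ¬cmpL = find (Allₚ.¬All⇒Any¬ (λ L → All.all? (comparable? L) w) w ¬cmp)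
                L′ , L′∈ , inc = find (Allₚ.¬All⇒Any¬ (comparable? L) w ¬cmpL)
                w₁ , w↭ = ∈-↭ L∈
            in second q inc w↭ (↭ₚ.∈-resp-↭ w↭ L′∈) } }
      where
      chain-ok : All Proper w → All (λ L → All (Comparable L) w) w → Ok ∅ w
      chain-ok ps cmp = record
        { flat = λ L∈ → proj₁ (All.lookup ps L∈) ; above = λ L∈ → proper-above (All.lookup ps L∈)
        ; chain = λ L∈ L′∈ → All.lookup (All.lookup cmp L∈) L′∈ }
      second : ∀ {L L′ w₁} → VarWord k w → ¬ Comparable L L′ → w ↭ L ∷ w₁ → L′ ∈ L ∷ w₁ → φ w ≡ 0ℚ
      second q inc w↭ (here refl)   = ⊥-elim (inc (inj₁ ⊆-refl))
      second {L} q inc w↭ (there L′∈) =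
        let w₂ , w₁↭ = ∈-↭ L′∈
            perm     = ↭-trans w↭ (prep L w₁↭)
        in trans (φ-sym perm) (incomparable-vanish inc (VarWord-↭ perm q))

    θ-sum : ∀ {a w} → suc (length w) ≡ k → All Proper w →
      θ a φ w ≡ ∑ (allFin v#) (λ i → if a ∈ᵇ x i then hat v (unitMon i +ᵐ exponents x w) else 0ℚ)
    θ-sum {a} {w} len ps = begin
      θ a φ w ≡⟨ ∑-x (λ L → if a ∈ᵇ L then φ (L ∷ w) else 0ℚ)
                   (λ {L} _ improper → if-𝟘 (a ∈ᵇ L) (φ-no {L ∷ w} (λ { (_ , p ∷ _) → improper p }))) ⟨
      ∑ (allFin v#) (λ i → if a ∈ᵇ x i then φ (x i ∷ w) else 0ℚ)
        ≡⟨ ∑-cong (allFin v#) (λ i → cong (λ z → if a ∈ᵇ x i then z else 0ℚ)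
             (trans (φ-yes {x i ∷ w} (len , x-proper i ∷ ps)) (hat-cong v (exponents-∷ x x-injective i w)))) ⟩
      ∑ (allFin v#) (λ i → if a ∈ᵇ x i then hat v (unitMon i +ᵐ exponents x w) else 0ℚ) ∎

    φ-lin : ∀ {a b} → a ∈ˢ E → b ∈ˢ E → ∀ w → θ a φ w ≡ θ b φ w
    φ-lin {a} {b} a∈E b∈E w = case suc (length w) ℕₚ.≟ k of λ
      { (no ne) → trans (vanish a (λ (len , _) → ne len)) (sym (vanish b (λ (len , _) → ne len)))
      ; (yes len) → case All.all? proper? w of λ
        { (no ¬ps) → trans (vanish a (λ (_ , ps) → ¬ps ps)) (sym (vanish b (λ (_ , ps) → ¬ps ps)))
        ; (yes ps) → balanced len ps } }
      where
      vanish : ∀ c → ¬ (suc (length w) ≡ k × All Proper w) → θ c φ w ≡ 0ℚ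
      vanish c none = op-zero (c ∈ᵇ_) φ w (λ L _ _ → φ-no {L ∷ w} (λ { (len , _ ∷ ps) → none (len , ps) }))

      -- The difference is the pairing of `v` with the linear generator for `a` and `b` times the
      -- monomial of `w`, which lies in the ideal.
      balanced : suc (length w) ≡ k → All Proper w → θ a φ w ≡ θ b φ w
      balanced len ps = sub≡0⇒≡ (begin
        θ a φ w - θ b φ w
          ≡⟨ cong₂ _-_ (θ-sum {a} len ps) (θ-sum {b} len ps) ⟩
        ∑ (allFin v#) (λ i → if a ∈ᵇ x i then hat v (unitMon i +ᵐ exponents x w) else 0ℚ) -
        ∑ (allFin v#) (λ i → if b ∈ᵇ x i then hat v (unitMon i +ᵐ exponents x w) else 0ℚ)
          ≡⟨ ∑-coef a b (λ i → hat v (unitMon i +ᵐ exponents x w)) ⟨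
        ∑ (allFin v#) (λ i → coef a b i * hat v (unitMon i +ᵐ exponents x w))
          ≡⟨ ∑-cong (allFin v#) (λ i → cong (coef a b i *_) (hat-cong v (λ l → cong (unitMon i l +_) (sym (u≗ l))))) ⟩
        ∑ (allFin v#) (λ i → coef a b i * hat v (unitMon i +ᵐ u))
          ≡⟨ dot-lin v u a b ⟨
        dot v (mulMon M k u (linJ M a b))
          ≡⟨ v⊥ _ (idealSpan⁺ (linear∈ a∈E b∈E) (subst (1 ≤_) len (s≤s z≤n)) u∈) ⟩
        0ℚ ∎)
        where
        complete : ∃ λ e → e ∈ monomials v# (k ∸ 1) × e ≗ exponents x w
        complete = monomials-complete v# (k ∸ 1) (exponents x w)
          (trans (deg-exponents x x-injective w (letters ps)) (cong (_∸ 1) len))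
        u : Monomial v#
        u = proj₁ complete
        u∈ : u ∈ monomials v# (k ∸ 1)
        u∈ = proj₁ (proj₂ complete)
        u≗ : u ≗ exponents x w
        u≗ = proj₂ (proj₂ complete)

    φ-TopFree : TopFree φ
    φ-TopFree = record
      { supp = φ-supp ; sym↭ = φ-sym
      ; free = λ w E∈w → φ-no {w} (λ { (_ , ps) → proj₂ (proj₂ (All.lookup ps E∈w)) refl })
      ; lin = φ-lin }

    φ-coords : ∀ j → coords φ j ≡ v j
    φ-coords j = trans (φ-yes {wordOf x (e# j)} (trans (length-wordOf x (e# j)) (deg-e# j) , All.tabulate proper))
      (trans (hat-cong v (count-wordOf x x-injective (e# j))) (hat-e# v j (λ _ → refl)))
      where
      proper : ∀ {L} → L ∈ wordOf x (e# j) → Proper L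
      proper L∈ = let i , eq = ∈-wordOf⁻ x (e# j) L∈ in subst Proper (sym eq) (x-proper i)

  wordOf-E∉ : ∀ u → E ∉ wordOf x u
  wordOf-E∉ u = x≢E (wordOf x u) (∈-wordOf⁻ x u)

  length-e# : ∀ j → length (wordOf x (e# j)) ≡ k
  length-e# j = trans (length-wordOf x (e# j)) (deg-e# j)

  coords-determine : ∀ {φ} → Ann ∅ φ → (∀ j → coords φ j ≡ 0ℚ) → ∀ w → length w ≡ k → φ w ≡ 0ℚ
  coords-determine {φ} A vanish = top-determined k A (λ w E∉w len → case ok? ∅ w of λ
    { (no ¬ok) → supp A w ¬ok ; (yes ok) → free-vanish w E∉w len ok })
    where
    free-vanish : ∀ w → E ∉ w → length w ≡ k → Ok ∅ w → φ w ≡ 0ℚ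
    free-vanish w E∉w len ok =
      let j , e#≗ = degree-k (exponents x w) (trans (deg-exponents x x-injective w xs) len) in begin
      φ w                          ≡⟨ sym↭ A (wordOf-exponents x x-injective w xs) ⟨
      φ (wordOf x (exponents x w)) ≡⟨ cong φ (wordOf-cong x e#≗) ⟨
      coords φ j                   ≡⟨ vanish j ⟩
      0ℚ ∎
      where
      xs : ∀ {L} → L ∈ w → ∃ λ i → L ≡ x i
      xs L∈ = proper-x (flat ok L∈ , above-nonempty (above ok L∈) , λ { refl → E∉w L∈ })

  NW : List (Word n)
  NW = normalWords k ∅ k

  d : ℕ
  d = normalCount ∅ k

  _≟ʷ_ : ∀ (w w′ : Word n) → Dec (w ≡ w′)
  _≟ʷ_ = Listₚ.≡-dec _≟ˢ_

  dualWord : ∀ i → ∃ λ φ → Ann ∅ φ × (∀ w → w ∈ NW → φ w ≡ (if does (lookup NW i ≟ʷ w) then 1ℚ else 0ℚ))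
  dualWord i = normalWords-free k k ℕₚ.≤-refl flat∅ (λ w → if does (lookup NW i ≟ʷ w) then 1ℚ else 0ℚ)

  β : Fin d → Fun
  β i = proj₁ (dualWord i)

  β-Ann : ∀ i → Ann ∅ (β i)
  β-Ann i = proj₁ (proj₂ (dualWord i))

  β-dual : ∀ i j → β i (lookup NW j) ≡ δ i j
  β-dual i j = trans (proj₂ (proj₂ (dualWord i)) (lookup NW j) (∈-lookup {xs = NW} j))
    (cong (λ b → if b then 1ℚ else 0ℚ) (bool-ext
      (λ p → dec-true (i Fin.≟ j) (lookup-injective (normalWords-unique k ∅ k) i j (does⁻ (lookup NW i ≟ʷ lookup NW j) p)))
      (λ p → dec-true (lookup NW i ≟ʷ lookup NW j) (cong (lookup NW) (does⁻ (i Fin.≟ j) p)))))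

  combβ : (Fin d → ℚ) → Fun
  combβ c w = ∑ (allFin d) (λ i → c i * β i w)

  combβ-Ann : ∀ c → Ann ∅ (combβ c)
  combβ-Ann c = Ann-∑ (allFin d) c β-Ann

  combβ-NW : ∀ c j → combβ c (lookup NW j) ≡ c j
  combβ-NW c j = trans (∑-cong (allFin d) (λ i → trans (cong (c i *_) (trans (β-dual i j) (δ-sym i j))) (ℚₚ.*-comm (c i) (δ j i))))
    (∑-δˡ d j c)

  normalWords-length : ∀ w → w ∈ NW → length w ≡ k
  normalWords-length w = go k ∅ k
    where
    go : ∀ t F k {w} → w ∈ normalWords t F k → length w ≡ k
    go t       F zero    (here refl) = refl
    go (suc t) F (suc k) w∈ = trans (cong length w≡) (trans (cong suc (trans (length-pow G e w′) (cong (e +_) (go t G (k ∸ e) w′∈)))) (cong suc (ℕₚ.m+[n∸m]≡n e≤k)))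
      where open Head (∈-normalWords⁻ {t} {F} {k} w∈)

  coordsβ : Fin d → V N
  coordsβ i = coords (β i)

  -- The coordinate vectors of the functionals dual to the normal words form a basis of the
  -- annihilator of the ideal. A combination with zero coordinates vanishes on all words of length
  -- `k`, and its values on the normal words are its coefficients. A vector killing the ideal
  -- extends to a functional on D(∅); subtracting the combination with the same values on the normal
  -- words leaves zero.
  chow-basis : ∃ λ (b : Fin d → V N) → Independent (idealSpan M k) d b × (∀ v → Spanned (idealSpan M k) d b v)
  chow-basis = quotient-basis (idealSpan M k) d coordsβ β⊥ independent spanning
    where
    β⊥ : ∀ i l → l ∈ idealSpan M k → dot (coordsβ i) l ≡ 0ℚ
    β⊥ i l l∈ = trans (∑-cong (allFin N) (λ j → cong (_* l j) (sym (topFree-∉ (β i) (wordOf-E∉ (e# j))))))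
      (TopFree⇒⊥ (restrict-top (β-Ann i)) l l∈)

    independent : Independent [] d coordsβ
    independent c (_ , eq) i = trans (sym (combβ-NW c i))
      (coords-determine (combβ-Ann c) eq (lookup NW i) (normalWords-length _ (∈-lookup {xs = NW} i)))

    spanning : ∀ v → (∀ l → l ∈ idealSpan M k → dot v l ≡ 0ℚ) → Spanned [] d coordsβ v
    spanning v v⊥ = c , InSpan-cong zero-diff (InSpan-0 {L = []})
      where
      module Fv = FromVector v v⊥
      extended = extend-top Fv.φ-TopFree
      ψ : Fun
      ψ = proj₁ extended
      c : Fin d → ℚ
      c i = ψ (lookup NW i)
      diff : Fun
      diff w = ψ w ⊕ (ℚ.- 1ℚ) * combβ c w
      diff-Ann : Ann ∅ diff
      diff-Ann = Ann-⊕ (proj₁ (proj₂ extended)) (Ann-⊗ (ℚ.- 1ℚ) (combβ-Ann c))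
      neg1 : ∀ y z → y ⊕ (ℚ.- 1ℚ) * z ≡ y - z
      neg1 y z = cong (y ⊕_) (trans (sym (ℚₚ.neg-distribˡ-* 1ℚ z)) (cong (ℚ.-_) (ℚₚ.*-identityˡ z)))
      vanish : ∀ w → w ∈ NW → diff w ≡ 0ℚ
      vanish w w∈ = trans (neg1 (ψ w) (combβ c w)) (trans (cong (λ z → ψ z - combβ c z) (lookup-index w∈))
        (trans (cong (ψ (lookup NW (index w∈)) -_) (combβ-NW c (index w∈))) (ℚₚ.+-inverseʳ (c (index w∈)))))
      zero-diff : ∀ j → v j - comb d c coordsβ j ≡ 0ℚ
      zero-diff j = begin
        v j - comb d c coordsβ j
          ≡⟨ cong (_- comb d c coordsβ j) (trans (sym (Fv.φ-coords j)) (sym (proj₂ (proj₂ extended) _ (wordOf-E∉ (e# j))))) ⟩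
        ψ (wordOf x (e# j)) - combβ c (wordOf x (e# j))
          ≡⟨ neg1 (ψ (wordOf x (e# j))) (combβ c (wordOf x (e# j))) ⟨
        diff (wordOf x (e# j))
          ≡⟨ normalWords-determine k k ℕₚ.≤-refl flat∅ diff-Ann vanish (wordOf x (e# j)) (length-e# j) ⟩
        0ℚ ∎

  chowDim : ChowDim M k d
  chowDim = let b , ind , span = chow-basis in
    b , (λ { c (e , eq) → ind c (e , eq) }) , λ v → let c , (e , eq) = span v in c , e , eq

  chowDim-unique : ∀ d′ → ChowDim M k d′ → d′ ≡ d
  chowDim-unique d′ (b′ , ind′ , span′) = let b , ind , span = chow-basis in dimension-unique {L = idealSpan M k} d′ d b′ b
    (λ { c (e , eq) → ind′ c (e , eq) }) ind (λ i → span (b′ i)) (λ j → let c , e , eq = span′ (b j) in c , (e , eq))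

-- Formal power series.

module PowerSeries (𝕂 : Scalars) where
  open Scalars 𝕂
  open IsCommutativeRing isCommutativeRing using (distribʳ; zeroˡ; zeroʳ; *-assoc; *-comm)
  open import Algebra.Properties.CommutativeSemigroup (CommutativeRing.+-commutativeSemigroup commutativeRing) using (interchange)
  open import Algebra.Properties.Ring (CommutativeRing.ring commutativeRing) using (-‿distribˡ-*; -‿+-comm)
  open ≡-Reasoning

  private
    Series′ : Set
    Series′ = ℕ → K

  one : Series′
  one zero    = 𝟙
  one (suc k) = 𝟘

  X : Series′ → Series′
  X p zero    = 𝟘
  X p (suc k) = p k

  X^ : ℕ → Series′ → Series′
  X^ zero    p = p
  X^ (suc i) p = X (X^ i p)

  X-cong : ∀ {p q} → p ≗ q → X p ≗ X q
  X-cong h zero    = refl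
  X-cong h (suc k) = h k

  X-⊕ : ∀ p q → X (λ k → p k ⊕ q k) ≗ (λ k → X p k ⊕ X q k)
  X-⊕ p q zero    = sym (⊕-identityˡ 𝟘)
  X-⊕ p q (suc k) = refl

  X-∑ : ∀ {A : Set} (xs : List A) (f : A → Series′) → X (λ k → ∑ xs (λ x → f x k)) ≗ (λ k → ∑ xs (λ x → X (f x) k))
  X-∑ xs f zero    = sym (∑-0 xs)
  X-∑ xs f (suc k) = refl

  X^-eval : ∀ i p k → X^ i p k ≡ (if i ≤ᵇ k then p (k ∸ i) else 𝟘)
  X^-eval zero          p k       = refl
  X^-eval (suc i)       p zero    = refl
  X^-eval (suc zero)    p (suc k) = refl
  X^-eval (suc (suc i)) p (suc k) = X^-eval (suc i) p k

  -- (X + … + X^d)(1 - X) = X - X^(d+1), without subtraction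
  geometric : ∀ d p k → ∑ (downFrom d) (λ e → X^ (suc e) p k) ⊕ X^ (suc d) p k ≡
                        X p k ⊕ X (λ j → ∑ (downFrom d) (λ e → X^ (suc e) p j)) k
  geometric zero    p zero    = refl
  geometric zero    p (suc k) = ⊕-comm 𝟘 (p k)
  geometric (suc d) p k = begin
    (a ⊕ S) ⊕ X^ (suc (suc d)) p k       ≡⟨ cong (_⊕ X^ (suc (suc d)) p k) (trans (⊕-comm a S) (geometric d p k)) ⟩
    (X p k ⊕ X S′ k) ⊕ X^ (suc (suc d)) p k ≡⟨ ⊕-assoc (X p k) (X S′ k) _ ⟩
    X p k ⊕ (X S′ k ⊕ X (X^ (suc d) p) k) ≡⟨ cong (X p k ⊕_) (trans (⊕-comm _ _) (sym (X-⊕ (X^ (suc d) p) S′ k))) ⟩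
    X p k ⊕ X (λ j → X^ (suc d) p j ⊕ S′ j) k ∎
    where
    a = X^ (suc d) p k
    S = ∑ (downFrom d) (λ e → X^ (suc e) p k)
    S′ : Series′
    S′ j = ∑ (downFrom d) (λ e → X^ (suc e) p j)

  -- The hypothesis says that p and q become equal after multiplication by X - 1; this factor is
  -- cancelled coefficient by coefficient.
  X-1-injective : ∀ p q → (∀ k → X p k ⊕ q k ≡ X q k ⊕ p k) → p ≗ q
  X-1-injective p q h zero    = sym (trans (sym (⊕-identityˡ (q 0))) (trans (h 0) (⊕-identityˡ (p 0))))
  X-1-injective p q h (suc k) = sym (⊕-cancelʳ (p k) _ _ (trans (⊕-comm _ _) (trans (h (suc k))
    (trans (cong (_⊕ p (suc k)) (sym (X-1-injective p q h k))) (⊕-comm _ _)))))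

  ∑-upTo-suc : ∀ k (f : ℕ → K) → ∑ (upTo (suc k)) f ≡ f 0 ⊕ ∑ (upTo k) (f ∘ suc)
  ∑-upTo-suc k f = cong (f 0 ⊕_) (trans (cong (λ l → ∑ l f) (sym (Listₚ.map-upTo suc k))) (∑-map suc (upTo k) f))

  ∑-upTo-δ : ∀ m j (f : ℕ → K) → (m ≤ j → f j ≡ 𝟘) → ∑ (upTo m) (λ i → if j ≡ᵇ i then f i else 𝟘) ≡ f j
  ∑-upTo-δ m j f out with j ℕₚ.<? m
  ... | yes j<m = ∑-single (Uniqueₚ.upTo⁺ m) (∈-upTo⁺ j<m) (j ≡ᵇ_) f (dec-true (j ℕₚ.≟ j) refl)
          (λ i _ h → sym (does⁻ (j ℕₚ.≟ i) h))
  ... | no j≮m = trans (∑-zero∈ (upTo m) zero-term) (sym (out (ℕₚ.≮⇒≥ j≮m)))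
    where
    zero-term : ∀ i → i ∈ upTo m → (if j ≡ᵇ i then f i else 𝟘) ≡ 𝟘
    zero-term i i∈ = cong (λ b → if b then f i else 𝟘) (dec-false (j ℕₚ.≟ i) (λ { refl → j≮m (∈-upTo⁻ i∈) }))

  infixl 7 _⋆_
  _⋆_ : Series′ → Series′ → Series′
  (p ⋆ q) k = ∑ (upTo (suc k)) (λ i → p i ⊗ q (k ∸ i))

  ⋆-congʳ : ∀ p {q q′} → q ≗ q′ → p ⋆ q ≗ p ⋆ q′
  ⋆-congʳ p h k = ∑-cong (upTo (suc k)) (λ i → cong (p i ⊗_) (h (k ∸ i)))

  ⋆-congˡ : ∀ {p p′} q → p ≗ p′ → p ⋆ q ≗ p′ ⋆ q
  ⋆-congˡ q h k = ∑-cong (upTo (suc k)) (λ i → cong (_⊗ q (k ∸ i)) (h i))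

  ⋆-⊕ˡ : ∀ p p′ q k → ((λ i → p i ⊕ p′ i) ⋆ q) k ≡ (p ⋆ q) k ⊕ (p′ ⋆ q) k
  ⋆-⊕ˡ p p′ q k = trans (∑-cong (upTo (suc k)) (λ i → distribʳ (q (k ∸ i)) (p i) (p′ i))) (∑-+ (upTo (suc k)) _ _)

  X-⋆ : ∀ p q → X (p ⋆ q) ≗ X p ⋆ q
  X-⋆ p q zero    = sym (𝟘⊕𝟘 (zeroˡ (q 0)) refl)
  X-⋆ p q (suc k) = sym (trans (∑-upTo-suc (suc k) (λ i → X p i ⊗ q (suc k ∸ i)))
    (trans (cong (_⊕ (p ⋆ q) k) (zeroˡ (q (suc k)))) (⊕-identityˡ _)))

  monomial-⋆ : ∀ d c q k → ((λ i → if d ≡ᵇ i then c else 𝟘) ⋆ q) k ≡ c ⊗ X^ d q k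
  monomial-⋆ zero c q k = trans (∑-upTo-suc k (λ i → (if 0 ≡ᵇ i then c else 𝟘) ⊗ q (k ∸ i)))
    (trans (cong (c ⊗ q k ⊕_) (∑-zero (upTo k) (λ i → zeroˡ _))) (⊕-identityʳ _))
  monomial-⋆ (suc d) c q zero    = trans (𝟘⊕𝟘 (zeroˡ (q 0)) refl) (sym (zeroʳ c))
  monomial-⋆ (suc d) c q (suc k) = trans (∑-upTo-suc (suc k) (λ i → (if suc d ≡ᵇ i then c else 𝟘) ⊗ q (suc k ∸ i)))
    (trans (cong₂ _⊕_ (zeroˡ (q (suc k))) (monomial-⋆ d c q k)) (⊕-identityˡ _))

  ∑-⋆ : ∀ {A : Set} (xs : List A) (p : A → Series′) q k → ((λ i → ∑ xs (λ x → p x i)) ⋆ q) k ≡ ∑ xs (λ x → (p x ⋆ q) k)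
  ∑-⋆ xs p q k = trans (∑-cong (upTo (suc k)) (λ i → sym (∑-*ʳ xs (q (k ∸ i)) (λ x → p x i))))
    (∑-swap (upTo (suc k)) xs (λ i x → p x i ⊗ q (k ∸ i)))

-- Flats of restrictions and contractions at a flat.

module Minors {n : ℕ} (M : MatroidData n) (isM : IsMatroid M) {F : Subset n} (flatF : Flats.IsFlat M F) where
  open Flats M
  open MatroidProperties isM
  open IsMatroid isM

  private
    F⊆E : F ⊆ E
    F⊆E = proj₁ flatF

  module Restriction = Flats (M ∣ᴹ F)
  module Contraction = Flats (M /ᴹ F)

  restriction-flat⁻ : ∀ {G} → Restriction.IsFlat G → IsFlat G × G ⊆ F
  restriction-flat⁻ {G} (G⊆F , strict) = (⊆-trans G⊆F F⊆E , λ e e∈E e∉G → jump e e∈E e∉G) , G⊆F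
    where
    jump : ∀ e → e ∈ˢ E → e ∉ˢ G → r G < r (G ∪ ⁅ e ⁆)
    jump e e∈E e∉G with e ∈? F
    ... | yes e∈F = strict e e∈F e∉G
    -- An element outside the flat `F` raises the rank of `F`, hence by diminishing returns also
    -- that of the subset `G`.
    ... | no e∉F  = ℕₚ.+-cancelˡ-≤ (r F) (suc (r G)) (r (G ∪ ⁅ e ⁆)) (ℕₚ.≤-trans (ℕₚ.≤-reflexive (ℕₚ.+-suc (r F) (r G)))
            (ℕₚ.≤-trans (ℕₚ.+-monoˡ-≤ (r G) (proj₂ flatF e e∈E e∉F)) (submodular G⊆F F⊆E (⁅⁆⊆ e∈E))))

  restriction-flat⁺ : ∀ {G} → IsFlat G → G ⊆ F → Restriction.IsFlat G
  restriction-flat⁺ (_ , strict) G⊆F = G⊆F , λ e e∈F → strict e (F⊆E e∈F)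

  restriction-isFlatᵇ : ∀ G → isFlatᵇ (M ∣ᴹ F) G ≡ isFlatᵇ M G ∧ (G ⊆ᵇ F)
  restriction-isFlatᵇ G = bool-ext
    (λ h → let flatG , G⊆F = restriction-flat⁻ (Restriction.isFlatᵇ⁻ h) in ∧-true⁺ (isFlatᵇ⁺ flatG) (dec-true (G ⊆? F) G⊆F))
    (λ h → Restriction.isFlatᵇ⁺ (restriction-flat⁺ (isFlatᵇ⁻ (proj₁ (∧-true⁻ h))) (does⁻ (G ⊆? F) (proj₂ (∧-true⁻ {isFlatᵇ M G} h)))))

  ─⁻ : ∀ {X Y : Subset n} {x} → x ∈ˢ X ─ Y → x ∈ˢ X × x ∉ˢ Y
  ─⁻ {X} {Y} {x} x∈ = p─q⊆p X Y x∈ , go X Y x∈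
    where
    go : ∀ {n} (X Y : Subset n) {x} → x ∈ˢ X ─ Y → x ∉ˢ Y
    go (true ∷ X) (false ∷ Y) Data.Vec.here ()
    go (_ ∷ X)    (_ ∷ Y)     (Data.Vec.there x∈) (Data.Vec.there x∈Y) = go X Y x∈ x∈Y

  ─-∪ : ∀ {Y} → F ⊆ Y → (Y ─ F) ∪ F ≡ Y
  ─-∪ {Y} F⊆Y = ⊆-antisym (∪-lub (p─q⊆p Y F) F⊆Y)
    (λ {x} x∈Y → case x ∈? F of λ { (yes x∈F) → q⊆p∪q (Y ─ F) F x∈F ; (no x∉F) → p⊆p∪q F (x∈p∧x∉q⇒x∈p─q x∈Y x∉F) })

  ─-∪-⁅⁆ : ∀ {Y e} → F ⊆ Y → ((Y ─ F) ∪ ⁅ e ⁆) ∪ F ≡ Y ∪ ⁅ e ⁆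
  ─-∪-⁅⁆ {Y} {e} F⊆Y = ⊆-antisym
    (∪-lub (∪-lub (⊆-trans (p─q⊆p Y F) (p⊆p∪q ⁅ e ⁆)) (q⊆p∪q Y ⁅ e ⁆)) (⊆-trans F⊆Y (p⊆p∪q ⁅ e ⁆)))
    (∪-lub (subst (_⊆ ((Y ─ F) ∪ ⁅ e ⁆) ∪ F) (─-∪ F⊆Y) (∪-lub (⊆-trans (p⊆p∪q ⁅ e ⁆) (p⊆p∪q F)) (q⊆p∪q _ F)))
           (⊆-trans (q⊆p∪q (Y ─ F) ⁅ e ⁆) (p⊆p∪q F)))

  r/ : ∀ {Y} → F ⊆ Y → rk (M /ᴹ F) (Y ─ F) ≡ r Y ∸ r F
  r/ F⊆Y = cong (λ Z → r Z ∸ r F) (─-∪ F⊆Y)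

  contraction-flat⁻ : ∀ {Y} → F ⊆ Y → Contraction.IsFlat (Y ─ F) → IsFlat Y
  contraction-flat⁻ {Y} F⊆Y (Y─F⊆ , strict) = Y⊆E , λ e e∈E e∉Y →
    ℕₚ.≰⇒> (λ le → ℕₚ.<⇒≱ (subst (_< r (Y ∪ ⁅ e ⁆) ∸ r F) (r/ F⊆Y)
      (subst (rk (M /ᴹ F) (Y ─ F) <_) (cong (λ Z → r Z ∸ r F) (─-∪-⁅⁆ F⊆Y))
        (strict e (x∈p∧x∉q⇒x∈p─q e∈E (e∉Y ∘ F⊆Y)) (e∉Y ∘ p─q⊆p Y F)))) (ℕₚ.∸-monoˡ-≤ (r F) le))
    where
    Y⊆E : Y ⊆ E
    Y⊆E = subst (_⊆ E) (─-∪ F⊆Y) (∪-lub (⊆-trans Y─F⊆ (p─q⊆p E F)) F⊆E)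

  contraction-flat⁺ : ∀ {Y} → F ⊆ Y → IsFlat Y → Contraction.IsFlat (Y ─ F)
  contraction-flat⁺ {Y} F⊆Y (Y⊆E , strict) =
    (λ x∈ → let x∈Y , x∉F = ─⁻ {Y} {F} x∈ in x∈p∧x∉q⇒x∈p─q (Y⊆E x∈Y) x∉F) ,
    λ e e∈ e∉ → let e∈E , e∉F = ─⁻ {E} {F} e∈ in
      subst (rk (M /ᴹ F) (Y ─ F) <_) (sym (cong (λ Z → r Z ∸ r F) (─-∪-⁅⁆ F⊆Y)))
        (subst (_< r (Y ∪ ⁅ e ⁆) ∸ r F) (sym (r/ F⊆Y))
          (ℕₚ.∸-monoˡ-< (strict e e∈E (λ e∈Y → e∉ (x∈p∧x∉q⇒x∈p─q e∈Y e∉F))) (r-mono F⊆Y Y⊆E)))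

  contraction-isMatroid : IsMatroid (M /ᴹ F)
  contraction-isMatroid = record
    { R1 = λ X X⊆ → ℕₚ.m≤n+o⇒m∸n≤o _ (r F) (ℕₚ.≤-trans (ℕₚ.≤-trans (ℕₚ.m≤m+n _ _) (R3 X F (↓ X⊆) F⊆E))
        (ℕₚ.≤-trans (ℕₚ.+-monoˡ-≤ (r F) (R1 X (↓ X⊆))) (ℕₚ.≤-reflexive (ℕₚ.+-comm ∣ X ∣ (r F)))))
    ; R2 = λ X Y X⊆Y Y⊆ → ℕₚ.∸-monoˡ-≤ (r F) (r-mono (∪-lub (⊆-trans X⊆Y (p⊆p∪q F)) (q⊆p∪q Y F)) (↑ Y⊆))
    ; R3 = λ X Y X⊆ Y⊆ → ∸-submodular (r F) (r≥ (∪-lub X⊆ Y⊆)) (r≥ (⊆-trans (p∩q⊆p X Y) X⊆)) (r≥ X⊆) (r≥ Y⊆)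
        (ℕₚ.≤-trans (ℕₚ.+-mono-≤
            (r-mono (∪-lub (∪-lub (⊆-trans (p⊆p∪q F) (p⊆p∪q _)) (⊆-trans (p⊆p∪q F) (q⊆p∪q (X ∪ F) _))) (⊆-trans (q⊆p∪q X F) (p⊆p∪q _)))
                    (∪-lub (↑ X⊆) (↑ Y⊆)))
            (r-mono (∪-lub (λ x∈ → let p , q = x∈p∩q⁻ X Y x∈ in x∈p∩q⁺ (p⊆p∪q F p , p⊆p∪q F q)) (λ x∈ → x∈p∩q⁺ (q⊆p∪q X F x∈ , q⊆p∪q Y F x∈)))
                    (⊆-trans (p∩q⊆p (X ∪ F) _) (↑ X⊆))))
          (R3 (X ∪ F) (Y ∪ F) (↑ X⊆) (↑ Y⊆))) }
    where
    ↓ : ∀ {X} → X ⊆ E ─ F → X ⊆ E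
    ↓ X⊆ = ⊆-trans X⊆ (p─q⊆p E F)
    ↑ : ∀ {X} → X ⊆ E ─ F → X ∪ F ⊆ E
    ↑ X⊆ = ∪-lub (↓ X⊆) F⊆E
    r≥ : ∀ {X} → X ⊆ E ─ F → r F ≤ r (X ∪ F)
    r≥ {X} X⊆ = r-mono (q⊆p∪q X F) (↑ X⊆)
    -- Because `f` lies below all four numbers the truncated subtractions are exact, and adding
    -- `f + f` on both sides restores the original inequality.
    ∸-submodular : ∀ f {a b c d} → f ≤ a → f ≤ b → f ≤ c → f ≤ d → a + b ≤ c + d → (a ∸ f) + (b ∸ f) ≤ (c ∸ f) + (d ∸ f)
    ∸-submodular f {a} {b} {c} {d} fa fb fc fd le = ℕₚ.+-cancelˡ-≤ (f + f) _ _
      (subst₂ _≤_ (sym (regroup fa fb)) (sym (regroup fc fd)) le)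
      where
      regroup : ∀ {p q} → f ≤ p → f ≤ q → f + f + ((p ∸ f) + (q ∸ f)) ≡ p + q
      regroup {p} {q} fp fq = trans (interchange f f (p ∸ f) (q ∸ f)) (cong₂ _+_ (ℕₚ.m+[n∸m]≡n fp) (ℕₚ.m+[n∸m]≡n fq))
        where open import Algebra.Properties.CommutativeSemigroup ℕₚ.+-commutativeSemigroup using (interchange)

  -- Flatness of `F` says that every remaining element raises its rank, and one element raises it by
  -- at most 1.
  contraction-loopless : Loopless (M /ᴹ F)
  contraction-loopless e e∈ = let e∈E , e∉F = ─⁻ {E} {F} e∈ in
    trans (cong (λ Z → r Z ∸ r F) (∪-comm ⁅ e ⁆ F))
      (trans (cong (_∸ r F) (ℕₚ.≤-antisym (r-∪-⁅⁆≤ F⊆E e∈E) (proj₂ flatF e e∈E e∉F))) (ℕₚ.m+n∸n≡m 1 (r F)))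

  ⊂-─⁺ : ∀ {G H} → F ⊆ G → G ⊂ H → (G ─ F) ⊂ (H ─ F)
  ⊂-─⁺ {G} {H} F⊆G (G⊆H , x , x∈H , x∉G) =
    (λ y∈ → let y∈G , y∉F = ─⁻ {G} {F} y∈ in x∈p∧x∉q⇒x∈p─q (G⊆H y∈G) y∉F) ,
    x , x∈p∧x∉q⇒x∈p─q x∈H (x∉G ∘ F⊆G) , x∉G ∘ p─q⊆p G F

  ⊂-─⁻ : ∀ {G H} → F ⊆ G → F ⊆ H → (G ─ F) ⊂ (H ─ F) → G ⊂ H
  ⊂-─⁻ {G} {H} F⊆G F⊆H (sub , x , x∈ , x∉) = let x∈H , x∉F = ─⁻ {H} {F} x∈ in
    subst (_⊆ H) (─-∪ F⊆G) (∪-lub (⊆-trans sub (p─q⊆p H F)) F⊆H) ,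
    x , x∈H , λ x∈G → x∉ (x∈p∧x∉q⇒x∈p─q x∈G x∉F)

-- Counting normal words, Möbius inversion, and the passage to contractions.

module Counting (𝕂 : Scalars) where
  open Scalars 𝕂
  open PowerSeries 𝕂
  open IsCommutativeRing isCommutativeRing using (distribˡ; zeroˡ; zeroʳ; *-assoc; *-comm) renaming (*-identityˡ to ⊗-identityˡ)
  open ≡-Reasoning

  card : ∀ {A : Set} → List A → K
  card xs = ∑ xs (λ _ → 𝟙)

  module _ {n : ℕ} (M : MatroidData n) where
    open Flats M
    open NormalWords M
    open FlatSums 𝕂 M

    -- The Hilbert function of D(F), counted by normal words with the degree as fuel, and taken in
    -- the ring so that it can be combined with Möbius values.
    v : Subset n → ℕ → K
    v F k = card (normalWords k F k)

    card-block : ∀ t k G e → k ≤ t → card (block t k G e) ≡ X^ e (v G) k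
    card-block t k G e k≤t = trans (go (e ≤ᵇ k)) (sym (X^-eval e (v G) k))
      where
      go : ∀ b → card (if b then map (pow G (suc e)) (normalWords t G (k ∸ e)) else []) ≡ (if b then v G (k ∸ e) else 𝟘)
      go true  = trans (∑-map (pow G (suc e)) (normalWords t G (k ∸ e)) (λ _ → 𝟙))
        (cong card (normalWords-fuel t (k ∸ e) G (k ∸ e) (ℕₚ.≤-trans (ℕₚ.m∸n≤m k e) k≤t) ℕₚ.≤-refl))
      go false = refl

    v-suc : ∀ F k → v F (suc k) ≡ ∑ (flatsAbove F) (λ G → ∑ (downFrom (r G ∸ r F ∸ 1)) (λ e → X^ e (v G) k))
    v-suc F k = trans (∑-concatMap (λ G → concatMap (block k k G) (downFrom (r G ∸ r F ∸ 1))) (flatsAbove F) (λ _ → 𝟙))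
      (∑-cong (flatsAbove F) (λ G → trans (∑-concatMap (block k k G) (downFrom (r G ∸ r F ∸ 1)) (λ _ → 𝟙))
        (∑-cong (downFrom (r G ∸ r F ∸ 1)) (λ e → card-block k k G e ℕₚ.≤-refl))))

    geom : Subset n → Subset n → ℕ → K
    geom F G k = ∑ (downFrom (r G ∸ r F ∸ 1)) (λ e → X^ (suc e) (v G) k)

    v-rec : ∀ F k → v F k ≡ one k ⊕ ∑ (flatsAbove F) (λ G → geom F G k)
    v-rec F zero    = cong (𝟙 ⊕_) (sym (∑-zero (flatsAbove F) (λ G → ∑-0 (downFrom (r G ∸ r F ∸ 1)))))
    v-rec F (suc k) = trans (v-suc F k) (sym (⊕-identityˡ _))

    ∑-upper : ∀ {F} → IsFlat F → (f : Subset n → K) → ∑ (flats M) (λ G → if F ⊆ᵇ G then f G else 𝟘) ≡ f F ⊕ ∑ (flatsAbove F) f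
    ∑-upper {F} flatF f = begin
      ∑ (flats M) (λ G → if F ⊆ᵇ G then f G else 𝟘)
        ≡⟨ ∑-cong (flats M) term ⟩
      ∑ (flats M) (λ G → (if does (G ≟ˢ F) then f G else 𝟘) ⊕ (if does (F ⊂? G) then f G else 𝟘))
        ≡⟨ ∑-+ (flats M) _ _ ⟩
      ∑ (flats M) (λ G → if does (G ≟ˢ F) then f G else 𝟘) ⊕ ∑ (flats M) (λ G → if does (F ⊂? G) then f G else 𝟘)
        ≡⟨ cong₂ _⊕_ (∑-at flatF f) (sym (∑-filter (F ⊂?_) (flats M) f)) ⟩
      f F ⊕ ∑ (flatsAbove F) f ∎
      where
      term : ∀ G → (if F ⊆ᵇ G then f G else 𝟘) ≡ (if does (G ≟ˢ F) then f G else 𝟘) ⊕ (if does (F ⊂? G) then f G else 𝟘)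
      term G with F ⊆? G | G ≟ˢ F | F ⊂? G
      ... | no F⊈G  | yes refl | _       = ⊥-elim (F⊈G ⊆-refl)
      ... | no F⊈G  | no _     | yes F⊂G = ⊥-elim (F⊈G (p⊂q⇒p⊆q F⊂G))
      ... | no _    | no _     | no _    = sym (⊕-identityˡ 𝟘)
      ... | yes _   | yes refl | yes F⊂F = contradiction F⊂F (⊂-irref refl)
      ... | yes _   | yes refl | no _    = sym (⊕-identityʳ _)
      ... | yes _   | no _     | yes _   = sym (⊕-identityˡ _)
      ... | yes F⊆G | no ne    | no F⊄G  with ⊆⇒≡⊎⊂ F⊆G
      ...   | inj₁ refl = contradiction refl ne
      ...   | inj₂ F⊂G  = contradiction F⊂G F⊄G

    module _ (isM : IsMatroid M) where
      open MatroidProperties isM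

      -- Σ_{G ⊇ F} (X^ρ - X) v_G = 1 - X, without subtraction
      v-upper : ∀ {F} → IsFlat F → ∀ k →
        ∑ (flats M) (λ G → if F ⊆ᵇ G then X^ (r G ∸ r F) (v G) k else 𝟘) ⊕ X one k ≡
        ∑ (flats M) (λ G → if F ⊆ᵇ G then X (v G) k else 𝟘) ⊕ one k
      v-upper {F} flatF k = begin
        ∑ (flats M) (λ G → if F ⊆ᵇ G then X^ (r G ∸ r F) (v G) k else 𝟘) ⊕ X one k
          ≡⟨ cong (_⊕ X one k) (∑-upper flatF (λ G → X^ (r G ∸ r F) (v G) k)) ⟩
        (X^ (r F ∸ r F) (v F) k ⊕ S) ⊕ X one k
          ≡⟨ cong (λ z → (z ⊕ S) ⊕ X one k) (trans (cong (λ d → X^ d (v F) k) (ℕₚ.n∸n≡0 (r F))) (v-rec F k)) ⟩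
        ((one k ⊕ ∑ W (λ G → geom F G k)) ⊕ S) ⊕ X one k
          ≡⟨ CM.solve 4 (λ a b c d → ((a CM.⊕ b) CM.⊕ c) CM.⊕ d CM.⊜ ((b CM.⊕ c) CM.⊕ d) CM.⊕ a) refl (one k) (∑ W (λ G → geom F G k)) S (X one k) ⟩
        ((∑ W (λ G → geom F G k) ⊕ S) ⊕ X one k) ⊕ one k
          ≡⟨ cong (λ z → (z ⊕ X one k) ⊕ one k) geometric-sum ⟩
        ((∑ W (λ G → X (v G) k) ⊕ ∑ W (λ G → X (geom F G) k)) ⊕ X one k) ⊕ one k
          ≡⟨ CM.solve 4 (λ a b c d → ((a CM.⊕ b) CM.⊕ c) CM.⊕ d CM.⊜ ((c CM.⊕ b) CM.⊕ a) CM.⊕ d) refl (∑ W (λ G → X (v G) k)) (∑ W (λ G → X (geom F G) k)) (X one k) (one k) ⟩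
        ((X one k ⊕ ∑ W (λ G → X (geom F G) k)) ⊕ ∑ W (λ G → X (v G) k)) ⊕ one k
          ≡⟨ cong (λ z → (z ⊕ ∑ W (λ G → X (v G) k)) ⊕ one k) (sym Xv) ⟩
        (X (v F) k ⊕ ∑ W (λ G → X (v G) k)) ⊕ one k
          ≡⟨ cong (_⊕ one k) (∑-upper flatF (λ G → X (v G) k)) ⟨
        ∑ (flats M) (λ G → if F ⊆ᵇ G then X (v G) k else 𝟘) ⊕ one k ∎
        where
        module CM = Algebra.Solver.CommutativeMonoid (CommutativeRing.+-commutativeMonoid commutativeRing)
        W = flatsAbove F
        S = ∑ W (λ G → X^ (r G ∸ r F) (v G) k)

        geometric-sum : ∑ W (λ G → geom F G k) ⊕ S ≡ ∑ W (λ G → X (v G) k) ⊕ ∑ W (λ G → X (geom F G) k)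
        geometric-sum = trans (sym (∑-+ W (λ G → geom F G k) _)) (trans (∑-cong∈ W each) (∑-+ W (λ G → X (v G) k) _))
          where
          each : ∀ G → G ∈ W → geom F G k ⊕ X^ (r G ∸ r F) (v G) k ≡ X (v G) k ⊕ X (geom F G) k
          each G G∈ = let flatG , F⊂G = ∈-flatsAbove⁻ G∈ in trans
            -- `geometric` is used with ρ - 1 in place of its `d`; its top exponent is then ρ,
            -- because ρ is positive for a flat strictly above `F`.
            (cong (λ d → geom F G k ⊕ X^ d (v G) k) (sym (ℕₚ.m+[n∸m]≡n {1} (ℕₚ.m<n⇒0<n∸m (r-strict flatF F⊂G (proj₁ flatG))))))
            (geometric (r G ∸ r F ∸ 1) (v G) k)

        Xv : X (v F) k ≡ X one k ⊕ ∑ W (λ G → X (geom F G) k)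
        Xv = trans (X-cong (v-rec F) k) (trans (X-⊕ one (λ j → ∑ W (λ G → geom F G j)) k) (cong (X one k ⊕_) (X-∑ W (geom F) k)))

      module Möbius (μ : Subset n → K)
        (∑μ : ∀ {F} → IsFlat F → ∑ (flats M) (λ G → if G ⊆ᵇ F then μ G else 𝟘) ≡ (if isEmptyᵇ F then 𝟙 else 𝟘)) where

        if-⊗ : ∀ b (c x : K) → (if b then c ⊗ x else 𝟘) ≡ c ⊗ (if b then x else 𝟘)
        if-⊗ true  c x = refl
        if-⊗ false c x = sym (zeroʳ c)

        if-⊗′ : ∀ b (c x : K) → c ⊗ (if b then x else 𝟘) ≡ (if b then c else 𝟘) ⊗ x
        if-⊗′ true  c x = refl
        if-⊗′ false c x = trans (zeroʳ c) (sym (zeroˡ x))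

        if-⊗″ : ∀ b (x : K) → (if b then 𝟙 else 𝟘) ⊗ x ≡ (if b then x else 𝟘)
        if-⊗″ true  x = ⊗-identityˡ x
        if-⊗″ false x = zeroˡ x

        -- Multiply `v-upper` at `G` by μ(G) and sum over `G`. The series 1 and X drop out, since
        -- the Möbius values of a nonempty matroid sum to zero. On the other side, summing over `G`
        -- below `F` first leaves only `F = ∅`.
        χ-v-sum : IsFlat ∅ → Nonempty E → ∀ k →
          ∑ (flats M) (λ F → ∑ (flats M) (λ G → if G ⊆ᵇ F then μ G ⊗ X^ (r F ∸ r G) (v F) k else 𝟘)) ≡ X (v ∅) k
        χ-v-sum flat∅ (a , a∈E) k = begin
          ∑ (flats M) (λ F → ∑ (flats M) (λ G → if G ⊆ᵇ F then μ G ⊗ X^ (r F ∸ r G) (v F) k else 𝟘))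
            ≡⟨ ∑-swap (flats M) (flats M) _ ⟩
          ∑ (flats M) (λ G → ∑ (flats M) (λ F → if G ⊆ᵇ F then μ G ⊗ X^ (r F ∸ r G) (v F) k else 𝟘))
            ≡⟨ ∑-cong (flats M) (λ G → trans (∑-cong (flats M) (λ F → if-⊗ (G ⊆ᵇ F) (μ G) _)) (∑-*ˡ (flats M) (μ G) _)) ⟩
          ∑ (flats M) (λ G → μ G ⊗ S G)
            ≡⟨ ⊕-identityʳ _ ⟨
          ∑ (flats M) (λ G → μ G ⊗ S G) ⊕ 𝟘
            ≡⟨ cong (∑ (flats M) (λ G → μ G ⊗ S G) ⊕_) (∑μ⊗ (X one k)) ⟨
          ∑ (flats M) (λ G → μ G ⊗ S G) ⊕ ∑ (flats M) (λ G → μ G ⊗ X one k)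
            ≡⟨ trans (sym (∑-+ (flats M) _ _)) (∑-cong (flats M) (λ G → sym (distribˡ (μ G) _ _))) ⟩
          ∑ (flats M) (λ G → μ G ⊗ (S G ⊕ X one k))
            ≡⟨ ∑-cong∈ (flats M) (λ G G∈ → cong (μ G ⊗_) (v-upper (∈-flats⁻ G∈) k)) ⟩
          ∑ (flats M) (λ G → μ G ⊗ (T′ G ⊕ one k))
            ≡⟨ trans (∑-cong (flats M) (λ G → distribˡ (μ G) _ _)) (∑-+ (flats M) _ _) ⟩
          ∑ (flats M) (λ G → μ G ⊗ T′ G) ⊕ ∑ (flats M) (λ G → μ G ⊗ one k)
            ≡⟨ trans (cong (∑ (flats M) (λ G → μ G ⊗ T′ G) ⊕_) (∑μ⊗ (one k))) (⊕-identityʳ _) ⟩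
          ∑ (flats M) (λ G → μ G ⊗ T′ G)
            ≡⟨ ∑-cong (flats M) (λ G → trans (sym (∑-*ˡ (flats M) (μ G) _)) (∑-cong (flats M) (λ F → if-⊗′ (G ⊆ᵇ F) (μ G) _))) ⟩
          ∑ (flats M) (λ G → ∑ (flats M) (λ F → (if G ⊆ᵇ F then μ G else 𝟘) ⊗ X (v F) k))
            ≡⟨ ∑-swap (flats M) (flats M) _ ⟩
          ∑ (flats M) (λ F → ∑ (flats M) (λ G → (if G ⊆ᵇ F then μ G else 𝟘) ⊗ X (v F) k))
            ≡⟨ ∑-cong∈ (flats M) (λ F F∈ → trans (∑-*ʳ (flats M) (X (v F) k) _) (trans (cong (_⊗ X (v F) k) (∑μ (∈-flats⁻ F∈))) (if-⊗″ (isEmptyᵇ F) _))) ⟩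
          ∑ (flats M) (λ F → if isEmptyᵇ F then X (v F) k else 𝟘)
            ≡⟨ ∑-at-∅ flat∅ (λ F → X (v F) k) ⟩
          X (v ∅) k ∎
          where
          S T′ : Subset n → K
          S G = ∑ (flats M) (λ F → if G ⊆ᵇ F then X^ (r F ∸ r G) (v F) k else 𝟘)
          T′ G = ∑ (flats M) (λ F → if G ⊆ᵇ F then X (v F) k else 𝟘)
          ∑μ⊗ : ∀ c → ∑ (flats M) (λ G → μ G ⊗ c) ≡ 𝟘
          ∑μ⊗ c = trans (∑-*ʳ (flats M) c μ) (trans (cong (_⊗ c) ∑μ-E) (zeroˡ c))
            where
            ∑μ-E : ∑ (flats M) μ ≡ 𝟘
            ∑μ-E = trans (∑-cong∈ (flats M) (λ G G∈ → cong (λ b → if b then μ G else 𝟘) (sym (dec-true (G ⊆? E) (proj₁ (∈-flats⁻ G∈))))))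
              (trans (∑μ E-flat) (cong (λ b → if b then 𝟙 else 𝟘) (dec-false (E ⊆? ∅) (λ E⊆∅ → ∉⊥ (E⊆∅ a∈E)))))

  ∑-allSubsets-suc : ∀ {n} (g : Subset (suc n) → K) → ∑ (allSubsets (suc n)) g ≡
    ∑ (allSubsets n) (λ X → g (true ∷ X)) ⊕ ∑ (allSubsets n) (λ X → g (false ∷ X))
  ∑-allSubsets-suc {n} g = trans (∑-++ (map (true ∷_) (allSubsets n)) _ g)
    (cong₂ _⊕_ (∑-map (true ∷_) (allSubsets n) g) (∑-map (false ∷_) (allSubsets n) g))

  -- Removing `F` is a bijection from the sets containing `F` to the sets disjoint from `F`, and `g`
  -- vanishes on all others.
  ∑-contract : ∀ {n} (F : Subset n) (g : Subset n → K) → (∀ {X x} → x ∈ˢ X → x ∈ˢ F → g X ≡ 𝟘) →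
    ∑ (allSubsets n) g ≡ ∑ (allSubsets n) (λ Y → if F ⊆ᵇ Y then g (Y ─ F) else 𝟘)
  ∑-contract []          g vanish = refl
  ∑-contract {suc n} (true ∷ F) g vanish = begin
    ∑ (allSubsets (suc n)) g
      ≡⟨ ∑-allSubsets-suc g ⟩
    ∑ (allSubsets n) (λ X → g (true ∷ X)) ⊕ ∑ (allSubsets n) (λ X → g (false ∷ X))
      ≡⟨ cong₂ _⊕_ (∑-zero (allSubsets n) (λ X → vanish Data.Vec.here Data.Vec.here))
           (∑-contract F (λ X → g (false ∷ X)) (λ p q → vanish (Data.Vec.there p) (Data.Vec.there q))) ⟩
    𝟘 ⊕ ∑ (allSubsets n) (λ Y → if F ⊆ᵇ Y then g (false ∷ (Y ─ F)) else 𝟘)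
      ≡⟨ ⊕-comm _ _ ⟩
    ∑ (allSubsets n) (λ Y → if F ⊆ᵇ Y then g (false ∷ (Y ─ F)) else 𝟘) ⊕ 𝟘
      ≡⟨ cong (∑ (allSubsets n) (λ Y → if F ⊆ᵇ Y then g (false ∷ (Y ─ F)) else 𝟘) ⊕_) (∑-0 (allSubsets n)) ⟨
    ∑ (allSubsets n) (λ Y → if F ⊆ᵇ Y then g (false ∷ (Y ─ F)) else 𝟘) ⊕ ∑ (allSubsets n) (λ _ → 𝟘)
      ≡⟨ ∑-allSubsets-suc (λ Y → if (true ∷ F) ⊆ᵇ Y then g (Y ─ (true ∷ F)) else 𝟘) ⟨
    ∑ (allSubsets (suc n)) (λ Y → if (true ∷ F) ⊆ᵇ Y then g (Y ─ (true ∷ F)) else 𝟘) ∎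
  ∑-contract {suc n} (false ∷ F) g vanish = begin
    ∑ (allSubsets (suc n)) g
      ≡⟨ ∑-allSubsets-suc g ⟩
    ∑ (allSubsets n) (λ X → g (true ∷ X)) ⊕ ∑ (allSubsets n) (λ X → g (false ∷ X))
      ≡⟨ cong₂ _⊕_ (∑-contract F (λ X → g (true ∷ X)) (λ p q → vanish (Data.Vec.there p) (Data.Vec.there q)))
           (∑-contract F (λ X → g (false ∷ X)) (λ p q → vanish (Data.Vec.there p) (Data.Vec.there q))) ⟩
    ∑ (allSubsets n) (λ Y → if F ⊆ᵇ Y then g (true ∷ (Y ─ F)) else 𝟘) ⊕ ∑ (allSubsets n) (λ Y → if F ⊆ᵇ Y then g (false ∷ (Y ─ F)) else 𝟘)
      ≡⟨ ∑-allSubsets-suc (λ Y → if (false ∷ F) ⊆ᵇ Y then g (Y ─ (false ∷ F)) else 𝟘) ⟨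
    ∑ (allSubsets (suc n)) (λ Y → if (false ∷ F) ⊆ᵇ Y then g (Y ─ (false ∷ F)) else 𝟘) ∎

  module _ {n : ℕ} (M : MatroidData n) (isM : IsMatroid M) {F : Subset n} (flatF : Flats.IsFlat M F) where
    open Flats M
    open MatroidProperties isM
    open Minors M isM flatF
    module N = NormalWords M
    module N/ = NormalWords (M /ᴹ F)

    ∑-flatsAbove-contract : ∀ {G} → F ⊆ G → (f h : Subset n → K) → (∀ {Y} → IsFlat Y → G ⊂ Y → f (Y ─ F) ≡ h Y) →
      ∑ (N/.flatsAbove (G ─ F)) f ≡ ∑ (N.flatsAbove G) h
    ∑-flatsAbove-contract {G} F⊆G f h f≡h = begin
      ∑ (N/.flatsAbove (G ─ F)) f
        ≡⟨ trans (∑-filter ((G ─ F) ⊂?_) (flats (M /ᴹ F)) f) (∑-filterᵇ (isFlatᵇ (M /ᴹ F)) (allSubsets n) _) ⟩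
      ∑ (allSubsets n) g
        ≡⟨ ∑-contract F g (λ {X} {x} x∈X x∈F → vanish x∈X x∈F) ⟩
      ∑ (allSubsets n) (λ Y → if F ⊆ᵇ Y then g (Y ─ F) else 𝟘)
        ≡⟨ ∑-cong (allSubsets n) term ⟩
      ∑ (allSubsets n) (λ Y → if isFlatᵇ M Y then (if does (G ⊂? Y) then h Y else 𝟘) else 𝟘)
        ≡⟨ trans (∑-filter (G ⊂?_) (flats M) h) (∑-filterᵇ (isFlatᵇ M) (allSubsets n) _) ⟨
      ∑ (N.flatsAbove G) h ∎
      where
      g : Subset n → K
      g X = if isFlatᵇ (M /ᴹ F) X then (if does ((G ─ F) ⊂? X) then f X else 𝟘) else 𝟘

      vanish : ∀ {X x} → x ∈ˢ X → x ∈ˢ F → g X ≡ 𝟘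
      vanish {X} x∈X x∈F with isFlatᵇ (M /ᴹ F) X in eq
      ... | false = refl
      ... | true  = contradiction x∈F (proj₂ (─⁻ {E} {F} (proj₁ (Contraction.isFlatᵇ⁻ eq) x∈X)))

      term : ∀ Y → (if F ⊆ᵇ Y then g (Y ─ F) else 𝟘) ≡ (if isFlatᵇ M Y then (if does (G ⊂? Y) then h Y else 𝟘) else 𝟘)
      term Y = case F ⊆? Y of λ
        { (yes F⊆Y) → trans (cong (λ b → if b then g (Y ─ F) else 𝟘) (dec-true (F ⊆? Y) F⊆Y)) (above-term F⊆Y)
        ; (no F⊈Y) → trans (cong (λ b → if b then g (Y ─ F) else 𝟘) (dec-false (F ⊆? Y) F⊈Y)) (sym (not-above F⊈Y)) }
        where
        not-above : ¬ F ⊆ Y → (if isFlatᵇ M Y then (if does (G ⊂? Y) then h Y else 𝟘) else 𝟘) ≡ 𝟘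
        not-above F⊈Y with isFlatᵇ M Y | G ⊂? Y
        ... | false | _       = refl
        ... | true  | no _    = refl
        ... | true  | yes G⊂Y = ⊥-elim (F⊈Y (⊆-trans F⊆G (p⊂q⇒p⊆q G⊂Y)))

        above-term : F ⊆ Y → g (Y ─ F) ≡ (if isFlatᵇ M Y then (if does (G ⊂? Y) then h Y else 𝟘) else 𝟘)
        above-term F⊆Y rewrite bool-ext {isFlatᵇ (M /ᴹ F) (Y ─ F)} {isFlatᵇ M Y}
            (λ p → isFlatᵇ⁺ (contraction-flat⁻ F⊆Y (Contraction.isFlatᵇ⁻ p)))
            (λ p → Contraction.isFlatᵇ⁺ (contraction-flat⁺ F⊆Y (isFlatᵇ⁻ p)))
          | bool-ext {does ((G ─ F) ⊂? (Y ─ F))} {does (G ⊂? Y)}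
            (λ p → dec-true (G ⊂? Y) (⊂-─⁻ F⊆G F⊆Y (does⁻ ((G ─ F) ⊂? (Y ─ F)) p)))
            (λ p → dec-true ((G ─ F) ⊂? (Y ─ F)) (⊂-─⁺ F⊆G (does⁻ (G ⊂? Y) p)))
          with isFlatᵇ M Y in flatᵇ | G ⊂? Y
        ... | false | _       = refl
        ... | true  | no _    = refl
        ... | true  | yes G⊂Y = f≡h (isFlatᵇ⁻ flatᵇ) G⊂Y

    -- Removing `F` identifies the flats above `G` in the matroid with those above `G ─ F` in the
    -- contraction and preserves rank differences, which are all that normal words depend on.
    card-contract : ∀ t k {G} → IsFlat G → F ⊆ G → card (N/.normalWords t (G ─ F) k) ≡ card (N.normalWords t G k)
    card-contract t       zero    flatG F⊆G = refl
    card-contract zero    (suc k) flatG F⊆G = refl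
    card-contract (suc t) (suc k) {G} flatG F⊆G = trans
      (∑-concatMap (λ H → concatMap (N/.block t k H) (downFrom (rk (M /ᴹ F) H ∸ rk (M /ᴹ F) (G ─ F) ∸ 1))) (N/.flatsAbove (G ─ F)) (λ _ → 𝟙))
      (trans (∑-flatsAbove-contract F⊆G _ _ each)
        (sym (∑-concatMap (λ H → concatMap (N.block t k H) (downFrom (r H ∸ r G ∸ 1))) (N.flatsAbove G) (λ _ → 𝟙))))
      where
      each : ∀ {H} → IsFlat H → G ⊂ H →
        card (concatMap (N/.block t k (H ─ F)) (downFrom (rk (M /ᴹ F) (H ─ F) ∸ rk (M /ᴹ F) (G ─ F) ∸ 1))) ≡
        card (concatMap (N.block t k H) (downFrom (r H ∸ r G ∸ 1)))
      each {H} flatH G⊂H = trans (∑-concatMap (N/.block t k (H ─ F)) (downFrom (rk (M /ᴹ F) (H ─ F) ∸ rk (M /ᴹ F) (G ─ F) ∸ 1)) (λ _ → 𝟙))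
        (trans (cong (λ d → ∑ (downFrom (d ∸ 1)) (λ e → card (N/.block t k (H ─ F) e))) ranks)
          (trans (∑-cong (downFrom (r H ∸ r G ∸ 1)) blocks) (sym (∑-concatMap (N.block t k H) (downFrom (r H ∸ r G ∸ 1)) (λ _ → 𝟙)))))
        where
        F⊆H : F ⊆ H
        F⊆H = ⊆-trans F⊆G (p⊂q⇒p⊆q G⊂H)
        ranks : rk (M /ᴹ F) (H ─ F) ∸ rk (M /ᴹ F) (G ─ F) ≡ r H ∸ r G
        ranks = trans (cong₂ _∸_ (r/ F⊆H) (r/ F⊆G)) (trans (ℕₚ.∸-+-assoc (r H) (r F) (r G ∸ r F))
          (cong (r H ∸_) (ℕₚ.m+[n∸m]≡n (r-mono F⊆G (proj₁ flatG)))))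
        blocks : ∀ e → card (N/.block t k (H ─ F) e) ≡ card (N.block t k H e)
        blocks e with e ≤ᵇ k
        ... | false = refl
        ... | true  = trans (∑-map (pow (H ─ F) (suc e)) (N/.normalWords t (H ─ F) (k ∸ e)) (λ _ → 𝟙))
                (trans (card-contract t (k ∸ e) flatH F⊆H) (sym (∑-map (pow H (suc e)) (N.normalWords t H (k ∸ e)) (λ _ → 𝟙))))

    v-contract : ∀ k → v (M /ᴹ F) ∅ k ≡ v M F k
    v-contract k = trans (cong (λ Z → card (N/.normalWords k Z k)) (sym F─F≡∅)) (card-contract k k flatF ⊆-refl)
      where
      F─F≡∅ : F ─ F ≡ ∅
      F─F≡∅ = Empty-unique (λ { (x , x∈) → let p , q = ─⁻ {F} {F} x∈ in q p })

-- Möbius function, characteristic polynomial and the recursion for the counts.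

open import Data.Integer using (ℤ; +_)
import Data.Integer as ℤ
import Data.Integer.Properties as ℤₚ

ℤ-scalars : Scalars
ℤ-scalars = record { isCommutativeRing = ℤₚ.+-*-isCommutativeRing }

module CharacteristicPolynomial {n : ℕ} (M : MatroidData n) (isM : IsMatroid M) where
  open Scalars ℤ-scalars
  open PowerSeries ℤ-scalars
  open Counting ℤ-scalars
  open Flats M
  open MatroidProperties isM
  open FlatSums ℤ-scalars M
  open ≡-Reasoning

  infix 4 _⊊ᵇ_
  _⊊ᵇ_ : Subset n → Subset n → Bool
  G ⊊ᵇ F = (G ⊆ᵇ F) ∧ not (F ⊆ᵇ G)

  ⊊ᵇ⁻ : ∀ {G F} → (G ⊊ᵇ F) ≡ true → G ⊂ F
  ⊊ᵇ⁻ {G} {F} h with G ⊆? F | F ⊆? G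
  ... | yes G⊆F | no F⊈G = G⊆F , ⊈⇒∃∉ F⊈G

  -- The recursion passes to strictly smaller sets, so any fuel above the size of `G` gives the same
  -- value.
  μ-fuel-stable : ∀ t t′ G → ∣ G ∣ < t → ∣ G ∣ < t′ → μ-fuel t M G ≡ μ-fuel t′ M G
  μ-fuel-stable (suc t) (suc t′) G (s≤s lt) (s≤s lt′) = cong (λ z → if isEmptyᵇ G then + 1 else ℤ.- z)
    (∑-cong∈ (filter (λ H → (H ⊊ᵇ G) Data.Bool.≟ true) (flats M)) {μ-fuel t M} {μ-fuel t′ M} (λ H H∈ →
      let H⊂G = ⊊ᵇ⁻ {H} {G} (proj₂ (∈-filter⁻ (λ H → (H ⊊ᵇ G) Data.Bool.≟ true) {xs = flats M} H∈))
          smaller = p⊂q⇒∣p∣<∣q∣ H⊂G in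
      μ-fuel-stable t t′ H (ℕₚ.<-≤-trans smaller lt) (ℕₚ.<-≤-trans smaller lt′)))

  ∑-below : ∀ {F} → IsFlat F → (f : Subset n → ℤ) → ∑ (flats M) (λ G → if G ⊆ᵇ F then f G else + 0) ≡
    f F ⊕ ∑ (filter (λ G → (G ⊊ᵇ F) Data.Bool.≟ true) (flats M)) f
  ∑-below {F} flatF f = begin
    ∑ (flats M) (λ G → if G ⊆ᵇ F then f G else + 0)
      ≡⟨ ∑-cong (flats M) term ⟩
    ∑ (flats M) (λ G → (if does (G ≟ˢ F) then f G else + 0) ⊕ (if G ⊊ᵇ F then f G else + 0))
      ≡⟨ ∑-+ (flats M) (λ G → if does (G ≟ˢ F) then f G else + 0) (λ G → if G ⊊ᵇ F then f G else + 0) ⟩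
    ∑ (flats M) (λ G → if does (G ≟ˢ F) then f G else + 0) ⊕ ∑ (flats M) (λ G → if G ⊊ᵇ F then f G else + 0)
      ≡⟨ cong₂ _⊕_ (∑-at flatF f)
                   (sym (∑-filterᵇ (_⊊ᵇ F) (flats M) f)) ⟩
    f F ⊕ ∑ (filter (λ G → (G ⊊ᵇ F) Data.Bool.≟ true) (flats M)) f ∎
    where
    term : ∀ G → (if G ⊆ᵇ F then f G else + 0) ≡ (if does (G ≟ˢ F) then f G else + 0) ⊕ (if G ⊊ᵇ F then f G else + 0)
    term G with G ≟ˢ F | G ⊆? F | F ⊆? G
    ... | yes refl | no G⊈G  | _       = ⊥-elim (G⊈G ⊆-refl)
    ... | yes refl | yes _   | no G⊈G  = ⊥-elim (G⊈G ⊆-refl)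
    ... | yes refl | yes _   | yes _   = sym (ℤₚ.+-identityʳ (f G))
    ... | no _     | no _    | _       = refl
    ... | no _     | yes _   | no _    = sym (ℤₚ.+-identityˡ (f G))
    ... | no G≢F   | yes G⊆F | yes F⊆G = contradiction (⊆-antisym G⊆F F⊆G) G≢F

  ∑-μ∅ : ∀ {F} → IsFlat F → ∑ (flats M) (λ G → if G ⊆ᵇ F then μ∅ M G else + 0) ≡ (if isEmptyᵇ F then + 1 else + 0)
  ∑-μ∅ {F} flatF = trans (∑-below flatF (μ∅ M)) (trans (cong (μ∅ M F ⊕_) stable) cancel)
    where
    below = filter (λ G → (G ⊊ᵇ F) Data.Bool.≟ true) (flats M)
    ∈-below : ∀ {G} → G ∈ below → G ⊂ F
    ∈-below {G} G∈ = ⊊ᵇ⁻ {G} {F} (proj₂ (∈-filter⁻ (λ G → (G ⊊ᵇ F) Data.Bool.≟ true) {xs = flats M} G∈))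
    -- Unfolding `μ∅` at `F` leaves fuel `n` in the sum, one less than in `μ∅`; this suffices for
    -- proper subsets of `F`.
    stable : ∑ below (μ∅ M) ≡ ∑ below (μ-fuel n M)
    stable = ∑-cong∈ below {μ∅ M} {μ-fuel n M} (λ G G∈ → let lt = ℕₚ.<-≤-trans (p⊂q⇒∣p∣<∣q∣ (∈-below G∈)) (∣p∣≤n F) in
      μ-fuel-stable (suc n) n G (ℕₚ.m<n⇒m<1+n lt) lt)
    cancel : μ∅ M F ⊕ ∑ below (μ-fuel n M) ≡ (if isEmptyᵇ F then + 1 else + 0)
    cancel with F ⊆? ∅
    ... | yes F⊆∅ = cong (+ 1 ⊕_) (∑-zero∈ below (λ G G∈ → let _ , x , x∈F , _ = ∈-below G∈ in contradiction (F⊆∅ x∈F) ∉⊥))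
    ... | no _    = ℤₚ.+-inverseˡ (∑ below (μ-fuel n M))

  module _ {F : Subset n} (flatF : IsFlat F) where
    open Minors M isM flatF

    ∑-restrict : ∀ (f : Subset n → ℤ) → ∑ (flats (M ∣ᴹ F)) f ≡ ∑ (flats M) (λ G → if G ⊆ᵇ F then f G else + 0)
    ∑-restrict f = trans (∑-filterᵇ (isFlatᵇ (M ∣ᴹ F)) (allSubsets n) f)
      (trans (∑-cong (allSubsets n) (λ G → trans (cong (λ b → if b then f G else + 0) (restriction-isFlatᵇ G)) (sym (if-∧ (isFlatᵇ M G) (G ⊆ᵇ F)))))
        (sym (∑-filterᵇ (isFlatᵇ M) (allSubsets n) (λ G → if G ⊆ᵇ F then f G else + 0))))

    -- The Möbius value at `G` depends only on the flats below `G`, and below `F` the restriction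
    -- has the same flats.
    μ-fuel-restrict : ∀ t G → G ⊆ F → μ-fuel t (M ∣ᴹ F) G ≡ μ-fuel t M G
    μ-fuel-restrict zero    G G⊆F = refl
    μ-fuel-restrict (suc t) G G⊆F = cong (λ z → if isEmptyᵇ G then + 1 else ℤ.- z) (begin
      ∑ (filter (λ H → (H ⊊ᵇ G) Data.Bool.≟ true) (flats (M ∣ᴹ F))) (μ-fuel t (M ∣ᴹ F))
        ≡⟨ ∑-filterᵇ (_⊊ᵇ G) (flats (M ∣ᴹ F)) (μ-fuel t (M ∣ᴹ F)) ⟩
      ∑ (flats (M ∣ᴹ F)) (λ H → if H ⊊ᵇ G then μ-fuel t (M ∣ᴹ F) H else + 0)
        ≡⟨ ∑-restrict (λ H → if H ⊊ᵇ G then μ-fuel t (M ∣ᴹ F) H else + 0) ⟩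
      ∑ (flats M) (λ H → if H ⊆ᵇ F then (if H ⊊ᵇ G then μ-fuel t (M ∣ᴹ F) H else + 0) else + 0)
        ≡⟨ ∑-cong (flats M) term ⟩
      ∑ (flats M) (λ H → if H ⊊ᵇ G then μ-fuel t M H else + 0)
        ≡⟨ ∑-filterᵇ (_⊊ᵇ G) (flats M) (μ-fuel t M) ⟨
      ∑ (filter (λ H → (H ⊊ᵇ G) Data.Bool.≟ true) (flats M)) (μ-fuel t M) ∎)
      where
      term : ∀ H → (if H ⊆ᵇ F then (if H ⊊ᵇ G then μ-fuel t (M ∣ᴹ F) H else + 0) else + 0) ≡ (if H ⊊ᵇ G then μ-fuel t M H else + 0)
      term H = case H ⊆? F of λ
        { (yes H⊆F) → trans (cong (λ b → if b then (if H ⊊ᵇ G then μ-fuel t (M ∣ᴹ F) H else + 0) else + 0) (dec-true (H ⊆? F) H⊆F))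
                        (if-cong (H ⊊ᵇ G) (λ _ → μ-fuel-restrict t H H⊆F))
        ; (no H⊈F) → trans (cong (λ b → if b then (if H ⊊ᵇ G then μ-fuel t (M ∣ᴹ F) H else + 0) else + 0) (dec-false (H ⊆? F) H⊈F))
                        (sym (outside-term H⊈F)) }
        where
        outside-term : ¬ H ⊆ F → (if H ⊊ᵇ G then μ-fuel t M H else + 0) ≡ + 0
        outside-term H⊈F with H ⊊ᵇ G in eq
        ... | false = refl
        ... | true  = ⊥-elim (H⊈F (⊆-trans (p⊂q⇒p⊆q (⊊ᵇ⁻ {H} {G} eq)) G⊆F))

    d : Subset n → ℕ
    d G = r F ∸ r G

    c : Subset n → ℤ
    c G = if G ⊆ᵇ F then μ∅ M G else + 0

    χ-restrict : ∀ i → χ (M ∣ᴹ F) i ≡ ∑ (flats M) (λ G → if d G ≡ᵇ i then c G else + 0)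
    χ-restrict i = trans (∑-restrict (λ G → if d G ≡ᵇ i then μ∅ (M ∣ᴹ F) G else + 0)) (∑-cong (flats M) term)
      where
      term : ∀ G → (if G ⊆ᵇ F then (if d G ≡ᵇ i then μ∅ (M ∣ᴹ F) G else + 0) else + 0) ≡ (if d G ≡ᵇ i then c G else + 0)
      term G = trans (if-cong (G ⊆ᵇ F) (λ h → cong (λ z → if d G ≡ᵇ i then z else + 0) (μ-fuel-restrict (suc n) G (does⁻ (G ⊆? F) h))))
        (if-swap (G ⊆ᵇ F) (d G ≡ᵇ i))

    χ-⋆ : ∀ p k → (χ (M ∣ᴹ F) *ˢ p) k ≡ ∑ (flats M) (λ G → if G ⊆ᵇ F then μ∅ M G ℤ.* X^ (d G) p k else + 0)
    χ-⋆ p k = begin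
      (χ (M ∣ᴹ F) ⋆ p) k
        ≡⟨ ⋆-congˡ {χ (M ∣ᴹ F)} {λ i → ∑ (flats M) (λ G → if d G ≡ᵇ i then c G else + 0)} p χ-restrict k ⟩
      ((λ i → ∑ (flats M) (λ G → if d G ≡ᵇ i then c G else + 0)) ⋆ p) k
        ≡⟨ ∑-⋆ (flats M) (λ G i → if d G ≡ᵇ i then c G else + 0) p k ⟩
      ∑ (flats M) (λ G → ((λ i → if d G ≡ᵇ i then c G else + 0) ⋆ p) k)
        ≡⟨ ∑-cong (flats M) (λ G → trans (monomial-⋆ (d G) (c G) p k) (if-* (G ⊆ᵇ F) (μ∅ M G) (X^ (d G) p k))) ⟩
      ∑ (flats M) (λ G → if G ⊆ᵇ F then μ∅ M G ℤ.* X^ (d G) p k else + 0) ∎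
      where
      if-* : ∀ b y z → (if b then y else + 0) ℤ.* z ≡ (if b then y ℤ.* z else + 0)
      if-* true  y z = refl
      if-* false y z = ℤₚ.*-zeroˡ z

    module _ (F⊈∅ : ¬ F ⊆ ∅) where

      χ̄-unfold : ∀ k → χ̄ (M ∣ᴹ F) k ≡ ∑ (upTo (suc (r F))) (λ i → if k <ᵇ i then χ (M ∣ᴹ F) i else + 0)
      χ̄-unfold k = cong (λ b → if b then (if k ≡ᵇ 0 then ℤ.- (+ 1) else + 0)
        else ∑ (upTo (suc (r F))) (λ i → if k <ᵇ i then χ (M ∣ᴹ F) i else + 0)) (dec-false (F ⊆? ∅) F⊈∅)

      -- The value of χ at 1 is the sum of all Möbius values below `F`, which is zero for nonempty
      -- `F`. This is divisibility by x - 1.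
      χ-total : ∑ (upTo (suc (r F))) (χ (M ∣ᴹ F)) ≡ + 0
      χ-total = begin
        ∑ (upTo (suc (r F))) (χ (M ∣ᴹ F))
          ≡⟨ ∑-cong (upTo (suc (r F))) χ-restrict ⟩
        ∑ (upTo (suc (r F))) (λ i → ∑ (flats M) (λ G → if d G ≡ᵇ i then c G else + 0))
          ≡⟨ ∑-swap (upTo (suc (r F))) (flats M) (λ i G → if d G ≡ᵇ i then c G else + 0) ⟩
        ∑ (flats M) (λ G → ∑ (upTo (suc (r F))) (λ i → if d G ≡ᵇ i then c G else + 0))
          ≡⟨ ∑-cong (flats M) (λ G → ∑-upTo-δ (suc (r F)) (d G) (λ _ → c G) (λ le → contradiction (ℕₚ.m∸n≤m (r F) (r G)) (ℕₚ.<⇒≱ le))) ⟩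
        ∑ (flats M) c
          ≡⟨ ∑-μ∅ flatF ⟩
        (if isEmptyᵇ F then + 1 else + 0)
          ≡⟨ cong (λ b → if b then + 1 else + 0) (dec-false (F ⊆? ∅) F⊈∅) ⟩
        + 0 ∎

      χ-high : ∀ k → r F < k → χ (M ∣ᴹ F) k ≡ + 0
      χ-high k lt = trans (χ-restrict k) (∑-zero (flats M) (λ G → cong (λ b → if b then c G else + 0)
        (dec-false (d G ℕₚ.≟ k) (λ { refl → ℕₚ.<⇒≱ lt (ℕₚ.m∸n≤m (r F) (r G)) }))))

      <ᵇ-split : ∀ k i (z : ℤ) → (if k <ᵇ i then z else + 0) ≡ (if suc k <ᵇ i then z else + 0) ⊕ (if suc k ≡ᵇ i then z else + 0)
      <ᵇ-split k       zero          z = refl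
      <ᵇ-split zero    (suc zero)    z = sym (ℤₚ.+-identityˡ z)
      <ᵇ-split zero    (suc (suc i)) z = sym (ℤₚ.+-identityʳ z)
      <ᵇ-split (suc k) (suc i)       z = <ᵇ-split k i z

      -- The identity x χ̄ = χ̄ + χ, that is (x - 1) χ̄ = χ. In positive degree two consecutive tail
      -- sums differ by one coefficient; in degree 0 the identity says that all coefficients of χ
      -- sum to zero.
      X-χ̄ : ∀ k → X (χ̄ (M ∣ᴹ F)) k ≡ χ̄ (M ∣ᴹ F) k ⊕ χ (M ∣ᴹ F) k
      X-χ̄ zero = sym (begin
        χ̄ (M ∣ᴹ F) 0 ⊕ χ (M ∣ᴹ F) 0
          ≡⟨ cong (_⊕ χ (M ∣ᴹ F) 0) (trans (χ̄-unfold 0) (trans (∑-upTo-suc (r F) (λ i → if 0 <ᵇ i then χ (M ∣ᴹ F) i else + 0))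
               (ℤₚ.+-identityˡ (∑ (upTo (r F)) (χ (M ∣ᴹ F) ∘ suc))))) ⟩
        ∑ (upTo (r F)) (χ (M ∣ᴹ F) ∘ suc) ⊕ χ (M ∣ᴹ F) 0
          ≡⟨ ℤₚ.+-comm (∑ (upTo (r F)) (χ (M ∣ᴹ F) ∘ suc)) (χ (M ∣ᴹ F) 0) ⟩
        χ (M ∣ᴹ F) 0 ⊕ ∑ (upTo (r F)) (χ (M ∣ᴹ F) ∘ suc)
          ≡⟨ ∑-upTo-suc (r F) (χ (M ∣ᴹ F)) ⟨
        ∑ (upTo (suc (r F))) (χ (M ∣ᴹ F))
          ≡⟨ χ-total ⟩
        + 0 ∎)
      X-χ̄ (suc k) = begin
        χ̄ (M ∣ᴹ F) k
          ≡⟨ χ̄-unfold k ⟩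
        ∑ (upTo (suc (r F))) (λ i → if k <ᵇ i then χ (M ∣ᴹ F) i else + 0)
          ≡⟨ ∑-cong (upTo (suc (r F))) (λ i → <ᵇ-split k i (χ (M ∣ᴹ F) i)) ⟩
        ∑ (upTo (suc (r F))) (λ i → (if suc k <ᵇ i then χ (M ∣ᴹ F) i else + 0) ⊕ (if suc k ≡ᵇ i then χ (M ∣ᴹ F) i else + 0))
          ≡⟨ ∑-+ (upTo (suc (r F))) (λ i → if suc k <ᵇ i then χ (M ∣ᴹ F) i else + 0) (λ i → if suc k ≡ᵇ i then χ (M ∣ᴹ F) i else + 0) ⟩
        ∑ (upTo (suc (r F))) (λ i → if suc k <ᵇ i then χ (M ∣ᴹ F) i else + 0) ⊕ ∑ (upTo (suc (r F))) (λ i → if suc k ≡ᵇ i then χ (M ∣ᴹ F) i else + 0)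
          ≡⟨ cong₂ _⊕_ (sym (χ̄-unfold (suc k))) (∑-upTo-δ (suc (r F)) (suc k) (χ (M ∣ᴹ F)) (λ le → χ-high (suc k) le)) ⟩
        χ̄ (M ∣ᴹ F) (suc k) ⊕ χ (M ∣ᴹ F) (suc k) ∎

      X-χ̄-⋆ : ∀ p k → X (χ̄ (M ∣ᴹ F) *ˢ p) k ≡ (χ̄ (M ∣ᴹ F) *ˢ p) k ⊕ (χ (M ∣ᴹ F) *ˢ p) k
      X-χ̄-⋆ p k = trans (X-⋆ (χ̄ (M ∣ᴹ F)) p k)
        (trans (⋆-congˡ {X (χ̄ (M ∣ᴹ F))} {λ i → χ̄ (M ∣ᴹ F) i ⊕ χ (M ∣ᴹ F) i} p X-χ̄ k) (⋆-⊕ˡ (χ̄ (M ∣ᴹ F)) (χ (M ∣ᴹ F)) p k))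

  module Recursion (loopless : Loopless M) (nonempty : Nonempty E) where

    flat∅ : IsFlat ∅
    flat∅ = ∅-flat loopless

    ∈-nonemptyFlats⁻ : ∀ {F} → F ∈ nonemptyFlats M → IsFlat F × ¬ F ⊆ ∅
    ∈-nonemptyFlats⁻ {F} F∈ = let p , q = ∈-filter⁻ (λ F → not (isEmptyᵇ F) Data.Bool.≟ true) {xs = flats M} F∈ in ∈-flats⁻ p , nonempty⁻ q
      where
      nonempty⁻ : not (isEmptyᵇ F) ≡ true → ¬ F ⊆ ∅
      nonempty⁻ h F⊆∅ with trans (sym (cong not (dec-true (F ⊆? ∅) F⊆∅))) h
      ... | ()

    ∑-nonempty : ∀ (f : Subset n → ℤ) → ∑ (flats M) f ≡ ∑ (nonemptyFlats M) f ⊕ f ∅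
    ∑-nonempty f = begin
      ∑ (flats M) f
        ≡⟨ ∑-cong (flats M) (λ F → term (isEmptyᵇ F) (f F)) ⟩
      ∑ (flats M) (λ F → (if not (isEmptyᵇ F) then f F else + 0) ⊕ (if isEmptyᵇ F then f F else + 0))
        ≡⟨ ∑-+ (flats M) (λ F → if not (isEmptyᵇ F) then f F else + 0) (λ F → if isEmptyᵇ F then f F else + 0) ⟩
      ∑ (flats M) (λ F → if not (isEmptyᵇ F) then f F else + 0) ⊕ ∑ (flats M) (λ F → if isEmptyᵇ F then f F else + 0)
        ≡⟨ cong₂ _⊕_ (sym (∑-filterᵇ (not ∘ isEmptyᵇ) (flats M) f)) (∑-at-∅ flat∅ f) ⟩
      ∑ (nonemptyFlats M) f ⊕ f ∅ ∎
      where
      term : ∀ b z → z ≡ (if not b then z else + 0) ⊕ (if b then z else + 0)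
      term true  z = sym (ℤₚ.+-identityˡ z)
      term false z = sym (ℤₚ.+-identityʳ z)

    -- The characteristic polynomial of the empty matroid is 1, as only the flat `∅` contributes.
    χ∅-⋆ : ∀ p k → (χ (M ∣ᴹ ∅) *ˢ p) k ≡ p k
    χ∅-⋆ p k = begin
      (χ (M ∣ᴹ ∅) *ˢ p) k
        ≡⟨ χ-⋆ flat∅ p k ⟩
      ∑ (flats M) (λ G → if G ⊆ᵇ ∅ then μ∅ M G ℤ.* X^ (r ∅ ∸ r G) p k else + 0)
        ≡⟨ ∑-at-∅ flat∅ (λ G → μ∅ M G ℤ.* X^ (r ∅ ∸ r G) p k) ⟩
      μ∅ M ∅ ℤ.* X^ (r ∅ ∸ r ∅) p k
        ≡⟨ cong₂ ℤ._*_ (cong (λ b → if b then + 1 else ℤ.- ∑ (filter (λ G → (G ⊊ᵇ ∅) Data.Bool.≟ true) (flats M)) (μ-fuel n M)) (dec-true (_⊆?_ {n} ∅ ∅) ⊆-refl))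
             (cong (λ e → X^ e p k) (ℕₚ.n∸n≡0 (r ∅))) ⟩
      + 1 ℤ.* p k
        ≡⟨ ℤₚ.*-identityˡ (p k) ⟩
      p k ∎

    -- In the sum of χ times the Hilbert series over all flats, the flat `∅` contributes H_M and the
    -- total is x H_M. Hence the nonempty flats contribute (x - 1) H_M; their χ is (x - 1) χ̄, and
    -- the factor x - 1 is cancelled.
    recursion : ∀ k → v M ∅ k ≡ sumSeries (nonemptyFlats M) (λ F → χ̄ (M ∣ᴹ F) *ˢ v M F) k
    recursion k = sym (X-1-injective P (v M ∅) step k)
      where
      NE = nonemptyFlats M
      P : ℕ → ℤ
      P k = ∑ NE (λ F → (χ̄ (M ∣ᴹ F) *ˢ v M F) k)
      open Möbius M isM (μ∅ M) ∑-μ∅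
      step : ∀ k → X P k ⊕ v M ∅ k ≡ X (v M ∅) k ⊕ P k
      step k = begin
        X P k ⊕ v M ∅ k
          ≡⟨ cong (_⊕ v M ∅ k) (trans (X-∑ NE (λ F → χ̄ (M ∣ᴹ F) *ˢ v M F) k)
               (trans (∑-cong∈ NE (λ F F∈ → let flatF , F⊈∅ = ∈-nonemptyFlats⁻ F∈ in X-χ̄-⋆ flatF F⊈∅ (v M F) k))
                 (∑-+ NE (λ F → (χ̄ (M ∣ᴹ F) *ˢ v M F) k) (λ F → (χ (M ∣ᴹ F) *ˢ v M F) k)))) ⟩
        (P k ⊕ ∑ NE (λ F → (χ (M ∣ᴹ F) *ˢ v M F) k)) ⊕ v M ∅ k
          ≡⟨ ℤₚ.+-assoc (P k) (∑ NE (λ F → (χ (M ∣ᴹ F) *ˢ v M F) k)) (v M ∅ k) ⟩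
        P k ⊕ (∑ NE (λ F → (χ (M ∣ᴹ F) *ˢ v M F) k) ⊕ v M ∅ k)
          ≡⟨ cong (λ z → P k ⊕ (∑ NE (λ F → (χ (M ∣ᴹ F) *ˢ v M F) k) ⊕ z)) (χ∅-⋆ (v M ∅) k) ⟨
        P k ⊕ (∑ NE (λ F → (χ (M ∣ᴹ F) *ˢ v M F) k) ⊕ (χ (M ∣ᴹ ∅) *ˢ v M ∅) k)
          ≡⟨ cong (P k ⊕_) (∑-nonempty (λ F → (χ (M ∣ᴹ F) *ˢ v M F) k)) ⟨
        P k ⊕ ∑ (flats M) (λ F → (χ (M ∣ᴹ F) *ˢ v M F) k)
          ≡⟨ cong (P k ⊕_) (trans (∑-cong∈ (flats M) (λ F F∈ → χ-⋆ (∈-flats⁻ F∈) (v M F) k)) (χ-v-sum flat∅ nonempty k)) ⟩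
        P k ⊕ X (v M ∅) k
          ≡⟨ ℤₚ.+-comm (P k) (X (v M ∅) k) ⟩
        X (v M ∅) k ⊕ P k ∎

-- The Hilbert series of the Chow ring, its recursion and its characterisation.

hilbert : ∀ {n} → MatroidData n → Series
hilbert M k = + NormalWords.normalCount M ∅ k

card-length : ∀ {A : Set} (xs : List A) → Counting.card ℤ-scalars xs ≡ + length xs
card-length []       = refl
card-length (x ∷ xs) = cong (ℤ._+_ (+ 1)) (card-length xs)

hilbert≡v : ∀ {n} (M : MatroidData n) k → Counting.v ℤ-scalars M ∅ k ≡ hilbert M k
hilbert≡v M k = card-length (NormalWords.normalWords M k ∅ k)

hilbert-unique : ∀ {n} (M : MatroidData n) → IsMatroid M → Loopless M → ∀ {h} → IsChowHilbert M h → h ≈ˢ hilbert M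
hilbert-unique M isM loopless isH k =
  let d , h≡ , dim = isH k in trans h≡ (cong +_ (ChowRing.chowDim-unique M isM loopless k d dim))

hilbert-isChowHilbert : ∀ {n} (M : MatroidData n) → IsMatroid M → Loopless M → ∀ {h} → h ≈ˢ hilbert M → IsChowHilbert M h
hilbert-isChowHilbert M isM loopless h≈ k = _ , h≈ k , ChowRing.chowDim M isM loopless k

sumSeries-cong : ∀ {A : Set} (xs : List A) (p : A → Series) {q q′ : A → Series} → (∀ x → x ∈ xs → q x ≈ˢ q′ x) →
  sumSeries xs (λ x → p x *ˢ q x) ≈ˢ sumSeries xs (λ x → p x *ˢ q′ x)
sumSeries-cong xs p {q} {q′} h k = ∑-cong∈ xs {λ x → (p x *ˢ q x) k} {λ x → (p x *ˢ q′ x) k}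
  (λ x x∈ → PowerSeries.⋆-congʳ ℤ-scalars (p x) {q x} {q′ x} (h x x∈) k)
  where open Scalars ℤ-scalars

hilbert-recursion : ∀ {n} (M : MatroidData n) → IsMatroid M → Loopless M → NonemptyMatroid M →
  hilbert M ≈ˢ sumSeries (nonemptyFlats M) (λ F → χ̄ (M ∣ᴹ F) *ˢ hilbert (M /ᴹ F))
hilbert-recursion M isM loopless nonempty k = trans (sym (hilbert≡v M k)) (trans (recursion k)
  (sumSeries-cong (nonemptyFlats M) (λ F → χ̄ (M ∣ᴹ F)) (λ F F∈ j →
    trans (sym (Counting.v-contract ℤ-scalars M isM (proj₁ (∈-nonemptyFlats⁻ F∈)) j)) (hilbert≡v (M /ᴹ F) j)) k))
  where open CharacteristicPolynomial.Recursion M isM loopless nonempty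

-- No flat lies strictly above `∅` when the ground set is empty, so the empty word is the only
-- normal word.
hilbert-empty : ∀ {n} (M : MatroidData n) → EmptyMatroid M → hilbert M ≈ˢ oneSeries
hilbert-empty M empty zero    = refl
hilbert-empty M empty (suc k) = trans (sym (hilbert≡v M (suc k)))
  (trans (Counting.v-suc ℤ-scalars M ∅ k) (∑-zero∈ (flatsAbove ∅) (λ G G∈ →
    let (G⊆E , _) , _ , x , x∈G , _ = ∈-flatsAbove⁻ {∅} G∈ in contradiction (x , G⊆E x∈G) empty)))
  where
  open Scalars ℤ-scalars
  open NormalWords M

module _ (Φ : ∀ {n : ℕ} → MatroidData n → Series)
  (Φ-empty : ∀ {n : ℕ} (M : MatroidData n) → IsMatroid M → EmptyMatroid M → Φ M ≈ˢ oneSeries)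
  (Φ-rec : ∀ {n : ℕ} (M : MatroidData n) → IsMatroid M → Loopless M → NonemptyMatroid M →
    Φ M ≈ˢ sumSeries (nonemptyFlats M) (λ F → χ̄ (M ∣ᴹ F) *ˢ Φ (M /ᴹ F))) where

  recursion-determines : ∀ t {n} (M : MatroidData n) → ∣ ground M ∣ < t → IsMatroid M → Loopless M → Φ M ≈ˢ hilbert M
  recursion-determines (suc t) M (s≤s lt) isM loopless k with nonempty? (ground M)
  ... | no empty = trans (Φ-empty M isM empty k) (sym (hilbert-empty M empty k))
  ... | yes nonempty = trans (Φ-rec M isM loopless nonempty k)
    (trans (sumSeries-cong (nonemptyFlats M) (λ F → χ̄ (M ∣ᴹ F)) (λ F F∈ → smaller F (∈-nonemptyFlats⁻ F∈)) k)
           (sym (hilbert-recursion M isM loopless nonempty k)))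
    where
    open CharacteristicPolynomial.Recursion M isM loopless nonempty
    open Flats M
    smaller : ∀ F → IsFlat F × ¬ F ⊆ ∅ → Φ (M /ᴹ F) ≈ˢ hilbert (M /ᴹ F)
    smaller F (flatF , F⊈∅) = recursion-determines t (M /ᴹ F)
      (ℕₚ.<-≤-trans (p∩q≢∅⇒∣p─q∣<∣p∣ (ground M) F (let x , x∈F , _ = ⊈⇒∃∉ F⊈∅ in x , x∈p∩q⁺ (proj₁ flatF x∈F , x∈F))) lt)
      contraction-isMatroid contraction-loopless
      where open Minors M isM flatF

theorem3p12 : (∀ {n : ℕ} (M : MatroidData n) → IsMatroid M → Loopless M → NonemptyMatroid M →
    (h : Series) (hF : Subset n → Series) →
    IsChowHilbert M h →
    (∀ F → F ∈ nonemptyFlats M → IsChowHilbert (M /ᴹ F) (hF F)) →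
    h ≈ˢ sumSeries (nonemptyFlats M) (λ F → χ̄ (M ∣ᴹ F) *ˢ hF F))
    ×
    (∀ (Φ : ∀ {n : ℕ} → MatroidData n → Series) →
    (∀ {n : ℕ} (M : MatroidData n) → IsMatroid M → EmptyMatroid M →
    Φ M ≈ˢ oneSeries) →
    (∀ {n : ℕ} (M : MatroidData n) → IsMatroid M → Loopless M → NonemptyMatroid M →
    Φ M ≈ˢ sumSeries (nonemptyFlats M) (λ F → χ̄ (M ∣ᴹ F) *ˢ Φ (M /ᴹ F))) →
    ∀ {n : ℕ} (M : MatroidData n) → IsMatroid M → Loopless M →
    IsChowHilbert M (Φ M))
theorem3p12 =
  (λ M isM loopless nonempty h hF isH isHF k → trans (hilbert-unique M isM loopless {h} isH k)
    (trans (hilbert-recursion M isM loopless nonempty k)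
      (sumSeries-cong (nonemptyFlats M) (λ F → χ̄ (M ∣ᴹ F)) (λ F F∈ j → sym (contracted M isM loopless nonempty F F∈ (isHF F F∈) j)) k))) ,
  (λ Φ Φ-empty Φ-rec M isM loopless →
    hilbert-isChowHilbert M isM loopless (recursion-determines Φ Φ-empty Φ-rec (suc ∣ ground M ∣) M ℕₚ.≤-refl isM loopless))
  where
  contracted : ∀ {n} (M : MatroidData n) (isM : IsMatroid M) (loopless : Loopless M) (nonempty : NonemptyMatroid M) F →
    F ∈ nonemptyFlats M → ∀ {h} → IsChowHilbert (M /ᴹ F) h → h ≈ˢ hilbert (M /ᴹ F)
  contracted M isM loopless nonempty F F∈ {h} = hilbert-unique (M /ᴹ F) contraction-isMatroid contraction-loopless {h}
    where
    open CharacteristicPolynomial.Recursion M isM loopless nonempty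
    open Minors M isM (proj₁ (∈-nonemptyFlats⁻ F∈))
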